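{- For each integer $h\ge1$, one has (as formal power series in $q$) $$\tilde a_h(q)=(-q;q)_\infty\sum_{j=0}^{\lceil h/2\rceil-1}q^h\binom{h-j-1}{j}_{q^2}\sum_{m\ge0}(q^{2m+1};q^2)_j\,q^{(2h-4j)m}$$ $$\qquad\qquad+(-q;q)_\infty\sum_{j=0}^{\lfloor h/2\rfloor-1}q^{3h-4j-3}\binom{h-j-2}{j}_{q^2}\sum_{m\ge0}(q^{2m+3};q^2)_j\,q^{(2h-4j-2)m}$$ and $$\tilde b_h(q)=(-q;q)_\infty\sum_{j=0}^{\lceil h/2\rceil-1}q^{h+j(j-1)/2}\binom{h-j-1}{j}_q\sum_{m\ge0}\frac{q^{(j+1)m}}{(-q^{m+1};q)_{h-j}}.$$
   Context: A partition $\lambda=(\lambda_1\ge\lambda_2\ge\dots\ge\lambda_\ell>0)$ of $n$ is drawn as its Ferrers diagram: left-adjusted rows of boxes, with $\lambda_i$ boxes in row $i$. The hook number of the box in row $i$ and column $j$ is the number of boxes in the L-shape consisting of that box, all boxes to its right in the same row, and all boxes below it in the same column. $\mathcal H(\lambda)$ denotes the multiset of all hook numbers of $\lambda$. Let $\mathcal O(n)$ be the set of partitions of $n$ all of whose parts are odd and $\mathcal D(n)$ the set of partitions of $n$ whose parts are pairwise distinct. For integers $h\ge1$ and $n\ge0$, define $$a_h(n)=\sum_{\lambda\in\mathcal O(n)}\#\{x\in\mathcal H(\lambda):x=h\},\qquad b_h(n)=\sum_{\lambda\in\mathcal D(n)}\#\{x\in\mathcal H(\lambda):x=h\},$$ counted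 with multiplicity, and set $\tilde a_h(q)=\sum_{n\ge0}a_h(n)q^n$, $\tilde b_h(q)=\sum_{n\ge0}b_h(n)q^n$. Notation: $(x;q)_0=1$, $(x;q)_n=\prod_{j=0}^{n-1}(1-xq^j)$ for $n\ge1$, $(x;q)_\infty=\lim_{n\to\infty}(x;q)_n$; for $0\le k\le n$, $\binom nk_q=\frac{(q;q)_n}{(q;q)_k(q;q)_{n-k}}$, and $\binom nk_{q^2}$ is this expression with $q$ replaced by $q^2$. Empty sums are $0$. -}

module Defs where

open import Data.Nat as ℕ using (ℕ; zero; suc; NonZero; z≤n; s≤s; ⌊_/2⌋; ⌈_/2⌉)
import Data.Nat.Properties as ℕ
open import Data.Nat.Divisibility using (_∣_; _∣?_)
import Data.Nat.ListAction as ℕ using (sum)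
open import Data.Integer as ℤ using (ℤ; +_; 0ℤ; 1ℤ)
import Data.Integer.Properties as ℤ
open import Data.Fin as Fin using (Fin; toℕ)
import Data.Fin.Properties as Fin
open import Data.Vec as Vec using (Vec)
open import Data.List using (List; []; _∷_; _++_; map; concatMap; filter; length; upTo)
open import Data.List.Membership.Propositional using (_∈_; find; lose)
open import Data.List.Relation.Binary.Disjoint.Propositional using (Disjoint)
open import Data.List.Membership.Propositional.Properties using (∈-map⁺; ∈-map⁻; ∈-upTo⁺; ∈-upTo⁻; ∈-filter⁺; ∈-filter⁻; ∈-concatMap⁺; ∈-concatMap⁻)
open import Data.List.Relation.Unary.All as All using (All; []; _∷_; all?)
import Data.List.Relation.Unary.All.Properties as All
open import Data.List.Relation.Unary.Any using (here; there)
open import Data.List.Relation.Unary.AllPairs as AllPairs using (AllPairs; []; _∷_)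
import Data.List.Relation.Unary.AllPairs.Properties as AllPairs
open import Data.List.Relation.Unary.Linked using (Linked; []; [-]; _∷_)
open import Data.List.Relation.Unary.Unique.Propositional using (Unique)
import Data.List.Relation.Unary.Unique.Propositional.Properties as Unique
open import Data.List.Relation.Unary.Unique.DecPropositional ℕ._≟_ using (unique?)
import Data.List.Properties as List
open import Data.Product using (∃; _×_; _,_; proj₁; proj₂; map₁)
open import Data.Sum using (_⊎_)
open import Function using (_⇔_; mk⇔)
open import Relation.Nullary using (¬_; Dec; ¬?; _×-dec_; _⊎-dec_)
open import Relation.Binary.PropositionalEquality
open import Algebra.Properties.CommutativeMonoid.Sum ℤ.+-0-commutativeMonoid using (sum-cong-≗; sum-replicate-zero; sum-init-last) renaming (sum to ∑ℤ)

record IsPartition (n : ℕ) (λs : List ℕ) : Set where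
  constructor isPartition
  field
    decreasing : Linked ℕ._≥_ λs
    positive   : All ℕ.NonZero λs
    size       : ℕ.sum λs ≡ n

-- The partitions whose diagram fits into a rectangle with ℓ rows and k columns.
inRectangle : (ℓ k : ℕ) → List (List ℕ)
inRectangle zero    k = [] ∷ []
inRectangle (suc ℓ) k = [] ∷ concatMap (λ a → map (suc a ∷_) (inRectangle ℓ (suc a))) (upTo k)

partitions : ℕ → List (List ℕ)
partitions n = filter (λ λs → ℕ.sum λs ℕ.≟ n) (inRectangle n n)

inRectangle-sound : ∀ ℓ k {λs} → λs ∈ inRectangle ℓ k →
                    Linked ℕ._≥_ λs × All ℕ.NonZero λs × All (ℕ._≤ k) λs
inRectangle-sound zero    k (here refl) = [] , [] , []
inRectangle-sound (suc ℓ) k (here refl) = [] , [] , []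
inRectangle-sound (suc ℓ) k (there p)
  with c , c∈ , q ← find (∈-concatMap⁻ (λ c → map (suc c ∷_) (inRectangle ℓ (suc c))) {upTo k} p)
  with μ , μ∈ , refl ← ∈-map⁻ (suc c ∷_) q
  with dec , pos , bnd ← inRectangle-sound ℓ (suc c) μ∈
  = link dec bnd , _ ∷ pos , ∈-upTo⁻ c∈ ∷ All.map (λ x≤ → ℕ.≤-trans x≤ (∈-upTo⁻ c∈)) bnd
  where
  link : ∀ {x xs} → Linked ℕ._≥_ xs → All (ℕ._≤ x) xs → Linked ℕ._≥_ (x ∷ xs)
  link []       []       = [-]
  link [-]      (y≤ ∷ _) = y≤ ∷ [-]
  link (r ∷ rs) (y≤ ∷ _) = y≤ ∷ (r ∷ rs)

inRectangle-complete : ∀ ℓ k {λs} → Linked ℕ._≥_ λs → All ℕ.NonZero λs → All (ℕ._≤ k) λs →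
                       length λs ℕ.≤ ℓ → λs ∈ inRectangle ℓ k
inRectangle-complete zero    k {[]}          _   _         _         _       = here refl
inRectangle-complete (suc ℓ) k {[]}          _   _         _         _       = here refl
inRectangle-complete (suc ℓ) k {suc c ∷ λs}  dec (_ ∷ pos) (c< ∷ _) (s≤s l≤) =
  there (∈-concatMap⁺ (λ c → map (suc c ∷_) (inRectangle ℓ (suc c))) {upTo k}
    (lose (∈-upTo⁺ c<) (∈-map⁺ (suc c ∷_)
      (inRectangle-complete ℓ (suc c) (unlink dec) pos (bounded dec) l≤))))
  where
  unlink : ∀ {x xs} → Linked ℕ._≥_ (x ∷ xs) → Linked ℕ._≥_ xs
  unlink [-]      = []
  unlink (_ ∷ rs) = rs

  bounded : ∀ {x xs} → Linked ℕ._≥_ (x ∷ xs) → All (ℕ._≤ x) xs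
  bounded [-]      = []
  bounded (r ∷ rs) = r ∷ All.map (λ y≤ → ℕ.≤-trans y≤ r) (bounded rs)

inRectangle-unique : ∀ ℓ k → Unique (inRectangle ℓ k)
inRectangle-unique zero    k = [] ∷ []
inRectangle-unique (suc ℓ) k = All.tabulate []≢ ∷ Unique.concat⁺
  (All.map⁺ (All.tabulate λ {c} _ → Unique.map⁺ List.∷-injectiveʳ (inRectangle-unique ℓ (suc c))))
  (AllPairs.map⁺ (AllPairs.map disjoint (Unique.upTo⁺ k)))
  where
  []≢ : ∀ {μ} → μ ∈ concatMap (λ c → map (suc c ∷_) (inRectangle ℓ (suc c))) (upTo k) → [] ≢ μ
  []≢ p refl
    with c , _ , q ← find (∈-concatMap⁻ (λ c → map (suc c ∷_) (inRectangle ℓ (suc c))) {upTo k} p)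
    with _ , _ , () ← ∈-map⁻ (suc c ∷_) q

  disjoint : ∀ {c d} → c ≢ d →
             Disjoint (map (suc c ∷_) (inRectangle ℓ (suc c))) (map (suc d ∷_) (inRectangle ℓ (suc d)))
  disjoint {c} {d} c≢d (p , q)
    with _ , _ , refl ← ∈-map⁻ (suc c ∷_) p
    with _ , _ , e    ← ∈-map⁻ (suc d ∷_) q
    = c≢d (ℕ.suc-injective (List.∷-injectiveˡ e))

∈-partitions : ∀ n λs → λs ∈ partitions n ⇔ IsPartition n λs
∈-partitions n λs = mk⇔ to from
  where
  to : λs ∈ partitions n → IsPartition n λs
  to p with p′ , size ← ∈-filter⁻ (λ λs → ℕ.sum λs ℕ.≟ n) {xs = inRectangle n n} p
       with dec , pos , _ ← inRectangle-sound n n p′ = isPartition dec pos size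

  parts≤ : ∀ xs → All (ℕ._≤ ℕ.sum xs) xs
  parts≤ []       = []
  parts≤ (x ∷ xs) = ℕ.m≤m+n x _ ∷ All.map (λ y≤ → ℕ.≤-trans y≤ (ℕ.m≤n+m _ x)) (parts≤ xs)

  length≤ : ∀ {xs} → All ℕ.NonZero xs → length xs ℕ.≤ ℕ.sum xs
  length≤ []                   = z≤n
  length≤ {suc x ∷ xs} (_ ∷ ps) = s≤s (ℕ.≤-trans (length≤ ps) (ℕ.m≤n+m _ x))

  from : IsPartition n λs → λs ∈ partitions n
  from (isPartition dec pos refl) =
    ∈-filter⁺ (λ λs → ℕ.sum λs ℕ.≟ n) (inRectangle-complete n n dec pos (parts≤ λs) (length≤ pos)) refl

partitions-unique : ∀ n → Unique (partitions n)
partitions-unique n = Unique.filter⁺ (λ λs → ℕ.sum λs ℕ.≟ n) (inRectangle-unique n n)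

Odd : ℕ → Set
Odd k = ¬ (2 ∣ k)

odd? : ∀ k → Dec (Odd k)
odd? k = ¬? (2 ∣? k)

𝒪 : ℕ → List (List ℕ)
𝒪 n = filter (all? odd?) (partitions n)

𝒟 : ℕ → List (List ℕ)
𝒟 n = filter unique? (partitions n)

-- (row , column), both counted from 0.
Box : Set
Box = ℕ × ℕ

boxes : List ℕ → List Box
boxes []       = []
boxes (r ∷ rs) = map (0 ,_) (upTo r) ++ map (map₁ suc) (boxes rs)

-- InHook b c: the box c lies in the L-shape of b; b itself satisfies both
-- disjuncts, but is counted only once in hook.
InHook : Box → Box → Set
InHook (i , j) (k , l) = (k ≡ i × j ℕ.≤ l) ⊎ (l ≡ j × i ℕ.≤ k)

inHook? : ∀ b c → Dec (InHook b c)
inHook? (i , j) (k , l) = (k ℕ.≟ i ×-dec j ℕ.≤? l) ⊎-dec (l ℕ.≟ j ×-dec i ℕ.≤? k)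

hook : List ℕ → Box → ℕ
hook λs b = length (filter (inHook? b) (boxes λs))

-- The multiset of hook numbers, as a list whose order is irrelevant.
ℋ : List ℕ → List ℕ
ℋ λs = map (hook λs) (boxes λs)

#hooks : ℕ → List ℕ → ℕ
#hooks h λs = length (filter (ℕ._≟ h) (ℋ λs))

a : ℕ → ℕ → ℕ
a h n = ℕ.sum (map (#hooks h) (𝒪 n))

b : ℕ → ℕ → ℕ
b h n = ℕ.sum (map (#hooks h) (𝒟 n))

-- Formal power series over ℤ in q: f n is the coefficient of qⁿ.
Series : Set
Series = ℕ → ℤ

infix  4 _≈_
infix  5 ∑ˢ
infixl 6 _+ˢ_ _-ˢ_
infixl 7 _*ˢ_
infix  8 -ˢ_
infix  9 q^_

_≈_ : Series → Series → Set
f ≈ g = ∀ n → f n ≡ g n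

1ˢ : Series
1ˢ zero    = 1ℤ
1ˢ (suc _) = 0ℤ

q^_ : ℕ → Series
(q^ zero)  n       = 1ˢ n
(q^ suc e) zero    = 0ℤ
(q^ suc e) (suc n) = (q^ e) n

_+ˢ_ _-ˢ_ _*ˢ_ : Series → Series → Series
(f +ˢ g) n = f n ℤ.+ g n
(f -ˢ g) n = f n ℤ.- g n
(f *ˢ g) n = ∑ℤ {suc n} λ i → f (toℕ i) ℤ.* g (n ℕ.∸ toℕ i)

-ˢ_ : Series → Series
(-ˢ f) n = ℤ.- f n

∑ˢ : (n : ℕ) → (Fin n → Series) → Series
∑ˢ n f k = ∑ℤ λ i → f i k

syntax ∑ˢ n (λ i → f) = ∑[ i < n ] f

-- The reciprocal 1/f exists since f has constant term 1.  The vector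
-- recipCoeffs f n lists the coefficients of 1/f of degrees n , n-1 , … , 0.
recipCoeffs : Series → (n : ℕ) → Vec ℤ (suc n)
recipCoeffs f zero    = 1ℤ Vec.∷ Vec.[]
recipCoeffs f (suc n) =
  (ℤ.- ∑ℤ λ i → f (suc (toℕ i)) ℤ.* Vec.lookup (recipCoeffs f n) i) Vec.∷ recipCoeffs f n

recip : (f : Series) → .(f 0 ≡ 1ℤ) → Series
recip f _ n = Vec.head (recipCoeffs f n)

lookup-recipCoeffs : ∀ f .(p : f 0 ≡ 1ℤ) n i → Vec.lookup (recipCoeffs f n) i ≡ recip f p (n ℕ.∸ toℕ i)
lookup-recipCoeffs f p zero    Fin.zero    = refl
lookup-recipCoeffs f p (suc n) Fin.zero    = refl
lookup-recipCoeffs f p (suc n) (Fin.suc i) = lookup-recipCoeffs f p n i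

*ˢ-recip : ∀ f (p : f 0 ≡ 1ℤ) → f *ˢ recip f p ≈ 1ˢ
*ˢ-recip f p zero    = cong (λ c → c ℤ.* 1ℤ ℤ.+ 0ℤ) p
*ˢ-recip f p (suc n) = begin
  f 0 ℤ.* (ℤ.- S) ℤ.+ S′  ≡⟨ cong₂ (λ c d → c ℤ.* (ℤ.- S) ℤ.+ d) p (sym S≡S′) ⟩
  1ℤ ℤ.* (ℤ.- S) ℤ.+ S    ≡⟨ cong (ℤ._+ S) (ℤ.*-identityˡ (ℤ.- S)) ⟩
  ℤ.- S ℤ.+ S             ≡⟨ ℤ.+-inverseˡ S ⟩
  0ℤ                      ∎
  where
  open ≡-Reasoning
  S S′ : ℤ
  S  = ∑ℤ λ i → f (suc (toℕ i)) ℤ.* Vec.lookup (recipCoeffs f n) i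
  S′ = ∑ℤ {suc n} λ i → f (suc (toℕ i)) ℤ.* recip f p (n ℕ.∸ toℕ i)
  S≡S′ : S ≡ S′
  S≡S′ = sum-cong-≗ λ i → cong (f (suc (toℕ i)) ℤ.*_) (lookup-recipCoeffs f p n i)

-- A limit of formal power series: every coefficient is eventually constant.
Convergent : (ℕ → Series) → Set
Convergent s = ∀ n → ∃ λ N → ∀ M → N ℕ.≤ M → s M n ≡ s N n

lim : (s : ℕ → Series) → Convergent s → Series
lim s c n = s (proj₁ (c n)) n

Summable : (ℕ → Series) → Set
Summable f = Convergent λ M → ∑[ m < M ] f (toℕ m)

-- Σ_{m ≥ 0} f m
∑∞ : (f : ℕ → Series) → Summable f → Series
∑∞ f c = lim (λ M → ∑[ m < M ] f (toℕ m)) c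

-- ⟨ x ⨾q^ d ⟩ n is (x;q^d)_n.
infix 9 ⟨_⨾q^_⟩_

⟨_⨾q^_⟩_ : Series → ℕ → ℕ → Series
⟨ x ⨾q^ d ⟩ zero  = 1ˢ
⟨ x ⨾q^ d ⟩ suc n = ⟨ x ⨾q^ d ⟩ n *ˢ (1ˢ -ˢ x *ˢ q^ (d ℕ.* n))

*ˢ-constant : ∀ f g → f 0 ≡ 1ℤ → g 0 ≡ 1ℤ → (f *ˢ g) 0 ≡ 1ℤ
*ˢ-constant f g p r = cong₂ (λ c d → c ℤ.* d ℤ.+ 0ℤ) p r

⨾-constant : ∀ x d n → x 0 ≡ 0ℤ → (⟨ x ⨾q^ d ⟩ n) 0 ≡ 1ℤ
⨾-constant x d zero    x₀ = refl
⨾-constant x d (suc n) x₀ = *ˢ-constant (⟨ x ⨾q^ d ⟩ n) (1ˢ -ˢ x *ˢ q^ (d ℕ.* n)) (⨾-constant x d n x₀)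
  (cong (λ c → 1ℤ ℤ.- (c ℤ.* (q^ (d ℕ.* n)) 0 ℤ.+ 0ℤ)) x₀)

1/⟨_⨾q^_⟩ : (x : Series) (d n : ℕ) → x 0 ≡ 0ℤ → Series
1/⟨ x ⨾q^ d ⟩ n x₀ = recip (⟨ x ⨾q^ d ⟩ n) (⨾-constant x d n x₀)

q^-constant : ∀ d .{{_ : NonZero d}} → (q^ d) 0 ≡ 0ℤ
q^-constant (suc d) = refl

-- The Gaussian binomial coefficient of n over k with q replaced by q^d, for k ≤ n.
binom[q^_] : (d : ℕ) .{{_ : NonZero d}} → ℕ → ℕ → Series
binom[q^ d ] n k =
  ⟨ q^ d ⨾q^ d ⟩ n *ˢ recip (⟨ q^ d ⨾q^ d ⟩ k *ˢ ⟨ q^ d ⨾q^ d ⟩ (n ℕ.∸ k))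
    (*ˢ-constant (⟨ q^ d ⨾q^ d ⟩ k) (⟨ q^ d ⨾q^ d ⟩ (n ℕ.∸ k))
      (⨾-constant (q^ d) d k (q^-constant d)) (⨾-constant (q^ d) d (n ℕ.∸ k) (q^-constant d)))

∑-zero : ∀ {n} (t : Fin n → ℤ) → (∀ i → t i ≡ 0ℤ) → ∑ℤ t ≡ 0ℤ
∑-zero {n} t t≡0 = trans (sum-cong-≗ t≡0) (sum-replicate-zero n)

*ˢ-identityʳ : ∀ f → f *ˢ 1ˢ ≈ f
*ˢ-identityʳ f n = begin
  ∑ℤ t                                ≡⟨ sum-init-last t ⟩
  ∑ℤ (λ i → t (Fin.inject₁ i)) ℤ.+ t (Fin.fromℕ n)
    ≡⟨ cong₂ ℤ._+_ (∑-zero _ init≡0) last≡ ⟩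
  0ℤ ℤ.+ f n                          ≡⟨ ℤ.+-identityˡ (f n) ⟩
  f n                                 ∎
  where
  open ≡-Reasoning
  t : Fin (suc n) → ℤ
  t i = f (toℕ i) ℤ.* 1ˢ (n ℕ.∸ toℕ i)

  1ˢ-positive : ∀ k → 0 ℕ.< k → 1ˢ k ≡ 0ℤ
  1ˢ-positive (suc k) _ = refl

  init≡0 : ∀ i → t (Fin.inject₁ i) ≡ 0ℤ
  init≡0 i rewrite Fin.toℕ-inject₁ i | 1ˢ-positive (n ℕ.∸ toℕ i) (ℕ.m<n⇒0<n∸m (Fin.toℕ<n i)) =
    ℤ.*-zeroʳ (f (toℕ i))

  last≡ : t (Fin.fromℕ n) ≡ f n
  last≡ rewrite Fin.toℕ-fromℕ n | ℕ.n∸n≡0 n = ℤ.*-identityʳ (f n)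

q^-low : ∀ e n → n ℕ.< e → (q^ e) n ≡ 0ℤ
q^-low (suc e) zero    _         = refl
q^-low (suc e) (suc n) (s≤s n<e) = q^-low e n n<e

*ˢ-q^-low : ∀ f e n → n ℕ.< e → (f *ˢ q^ e) n ≡ 0ℤ
*ˢ-q^-low f e n n<e = ∑-zero {suc n} _ λ i →
  trans (cong (f (toℕ i) ℤ.*_) (q^-low e _ (ℕ.≤-<-trans (ℕ.m∸n≤m n (toℕ i)) n<e))) (ℤ.*-zeroʳ (f (toℕ i)))

*ˢ-q^-low′ : ∀ x e n → x 0 ≡ 0ℤ → n ℕ.≤ e → (x *ˢ q^ e) n ≡ 0ℤ
*ˢ-q^-low′ x e n x₀ n≤e = ∑-zero _ term
  where
  term : (i : Fin (suc n)) → x (toℕ i) ℤ.* (q^ e) (n ℕ.∸ toℕ i) ≡ 0ℤ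
  term Fin.zero                 = trans (cong (ℤ._* (q^ e) n) x₀) (ℤ.*-zeroˡ ((q^ e) n))
  term (Fin.suc {n = suc n′} i) =
    trans (cong (x (suc (toℕ i)) ℤ.*_) (q^-low e _ (ℕ.≤-trans (s≤s (ℕ.m∸n≤m n′ (toℕ i))) n≤e)))
          (ℤ.*-zeroʳ (x (suc (toℕ i))))

stable : ∀ (s : ℕ → ℤ) N → (∀ M → N ℕ.≤ M → s (suc M) ≡ s M) → ∀ M → N ℕ.≤ M → s M ≡ s N
stable s N step M N≤M = go (ℕ.≤⇒≤′ N≤M)
  where
  go : ∀ {M} → N ℕ.≤′ M → s M ≡ s N
  go (ℕ.≤′-reflexive refl) = refl
  go (ℕ.≤′-step N≤′M)      = trans (step _ (ℕ.≤′⇒≤ N≤′M)) (go N≤′M)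

⨾-convergent : ∀ x d .{{_ : NonZero d}} → x 0 ≡ 0ℤ → Convergent (⟨ x ⨾q^ d ⟩_)
⨾-convergent x d x₀ n = n , stable (λ M → (⟨ x ⨾q^ d ⟩ M) n) n step
  where
  step : ∀ M → n ℕ.≤ M → (⟨ x ⨾q^ d ⟩ suc M) n ≡ (⟨ x ⨾q^ d ⟩ M) n
  step M n≤M = trans (sum-cong-≗ {suc n} λ i → cong ((⟨ x ⨾q^ d ⟩ M) (toℕ i) ℤ.*_) (factor (n ℕ.∸ toℕ i) (ℕ.m∸n≤m n (toℕ i))))
                     (*ˢ-identityʳ (⟨ x ⨾q^ d ⟩ M) n)
    where
    factor : ∀ k → k ℕ.≤ n → (1ˢ -ˢ x *ˢ q^ (d ℕ.* M)) k ≡ 1ˢ k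
    factor k k≤n = trans
      (cong (λ c → 1ˢ k ℤ.- c)
        (*ˢ-q^-low′ x (d ℕ.* M) k x₀ (ℕ.≤-trans k≤n (ℕ.≤-trans n≤M (ℕ.m≤n*m M d)))))
      (ℤ.+-identityʳ (1ˢ k))

-- (x;q^d)_∞, which exists since x has constant term 0.
⟨_⨾q^_⟩∞ : (x : Series) (d : ℕ) .{{_ : NonZero d}} → x 0 ≡ 0ℤ → Series
⟨ x ⨾q^ d ⟩∞ x₀ = lim (⟨ x ⨾q^ d ⟩_) (⨾-convergent x d x₀)

summable : ∀ f → (∀ m n → n ℕ.< m → f m n ≡ 0ℤ) → Summable f
summable f low n = suc n , stable (λ M → ∑ℤ {M} λ m → f (toℕ m) n) (suc n) step
  where
  open ≡-Reasoning
  step : ∀ M → n ℕ.< M → (∑ℤ {suc M} λ m → f (toℕ m) n) ≡ ∑ℤ {M} λ m → f (toℕ m) n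
  step M n<M = begin
    (∑ℤ {suc M} λ m → f (toℕ m) n)
      ≡⟨ sum-init-last (λ (m : Fin (suc M)) → f (toℕ m) n) ⟩
    (∑ℤ {M} λ m → f (toℕ (Fin.inject₁ m)) n) ℤ.+ f (toℕ (Fin.fromℕ M)) n
      ≡⟨ cong₂ ℤ._+_ (sum-cong-≗ λ m → cong (λ k → f k n) (Fin.toℕ-inject₁ {M} m))
                     (trans (cong (λ k → f k n) (Fin.toℕ-fromℕ M)) (low M n n<M)) ⟩
    (∑ℤ {M} λ m → f (toℕ m) n) ℤ.+ 0ℤ
      ≡⟨ ℤ.+-identityʳ _ ⟩
    (∑ℤ {M} λ m → f (toℕ m) n) ∎

*ˢ-summable : ∀ (g : ℕ → Series) e → 0 ℕ.< e → Summable λ m → g m *ˢ q^ (e ℕ.* m)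
*ˢ-summable g (suc e) _ = summable _ λ m n n<m →
  *ˢ-q^-low (g m) (suc e ℕ.* m) n (ℕ.<-≤-trans n<m (ℕ.m≤n*m m (suc e)))

<⌊n/2⌋ : ∀ n j → j ℕ.< ⌊ n /2⌋ → 2 ℕ.* j ℕ.+ 1 ℕ.< n
<⌊n/2⌋ (suc (suc n)) zero    _       = s≤s (s≤s z≤n)
<⌊n/2⌋ (suc (suc n)) (suc j) (s≤s p) rewrite ℕ.+-suc j (j ℕ.+ 0) = s≤s (s≤s (<⌊n/2⌋ n j p))

<⌈n/2⌉ : ∀ n j → j ℕ.< ⌈ n /2⌉ → 2 ℕ.* j ℕ.< n
<⌈n/2⌉ n j p = ℕ.s≤s⁻¹ (subst (ℕ._< suc n) (ℕ.+-comm (2 ℕ.* j) 1) (<⌊n/2⌋ (suc n) j p))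

-- The truncated subtractions are exact in the next two statements, since
-- 4j + 2 ≤ 2h for j < ⌈h/2⌉ and 4j + 4 ≤ 2h for j < ⌊h/2⌋.
summable₁ : ∀ h (j : Fin ⌈ h /2⌉) (g : ℕ → Series) →
            Summable λ m → g m *ˢ q^ ((2 ℕ.* h ℕ.∸ 4 ℕ.* toℕ j) ℕ.* m)
summable₁ h j g = *ˢ-summable g _ (ℕ.m<n⇒0<n∸m
  (subst (ℕ._< 2 ℕ.* h) (sym (ℕ.*-assoc 2 2 (toℕ j))) (ℕ.*-monoʳ-< 2 (<⌈n/2⌉ h (toℕ j) (Fin.toℕ<n j)))))

summable₂ : ∀ h (j : Fin ⌊ h /2⌋) (g : ℕ → Series) →
            Summable λ m → g m *ˢ q^ ((2 ℕ.* h ℕ.∸ 4 ℕ.* toℕ j ℕ.∸ 2) ℕ.* m)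
summable₂ h j g = *ˢ-summable g _ (subst (0 ℕ.<_) (sym (ℕ.∸-+-assoc (2 ℕ.* h) (4 ℕ.* toℕ j) 2))
  (ℕ.m<n⇒0<n∸m (subst (ℕ._< 2 ℕ.* h)
    (trans (ℕ.*-distribˡ-+ 2 (2 ℕ.* toℕ j) 1) (cong (ℕ._+ 2) (sym (ℕ.*-assoc 2 2 (toℕ j)))))
    (ℕ.*-monoʳ-< 2 (<⌊n/2⌋ h (toℕ j) (Fin.toℕ<n j))))))

summable₃ : ∀ j (g : ℕ → Series) → Summable λ m → g m *ˢ q^ ((j ℕ.+ 1) ℕ.* m)
summable₃ j g = *ˢ-summable g _ (ℕ.m≤n+m 1 j)

a~ : ℕ → Series
a~ h n = + a h n

b~ : ℕ → Series
b~ h n = + b h n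

{-# OPTIONS --safe #-}
-- Consider a box in column m, counted from 0, with arm a and leg l, so that its
-- hook has length h = a + l + 1.  Its row is a part m + 1 + a; below it come l
-- parts between m + 1 and m + 1 + a, which a Gaussian binomial coefficient counts,
-- and then parts of size at most m; above it come parts of size at least m + 1 + a.
-- Relative to the generating function of all partitions of the given kind, only
-- the factors belonging to the sizes from m + 1 to m + 1 + a change.  The index j
-- of the theorem is l for distinct parts and ⌊a/2⌋ for odd parts, where even and
-- odd m give the two sums, and where the common factor 1/(q;q²)_∞ is (-q;q)_∞ by
-- Euler's theorem.  All identities are proved modulo q^(n+1), for every n.
module Submission where

open import Defs
open import Data.Nat using (ℕ; suc; _+_; _*_; _∸_; _/_; _≤_; ⌊_/2⌋; ⌈_/2⌉)
open import Data.Fin using (toℕ)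
open import Data.Product using (_×_)
open import Relation.Binary.PropositionalEquality using (refl)

open import Algebra.Bundles using (CommutativeRing)
import Algebra.Solver.Ring.AlmostCommutativeRing as ACR
open import Data.Bool using (true; false; if_then_else_)
open import Data.Fin using (Fin; inject₁; fromℕ)
import Data.Fin.Properties as Fin
open import Data.Integer as ℤ using (ℤ; +_; 0ℤ; 1ℤ)
import Data.Integer.Properties as ℤ
import Data.Integer.Tactic.RingSolver as ℤ
open import Data.List using (List; []; _∷_; _++_; _∷ʳ_; map; concatMap; filter; length; upTo)
import Data.List.Properties as List
open import Data.List.Membership.Propositional using (_∈_)
open import Data.List.Relation.Unary.All as All using (All; []; _∷_; all?)
open import Data.List.Relation.Unary.AllPairs using (_∷_)
open import Data.List.Relation.Unary.Any using (here; there)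
open import Data.List.Relation.Unary.Unique.Propositional using (Unique)
open import Data.List.Relation.Unary.Unique.DecPropositional Data.Nat._≟_ using (unique?)
open import Data.Maybe as Maybe using (Maybe)
open import Data.Nat as ℕ using (zero; _<_; z≤n; s≤s; s≤s⁻¹; _≟_; _≤?_; _<?_; _⊔_; NonZero)
open import Data.Nat.Divisibility using (_∣_; m∣m*n; ∣m+n∣m⇒∣n; ∣1⇒≡1)
open import Data.Nat.DivMod using (m*n/n≡m)
import Data.Nat.ListAction as ℕ using (sum)
import Data.Nat.Properties as ℕ
import Data.Nat.Tactic.RingSolver as ℕ
open import Data.Product using (_,_; proj₁; proj₂; map₁)
open import Data.Sum using (inj₁; inj₂)
open import Function using (_∘_; _⇔_; mk⇔; const)
open import Relation.Binary.Bundles using (Setoid)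
open import Relation.Binary.Definitions using (tri<; tri≈; tri>)
open import Relation.Binary.PropositionalEquality
import Relation.Binary.Reasoning.Setoid as SetoidReasoning
open import Relation.Nullary using (¬_; Dec; yes; no; does; contradiction)
open import Relation.Nullary.Decidable using (dec⇒maybe; does-⇔; dec-true; dec-false)
open import Relation.Unary using (Decidable)
open import Algebra.Properties.CommutativeMonoid.Sum ℤ.+-0-commutativeMonoid using (sum-cong-≗; sum-init-last)

-- The picture of rows above and below a box is not turned into a bijection. Instead the largest
-- permitted part grows by one size at a time. Removing the first row of a partition leaves all
-- other hooks intact, so only first-row hooks need a formula. The rows above a box enter through
-- the recursion itself: as a factor 1 + q^r for distinct parts, and, since an equal part may
-- follow, as a division by 1 - q^r for odd parts. Relative to the total generating function the
-- recursion becomes a plain double sum over first rows and columns, which is then resummed by the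
-- arm, or by half the arm for odd parts. The bound on the part sizes has to exceed the degree n by
-- about h: relevant arms are below h, so every inner sum over m keeps more than n terms and can be
-- exchanged for the infinite one. Infinite sums and products thus occur only at the two ends of the
-- argument.

infixl 7 _·ˢ_

-- Convolution algebra of formal power series

0ˢ : Series
0ˢ _ = 0ℤ

_·ˢ_ : ℤ → Series → Series
(c ·ˢ f) n = c ℤ.* f n

-- The convolution unfolds definitionally along `tail`: its coefficient at `suc n` is f 0 * g (suc
-- n) plus the coefficient of `tail f *ˢ g` at n. The ring laws are inductions along this equation.
tail : Series → Series
tail f n = f (suc n)

*ˢ-distribʳ : ∀ h f g → (f +ˢ g) *ˢ h ≈ f *ˢ h +ˢ g *ˢ h
*ˢ-distribʳ h f g zero = lemma (f 0) (g 0) (h 0)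
  where
  lemma : ∀ x y z → (x ℤ.+ y) ℤ.* z ℤ.+ 0ℤ ≡ (x ℤ.* z ℤ.+ 0ℤ) ℤ.+ (y ℤ.* z ℤ.+ 0ℤ)
  lemma = ℤ.solve-∀
*ˢ-distribʳ h f g (suc n) rewrite *ˢ-distribʳ h (tail f) (tail g) n =
  lemma (f 0) (g 0) (h (suc n)) ((tail f *ˢ h) n) ((tail g *ˢ h) n)
  where
  lemma : ∀ x y z u v → (x ℤ.+ y) ℤ.* z ℤ.+ (u ℤ.+ v) ≡ (x ℤ.* z ℤ.+ u) ℤ.+ (y ℤ.* z ℤ.+ v)
  lemma = ℤ.solve-∀

·ˢ-*ˢ : ∀ c f g → (c ·ˢ f) *ˢ g ≈ c ·ˢ (f *ˢ g)
·ˢ-*ˢ c f g zero = lemma c (f 0) (g 0)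
  where
  lemma : ∀ x y z → x ℤ.* y ℤ.* z ℤ.+ 0ℤ ≡ x ℤ.* (y ℤ.* z ℤ.+ 0ℤ)
  lemma = ℤ.solve-∀
·ˢ-*ˢ c f g (suc n) rewrite ·ˢ-*ˢ c (tail f) g n = lemma c (f 0) (g (suc n)) ((tail f *ˢ g) n)
  where
  lemma : ∀ x y z u → x ℤ.* y ℤ.* z ℤ.+ x ℤ.* u ≡ x ℤ.* (y ℤ.* z ℤ.+ u)
  lemma = ℤ.solve-∀

*ˢ-assoc : ∀ f g h → (f *ˢ g) *ˢ h ≈ f *ˢ (g *ˢ h)
*ˢ-assoc f g h zero = lemma (f 0) (g 0) (h 0)
  where
  lemma : ∀ x y z → (x ℤ.* y ℤ.+ 0ℤ) ℤ.* z ℤ.+ 0ℤ ≡ x ℤ.* (y ℤ.* z ℤ.+ 0ℤ) ℤ.+ 0ℤ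
  lemma = ℤ.solve-∀
*ˢ-assoc f g h (suc n)
  -- The tail of f *ˢ g is f 0 times the tail of g, plus the tail of f times g; this is why
  -- distributivity and scalars precede associativity.
  rewrite *ˢ-distribʳ h (f 0 ·ˢ tail g) (tail f *ˢ g) n
        | ·ˢ-*ˢ (f 0) (tail g) h n
        | *ˢ-assoc (tail f) g h n
  = lemma (f 0) (g 0) (h (suc n)) ((tail g *ˢ h) n) ((tail f *ˢ (g *ˢ h)) n)
  where
  lemma : ∀ x y z u v → (x ℤ.* y ℤ.+ 0ℤ) ℤ.* z ℤ.+ (x ℤ.* u ℤ.+ v) ≡ x ℤ.* (y ℤ.* z ℤ.+ u) ℤ.+ v
  lemma = ℤ.solve-∀

-- The definition peels the first coefficient off the left factor; commutativity also requires
-- peeling it off the right one.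
*ˢ-sucʳ : ∀ f g n → (f *ˢ g) (suc n) ≡ (f *ˢ tail g) n ℤ.+ f (suc n) ℤ.* g 0
*ˢ-sucʳ f g zero    = lemma (f 0 ℤ.* g 1) (f 1 ℤ.* g 0)
  where
  lemma : ∀ x y → x ℤ.+ (y ℤ.+ 0ℤ) ≡ x ℤ.+ 0ℤ ℤ.+ y
  lemma = ℤ.solve-∀
*ˢ-sucʳ f g (suc n) rewrite *ˢ-sucʳ (tail f) g n =
  sym (ℤ.+-assoc (f 0 ℤ.* g (suc (suc n))) ((tail f *ˢ tail g) n) (f (suc (suc n)) ℤ.* g 0))

*ˢ-comm : ∀ f g → f *ˢ g ≈ g *ˢ f
*ˢ-comm f g zero    = cong (ℤ._+ 0ℤ) (ℤ.*-comm (f 0) (g 0))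
*ˢ-comm f g (suc n) rewrite *ˢ-sucʳ g f n | *ˢ-comm (tail f) g n =
  trans (ℤ.+-comm (f 0 ℤ.* g (suc n)) _) (cong (λ c → (g *ˢ tail f) n ℤ.+ c) (ℤ.*-comm (f 0) (g (suc n))))

q^-*ˢ : ∀ d e → q^ (d + e) ≈ q^ d *ˢ q^ e
q^-*ˢ zero    e n = sym (trans (*ˢ-cong-0 n) (trans (*ˢ-comm 1ˢ (q^ e) n) (*ˢ-identityʳ (q^ e) n)))
  where
  *ˢ-cong-0 : q^ 0 *ˢ q^ e ≈ 1ˢ *ˢ q^ e
  *ˢ-cong-0 _ = refl
q^-*ˢ (suc d) e zero    = sym (trans (ℤ.+-identityʳ _) (ℤ.*-zeroˡ ((q^ e) 0)))
q^-*ˢ (suc d) e (suc n) = trans (q^-*ˢ d e n)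
  (sym (trans (cong (ℤ._+ (q^ d *ˢ q^ e) n) (ℤ.*-zeroˡ ((q^ e) (suc n)))) (ℤ.+-identityˡ ((q^ d *ˢ q^ e) n))))

-- A record, so that Agda can infer both series from the type of an equation.
record _≈[_]_ (f : Series) (n : ℕ) (g : Series) : Set where
  constructor below
  field
    coeff : ∀ i → i ≤ n → f i ≡ g i

open _≈[_]_ public

infix 4 _≈[_]_

exact : ∀ {f g n} → f ≈ g → f ≈[ n ] g
exact p = below λ i _ → p i

infix  8 ⊖_
infixl 7 _⊗_
infixl 6 _⊕_
infix  9 𝕢^_

-- Copies of the operations of Defs that do not unfold: those unfold as soon as
-- a coefficient is taken, and their arguments can then not be inferred.
opaque
  𝟘 𝟙 : Series
  𝟘 = 0ˢ
  𝟙 = 1ˢ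

  𝕢^_ : ℕ → Series
  𝕢^_ = q^_

  ⊖_ : Series → Series
  ⊖_ = -ˢ_

  _⊕_ _⊗_ : Series → Series → Series
  _⊕_ = _+ˢ_
  _⊗_ = _*ˢ_

  q^≡𝕢^ : ∀ e → q^ e ≡ 𝕢^ e
  q^≡𝕢^ _ = refl

  -ˢ≡⊖ : ∀ f → -ˢ f ≡ ⊖ f
  -ˢ≡⊖ _ = refl

  +ˢ≡⊕ : ∀ f g → f +ˢ g ≡ f ⊕ g
  +ˢ≡⊕ _ _ = refl

  *ˢ≡⊗ : ∀ f g → f *ˢ g ≡ f ⊗ g
  *ˢ≡⊗ _ _ = refl

-- The commutative ring of power series modulo q^(n+1)

module Truncation (n : ℕ) where

  ≈-refl : ∀ {f} → f ≈[ n ] f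
  ≈-refl = below λ _ _ → refl

  ≈-sym : ∀ {f g} → f ≈[ n ] g → g ≈[ n ] f
  ≈-sym p = below λ i i≤n → sym (coeff p i i≤n)

  ≈-trans : ∀ {f g h} → f ≈[ n ] g → g ≈[ n ] h → f ≈[ n ] h
  ≈-trans p r = below λ i i≤n → trans (coeff p i i≤n) (coeff r i i≤n)

  ≡⇒≈ : ∀ {f g} → f ≡ g → f ≈[ n ] g
  ≡⇒≈ refl = ≈-refl

  opaque
    unfolding _⊕_

    ⊕-cong : ∀ {f f′ g g′} → f ≈[ n ] f′ → g ≈[ n ] g′ → f ⊕ g ≈[ n ] f′ ⊕ g′
    ⊕-cong p r = below λ i i≤n → cong₂ ℤ._+_ (coeff p i i≤n) (coeff r i i≤n)

    ⊖-cong : ∀ {f g} → f ≈[ n ] g → ⊖ f ≈[ n ] ⊖ g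
    ⊖-cong p = below λ i i≤n → cong ℤ.-_ (coeff p i i≤n)

    ⊗-cong : ∀ {f f′ g g′} → f ≈[ n ] f′ → g ≈[ n ] g′ → f ⊗ g ≈[ n ] f′ ⊗ g′
    ⊗-cong p r = below λ i i≤n → sum-cong-≗ {suc i} λ j → cong₂ ℤ._*_
      (coeff p (toℕ j) (ℕ.≤-trans (s≤s⁻¹ (Fin.toℕ<n j)) i≤n))
      (coeff r (i ∸ toℕ j) (ℕ.≤-trans (ℕ.m∸n≤m i (toℕ j)) i≤n))

    ⊕-assoc : ∀ f g h → f ⊕ g ⊕ h ≈[ n ] f ⊕ (g ⊕ h)
    ⊕-assoc f g h = exact λ i → ℤ.+-assoc (f i) (g i) (h i)

    ⊕-comm : ∀ f g → f ⊕ g ≈[ n ] g ⊕ f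
    ⊕-comm f g = exact λ i → ℤ.+-comm (f i) (g i)

    ⊕-identityˡ : ∀ f → 𝟘 ⊕ f ≈[ n ] f
    ⊕-identityˡ f = exact λ i → ℤ.+-identityˡ (f i)

    ⊕-identityʳ : ∀ f → f ⊕ 𝟘 ≈[ n ] f
    ⊕-identityʳ f = exact λ i → ℤ.+-identityʳ (f i)

    ⊖-inverseˡ : ∀ f → ⊖ f ⊕ f ≈[ n ] 𝟘
    ⊖-inverseˡ f = exact λ i → ℤ.+-inverseˡ (f i)

    ⊖-inverseʳ : ∀ f → f ⊕ ⊖ f ≈[ n ] 𝟘
    ⊖-inverseʳ f = exact λ i → ℤ.+-inverseʳ (f i)

    ⊗-assoc : ∀ f g h → f ⊗ g ⊗ h ≈[ n ] f ⊗ (g ⊗ h)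
    ⊗-assoc f g h = exact (*ˢ-assoc f g h)

    ⊗-comm : ∀ f g → f ⊗ g ≈[ n ] g ⊗ f
    ⊗-comm f g = exact (*ˢ-comm f g)

    ⊗-identityʳ : ∀ f → f ⊗ 𝟙 ≈[ n ] f
    ⊗-identityʳ f = exact (*ˢ-identityʳ f)

    ⊗-distribʳ-⊕ : ∀ h f g → (f ⊕ g) ⊗ h ≈[ n ] f ⊗ h ⊕ g ⊗ h
    ⊗-distribʳ-⊕ h f g = exact (*ˢ-distribʳ h f g)

  ⊗-identityˡ : ∀ f → 𝟙 ⊗ f ≈[ n ] f
  ⊗-identityˡ f = ≈-trans (⊗-comm 𝟙 f) (⊗-identityʳ f)

  ⊗-distribˡ-⊕ : ∀ h f g → h ⊗ (f ⊕ g) ≈[ n ] h ⊗ f ⊕ h ⊗ g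
  ⊗-distribˡ-⊕ h f g = ≈-trans (⊗-comm h (f ⊕ g)) (≈-trans (⊗-distribʳ-⊕ h f g) (⊕-cong (⊗-comm f h) (⊗-comm g h)))

  ⊕-congˡ : ∀ {f g g′} → g ≈[ n ] g′ → f ⊕ g ≈[ n ] f ⊕ g′
  ⊕-congˡ = ⊕-cong ≈-refl

  ⊕-congʳ : ∀ {f f′ g} → f ≈[ n ] f′ → f ⊕ g ≈[ n ] f′ ⊕ g
  ⊕-congʳ p = ⊕-cong p ≈-refl

  ⊗-congˡ : ∀ {f g g′} → g ≈[ n ] g′ → f ⊗ g ≈[ n ] f ⊗ g′
  ⊗-congˡ = ⊗-cong ≈-refl

  ⊗-congʳ : ∀ {f f′ g} → f ≈[ n ] f′ → f ⊗ g ≈[ n ] f′ ⊗ g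
  ⊗-congʳ p = ⊗-cong p ≈-refl

  series : CommutativeRing _ _
  series = record
    { Carrier = Series ; _≈_ = _≈[ n ]_ ; _+_ = _⊕_ ; _*_ = _⊗_ ; -_ = ⊖_ ; 0# = 𝟘 ; 1# = 𝟙
    ; isCommutativeRing = record
      { isRing = record
        { +-isAbelianGroup = record
          { isGroup = record
            { isMonoid = record
              { isSemigroup = record
                { isMagma = record
                  { isEquivalence = record { refl = ≈-refl ; sym = ≈-sym ; trans = ≈-trans }
                  ; ∙-cong = ⊕-cong
                  }
                ; assoc = ⊕-assoc
                }
              ; identity = ⊕-identityˡ , ⊕-identityʳ
              }
            ; inverse = ⊖-inverseˡ , ⊖-inverseʳ
            ; ⁻¹-cong = ⊖-cong
            }
          ; comm = ⊕-comm
          }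
        ; *-cong = ⊗-cong
        ; *-assoc = ⊗-assoc
        ; *-identity = ⊗-identityˡ , ⊗-identityʳ
        ; distrib = ⊗-distribˡ-⊕ , ⊗-distribʳ-⊕
        }
      ; *-comm = ⊗-comm
      }
    }

  ≈-setoid : Setoid _ _
  ≈-setoid = CommutativeRing.setoid series

  -- The cases 0 and 1 are split off so that `con 0ℤ` and `con 1ℤ` in solver equations evaluate to
  -- `𝟘` and `𝟙` themselves, not to multiples of `𝟙`.
  fromℤ : ℤ → Series
  fromℤ (+ 0) = 𝟘
  fromℤ (+ 1) = 𝟙
  fromℤ c     = c ·ˢ 𝟙

  private opaque
    unfolding _⊕_

    fromℤ≈ : ∀ c → fromℤ c ≈ c ·ˢ 1ˢ
    fromℤ≈ (+ 0)           i = refl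
    fromℤ≈ (+ 1)           i = sym (ℤ.*-identityˡ (1ˢ i))
    fromℤ≈ (+ suc (suc _)) i = refl
    fromℤ≈ ℤ.-[1+ _ ]      i = refl

    fromℤ-+ : ∀ c d → fromℤ (c ℤ.+ d) ≈[ n ] fromℤ c ⊕ fromℤ d
    fromℤ-+ c d = exact λ i → trans (fromℤ≈ (c ℤ.+ d) i)
      (trans (ℤ.*-distribʳ-+ (1ˢ i) c d) (sym (cong₂ ℤ._+_ (fromℤ≈ c i) (fromℤ≈ d i))))

    fromℤ-* : ∀ c d → fromℤ (c ℤ.* d) ≈[ n ] fromℤ c ⊗ fromℤ d
    fromℤ-* c d = ≈-trans (exact λ i → trans (fromℤ≈ (c ℤ.* d) i)
        (trans (ℤ.*-assoc c d (1ˢ i)) (sym (trans (·ˢ-*ˢ c 1ˢ (d ·ˢ 1ˢ) i)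
          (cong (c ℤ.*_) (trans (*ˢ-comm 1ˢ (d ·ˢ 1ˢ) i) (*ˢ-identityʳ (d ·ˢ 1ˢ) i)))))))
      (≈-sym (⊗-cong (exact (fromℤ≈ c)) (exact (fromℤ≈ d))))

    fromℤ-neg : ∀ c → fromℤ (ℤ.- c) ≈[ n ] ⊖ fromℤ c
    fromℤ-neg c = exact λ i → trans (fromℤ≈ (ℤ.- c) i)
      (trans (sym (ℤ.neg-distribˡ-* c (1ˢ i))) (cong ℤ.-_ (sym (fromℤ≈ c i))))

  fromℤ-homomorphism : CommutativeRing.rawRing ℤ.+-*-commutativeRing
                         ACR.-Raw-AlmostCommutative⟶ ACR.fromCommutativeRing series
  fromℤ-homomorphism = record
    { ⟦_⟧    = fromℤ
    ; +-homo = fromℤ-+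
    ; *-homo = fromℤ-*
    ; -‿homo = fromℤ-neg
    ; 0-homo = ≈-refl
    ; 1-homo = ≈-refl
    }

  fromℤ-≟ : ∀ c d → Maybe (fromℤ c ≈[ n ] fromℤ d)
  fromℤ-≟ c d = Maybe.map (λ { refl → ≈-refl }) (dec⇒maybe (c ℤ.≟ d))

  open import Algebra.Solver.Ring (CommutativeRing.rawRing ℤ.+-*-commutativeRing)
    (ACR.fromCommutativeRing series) fromℤ-homomorphism fromℤ-≟ public
    using (solve; _:=_; _:+_; _:*_; :-_; con)

-- Powers of q, finite sums and truncated limits

opaque
  unfolding _⊕_

  𝕢^-low : ∀ {n} e f → n < e → 𝕢^ e ⊗ f ≈[ n ] 𝟘
  𝕢^-low e f n<e = below λ i i≤n → trans (*ˢ-comm (q^ e) f i) (*ˢ-q^-low f e i (ℕ.≤-<-trans i≤n n<e))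

  -- A positive power of q improves the precision: coefficients up to degree n + 1 of the products
  -- involve only coefficients up to degree n of f and g. This pays for the row lost when a largest
  -- part is removed.
  𝕢^-raise : ∀ {n f g} e → f ≈[ n ] g → 𝕢^ suc e ⊗ f ≈[ suc n ] 𝕢^ suc e ⊗ g
  𝕢^-raise {n} {f} {g} e p = below λ where
    zero    _         → cong (λ c → 0ℤ ℤ.* c ℤ.+ 0ℤ) (coeff p 0 z≤n)
    (suc i) (s≤s i≤n) → cong₂ ℤ._+_ (trans (ℤ.*-zeroˡ (f (suc i))) (sym (ℤ.*-zeroˡ (g (suc i)))))
                                    (coeff (Truncation.⊗-congˡ n {f = q^ e} p) i i≤n)

-- Indexed by ℕ so that ranges can be extended, reversed and reindexed without transport between
-- `Fin` types.
∑< : ℕ → (ℕ → Series) → Series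
∑< zero    f = 𝟘
∑< (suc n) f = ∑< n f ⊕ f n

opaque
  unfolding _⊕_
  ∑ˢ-∑< : ∀ {n} k {F : Fin k → Series} {f} → (∀ i → F i ≈[ n ] f (toℕ i)) → ∑ˢ k F ≈[ n ] ∑< k f
  ∑ˢ-∑< zero    p = exact λ _ → refl
  ∑ˢ-∑< (suc k) {F} {f} p = below λ i i≤n → trans (sum-init-last λ j → F j i) (cong₂ ℤ._+_
    (coeff (∑ˢ-∑< k λ j → subst (λ m → F (inject₁ j) ≈[ _ ] f m) (Fin.toℕ-inject₁ j) (p (inject₁ j))) i i≤n)
    (trans (coeff (p (fromℕ k)) i i≤n) (cong (λ m → f m i) (Fin.toℕ-fromℕ k))))

-- The index N supplied by `c` may lie on either side of M. Both partial sums are compared with the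
-- one at `N ⊔ M`: `c` settles one comparison, and the other holds because f m starts in degree m.
∑∞-truncate : ∀ {n} f (c : Summable f) M → (∀ m k → k < m → f m k ≡ 0ℤ) → n < M → ∑∞ f c ≈[ n ] ∑< M f
∑∞-truncate f c M low n<M = below λ i i≤n →
  let N = proj₁ (c i)
      M′ = N ⊔ M
      i<M = ℕ.≤-<-trans i≤n n<M
      stab = proj₂ (summable f low i)
  in trans (trans (sym (proj₂ (c i) M′ (ℕ.m≤m⊔n N M)))
             (trans (stab M′ (ℕ.≤-trans i<M (ℕ.m≤n⊔m N M))) (sym (stab M i<M))))
           (coeff (∑ˢ-∑< M {f = f} λ _ → exact λ _ → refl) i ℕ.≤-refl)

⨾-truncate : ∀ {n} x d .{{_ : NonZero d}} (x₀ : x 0 ≡ 0ℤ) M → n ≤ M → ⟨ x ⨾q^ d ⟩∞ x₀ ≈[ n ] ⟨ x ⨾q^ d ⟩ M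
⨾-truncate x d x₀ M n≤M = below λ i i≤n → sym (proj₂ (⨾-convergent x d x₀ i) M (ℕ.≤-trans i≤n n≤M))

-- The box with c rows and l columns: box d c l is the generating function in
-- q^d of the partitions inside it.
box : ℕ → ℕ → ℕ → Series
box d zero    l       = 𝟙
box d (suc c) zero    = 𝟙
box d (suc c) (suc l) = box d c (suc l) ⊕ 𝕢^ (d * suc c) ⊗ box d (suc c) l

box-zeroʳ : ∀ d c → box d c 0 ≡ 𝟙
box-zeroʳ d zero    = refl
box-zeroʳ d (suc c) = refl

-- Rearranging sums, Gaussian binomial coefficients, Euler's theorem

module TruncatedSeries (n : ℕ) where
  open Truncation n public
  open SetoidReasoning ≈-setoid public

  𝕢^-cong : ∀ {d e} → d ≡ e → 𝕢^ d ≈[ n ] 𝕢^ e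
  𝕢^-cong refl = ≈-refl

  opaque
    unfolding _⊕_

    𝕢^0 : 𝕢^ 0 ≈[ n ] 𝟙
    𝕢^0 = exact λ _ → refl

    𝕢^-merge : ∀ {d e k} → d + e ≡ k → 𝕢^ d ⊗ 𝕢^ e ≈[ n ] 𝕢^ k
    𝕢^-merge {d} {e} refl = ≈-sym (exact (q^-*ˢ d e))

    ⊗-recip : ∀ f (f₀ : f 0 ≡ 1ℤ) → f ⊗ recip f f₀ ≈[ n ] 𝟙
    ⊗-recip f f₀ = exact (*ˢ-recip f f₀)

    ⨾-suc : ∀ x d k → ⟨ x ⨾q^ d ⟩ suc k ≈[ n ] ⟨ x ⨾q^ d ⟩ k ⊗ (𝟙 ⊕ ⊖ (x ⊗ 𝕢^ (d * k)))
    ⨾-suc x d k = exact λ _ → refl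

    ⨾-zero : ∀ x d → ⟨ x ⨾q^ d ⟩ 0 ≈[ n ] 𝟙
    ⨾-zero x d = exact λ _ → refl

    constant-⊗ : ∀ f g → f 0 ≡ 1ℤ → g 0 ≡ 1ℤ → (f ⊗ g) 0 ≡ 1ℤ
    constant-⊗ = *ˢ-constant

  ⨾-q-suc : ∀ e d k → ⟨ q^ e ⨾q^ d ⟩ suc k ≈[ n ] ⟨ q^ e ⨾q^ d ⟩ k ⊗ (𝟙 ⊕ ⊖ 𝕢^ (e + d * k))
  ⨾-q-suc e d k = ≈-trans (⨾-suc (q^ e) d k) (⊗-congˡ (⊕-congˡ (⊖-cong
    (≈-trans (⊗-congʳ (≡⇒≈ (q^≡𝕢^ e))) (𝕢^-merge refl)))))

  ⨾-−q-suc : ∀ e d k → ⟨ -ˢ q^ e ⨾q^ d ⟩ suc k ≈[ n ] ⟨ -ˢ q^ e ⨾q^ d ⟩ k ⊗ (𝟙 ⊕ 𝕢^ (e + d * k))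
  ⨾-−q-suc e d k = ≈-trans (⨾-suc (-ˢ q^ e) d k) (⊗-congˡ (⊕-congˡ (begin
    ⊖ ((-ˢ q^ e) ⊗ 𝕢^ (d * k))  ≈⟨ ⊖-cong (⊗-congʳ (≡⇒≈ (trans (-ˢ≡⊖ (q^ e)) (cong ⊖_ (q^≡𝕢^ e))))) ⟩
    ⊖ (⊖ 𝕢^ e ⊗ 𝕢^ (d * k))     ≈⟨ solve 2 (λ x y → :- (:- x :* y) := x :* y) ≈-refl (𝕢^ e) (𝕢^ (d * k)) ⟩
    𝕢^ e ⊗ 𝕢^ (d * k)           ≈⟨ 𝕢^-merge refl ⟩
    𝕢^ (e + d * k)              ∎)))

  -- Constant term 1 makes f a unit, so identities between quotients can be proved with cleared
  -- denominators.
  ⊗-cancelˡ : ∀ f {g h} → f 0 ≡ 1ℤ → f ⊗ g ≈[ n ] f ⊗ h → g ≈[ n ] h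
  ⊗-cancelˡ f {g} {h} f₀ p = ≈-trans (≈-sym (strip g)) (≈-trans (⊗-congˡ p) (strip h))
    where
    strip : ∀ g → recip f f₀ ⊗ (f ⊗ g) ≈[ n ] g
    strip g = begin
      recip f f₀ ⊗ (f ⊗ g)  ≈⟨ solve 3 (λ x y z → x :* (y :* z) := (y :* x) :* z) ≈-refl (recip f f₀) f g ⟩
      (f ⊗ recip f f₀) ⊗ g  ≈⟨ ⊗-congʳ (⊗-recip f f₀) ⟩
      𝟙 ⊗ g                 ≈⟨ solve 1 (λ x → con 1ℤ :* x := x) ≈-refl g ⟩
      g                       ∎

  ∑<-cong : ∀ k {f g} → (∀ i → i < k → f i ≈[ n ] g i) → ∑< k f ≈[ n ] ∑< k g
  ∑<-cong zero    p = ≈-refl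
  ∑<-cong (suc k) p = ⊕-cong (∑<-cong k λ i i<k → p i (ℕ.m<n⇒m<1+n i<k)) (p k ℕ.≤-refl)

  ∑<-zero : ∀ k {f} → (∀ i → i < k → f i ≈[ n ] 𝟘) → ∑< k f ≈[ n ] 𝟘
  ∑<-zero zero    p = ≈-refl
  ∑<-zero (suc k) p = ≈-trans (⊕-cong (∑<-zero k λ i i<k → p i (ℕ.m<n⇒m<1+n i<k)) (p k ℕ.≤-refl))
                              (⊕-identityʳ 𝟘)

  ∑<-⊕ : ∀ k f g → ∑< k (λ i → f i ⊕ g i) ≈[ n ] ∑< k f ⊕ ∑< k g
  ∑<-⊕ zero    f g = ≈-sym (⊕-identityʳ 𝟘)
  ∑<-⊕ (suc k) f g = ≈-trans (⊕-congʳ (∑<-⊕ k f g))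
    (solve 4 (λ u v x y → (u :+ v) :+ (x :+ y) := (u :+ x) :+ (v :+ y)) ≈-refl (∑< k f) (∑< k g) (f k) (g k))

  ∑<-⊗ : ∀ k c f → ∑< k (λ i → c ⊗ f i) ≈[ n ] c ⊗ ∑< k f
  ∑<-⊗ zero    c f = solve 1 (λ x → con 0ℤ := x :* con 0ℤ) ≈-refl c
  ∑<-⊗ (suc k) c f = ≈-trans (⊕-congʳ (∑<-⊗ k c f))
    (solve 3 (λ x y z → x :* y :+ x :* z := x :* (y :+ z)) ≈-refl c (∑< k f) (f k))

  ∑<-suc : ∀ k f → ∑< (suc k) f ≈[ n ] f 0 ⊕ ∑< k (f ∘ suc)
  ∑<-suc zero    f = solve 1 (λ x → con 0ℤ :+ x := x :+ con 0ℤ) ≈-refl (f 0)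
  ∑<-suc (suc k) f = ≈-trans (⊕-congʳ (∑<-suc k f))
    (solve 3 (λ x y z → (x :+ y) :+ z := x :+ (y :+ z)) ≈-refl (f 0) (∑< k (f ∘ suc)) (f (suc k)))

  ∑<-reverse : ∀ k f → ∑< k f ≈[ n ] ∑< k (λ i → f (k ∸ suc i))
  ∑<-reverse zero    f = ≈-refl
  ∑<-reverse (suc k) f = begin
    ∑< k f ⊕ f k                                ≈⟨ solve 2 (λ x y → x :+ y := y :+ x) ≈-refl (∑< k f) (f k) ⟩
    f k ⊕ ∑< k f                                ≈⟨ ⊕-congˡ (∑<-reverse k f) ⟩
    f k ⊕ ∑< k (λ i → f (k ∸ suc i))            ≈⟨ ∑<-suc k (λ i → f (k ∸ i)) ⟨
    ∑< (suc k) (λ i → f (k ∸ i))                 ∎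

  ∑<-extend : ∀ {k k′ f} → k ≤ k′ → (∀ i → k ≤ i → f i ≈[ n ] 𝟘) → ∑< k′ f ≈[ n ] ∑< k f
  ∑<-extend {k} {k′} {f} k≤k′ z = go (ℕ.≤⇒≤′ k≤k′)
    where
    go : ∀ {k′} → k ℕ.≤′ k′ → ∑< k′ f ≈[ n ] ∑< k f
    go (ℕ.≤′-reflexive refl) = ≈-refl
    go (ℕ.≤′-step {m} p) = begin
      ∑< m f ⊕ f m   ≈⟨ ⊕-cong (go p) (z m (ℕ.≤′⇒≤ p)) ⟩
      ∑< k f ⊕ 𝟘    ≈⟨ solve 1 (λ x → x :+ con 0ℤ := x) ≈-refl (∑< k f) ⟩
      ∑< k f          ∎

  -- Both sides run over the pairs with m + a < K, by diagonals r = m + a on the left and by a on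
  -- the right. The induction peels the term a = 0 off every diagonal; what remains is the next
  -- smaller triangle for V shifted in a.
  ∑<-triangle : ∀ K (V : ℕ → ℕ → Series) →
                ∑< K (λ r → ∑< (suc r) λ m → V m (r ∸ m)) ≈[ n ] ∑< K (λ a → ∑< (K ∸ a) λ m → V m a)
  ∑<-triangle zero    V = ≈-refl
  ∑<-triangle (suc K) V = begin
    ∑< (suc K) (λ r → ∑< (suc r) λ m → V m (r ∸ m))
      ≈⟨ ∑<-cong (suc K) (λ r _ → peel r) ⟩
    ∑< (suc K) (λ r → ∑< r (λ m → V m (suc (r ∸ suc m))) ⊕ V r 0)
      ≈⟨ ∑<-⊕ (suc K) (λ r → ∑< r (λ m → V m (suc (r ∸ suc m)))) (λ r → V r 0) ⟩
    ∑< (suc K) (λ r → ∑< r (λ m → V m (suc (r ∸ suc m)))) ⊕ ∑< (suc K) (λ r → V r 0)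
      ≈⟨ ⊕-congʳ (∑<-suc K (λ r → ∑< r (λ m → V m (suc (r ∸ suc m))))) ⟩
    𝟘 ⊕ ∑< K (λ r → ∑< (suc r) (λ m → V m (suc (r ∸ m)))) ⊕ ∑< (suc K) (λ r → V r 0)
      ≈⟨ ⊕-congʳ (⊕-congˡ (∑<-triangle K λ m a → V m (suc a))) ⟩
    𝟘 ⊕ ∑< K (λ a → ∑< (K ∸ a) λ m → V m (suc a)) ⊕ ∑< (suc K) (λ r → V r 0)
      ≈⟨ solve 2 (λ x y → con 0ℤ :+ x :+ y := y :+ x)
           ≈-refl (∑< K (λ a → ∑< (K ∸ a) λ m → V m (suc a))) (∑< (suc K) (λ r → V r 0)) ⟩
    ∑< (suc K) (λ r → V r 0) ⊕ ∑< K (λ a → ∑< (K ∸ a) λ m → V m (suc a))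
      ≈⟨ ∑<-suc K (λ a → ∑< (suc K ∸ a) λ m → V m a) ⟨
    ∑< (suc K) (λ a → ∑< (suc K ∸ a) λ m → V m a)
      ∎
    where
    peel : ∀ r → ∑< (suc r) (λ m → V m (r ∸ m)) ≈[ n ] ∑< r (λ m → V m (suc (r ∸ suc m))) ⊕ V r 0
    peel r = ⊕-cong
      (∑<-cong r λ m m<r → exact λ i → cong (λ a → V m a i) (ℕ.+-∸-assoc 1 m<r))
      (exact λ i → cong (λ a → V r a i) (ℕ.n∸n≡0 r))

  -- The factors of (q^d;q^d), in the notation X = q^(d(c+1)), Y = q^(d(l+1)),
  -- satisfy (1 - X) + X (1 - Y) = 1 - XY.
  box-⨾ : ∀ d c l → box d c l ⊗ (⟨ q^ d ⨾q^ d ⟩ c ⊗ ⟨ q^ d ⨾q^ d ⟩ l) ≈[ n ] ⟨ q^ d ⨾q^ d ⟩ (c + l)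
  box-⨾ d zero    l = ≈-trans (⊗-congˡ (⊗-congʳ (⨾-zero (q^ d) d)))
    (solve 1 (λ x → con 1ℤ :* (con 1ℤ :* x) := x) ≈-refl (⟨ q^ d ⨾q^ d ⟩ l))
  box-⨾ d (suc c) zero rewrite ℕ.+-identityʳ c = ≈-trans (⊗-congˡ (⊗-congˡ (⨾-zero (q^ d) d)))
    (solve 1 (λ x → con 1ℤ :* (x :* con 1ℤ) := x) ≈-refl (⟨ q^ d ⨾q^ d ⟩ suc c))
  box-⨾ d (suc c) (suc l) = begin
    (B₁ ⊕ 𝕢^ (d * suc c) ⊗ B₂) ⊗ (P (suc c) ⊗ P (suc l))
      ≈⟨ ⊗-cong (⊕-congˡ (⊗-congʳ (𝕢^-cong (ℕ.*-suc d c)))) (⊗-cong (⨾-q-suc d d c) (⨾-q-suc d d l)) ⟩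
    (B₁ ⊕ X ⊗ B₂) ⊗ ((P c ⊗ (𝟙 ⊕ ⊖ X)) ⊗ (P l ⊗ (𝟙 ⊕ ⊖ Y)))
      ≈⟨ solve 6 (λ B₁ B₂ C L X Y →
           (B₁ :+ X :* B₂) :* ((C :* (con 1ℤ :+ :- X)) :* (L :* (con 1ℤ :+ :- Y)))
           := (B₁ :* (C :* (L :* (con 1ℤ :+ :- Y)))) :* (con 1ℤ :+ :- X)
              :+ (B₂ :* ((C :* (con 1ℤ :+ :- X)) :* L)) :* (X :* (con 1ℤ :+ :- Y)))
         ≈-refl B₁ B₂ (P c) (P l) X Y ⟩
    (B₁ ⊗ (P c ⊗ (P l ⊗ (𝟙 ⊕ ⊖ Y)))) ⊗ (𝟙 ⊕ ⊖ X) ⊕ (B₂ ⊗ ((P c ⊗ (𝟙 ⊕ ⊖ X)) ⊗ P l)) ⊗ (X ⊗ (𝟙 ⊕ ⊖ Y))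
      ≈⟨ ⊕-cong (⊗-congʳ (≈-trans (⊗-congˡ (⊗-congˡ (≈-sym (⨾-q-suc d d l)))) (box-⨾ d c (suc l))))
                (⊗-congʳ (≈-trans (⊗-congˡ (⊗-congʳ (≈-sym (⨾-q-suc d d c))))
                  (≈-trans (box-⨾ d (suc c) l) (≡⇒≈ (cong P (sym (ℕ.+-suc c l))))))) ⟩
    P (c + suc l) ⊗ (𝟙 ⊕ ⊖ X) ⊕ P (c + suc l) ⊗ (X ⊗ (𝟙 ⊕ ⊖ Y))
      ≈⟨ solve 3 (λ P X Y → P :* (con 1ℤ :+ :- X) :+ P :* (X :* (con 1ℤ :+ :- Y)) := P :* (con 1ℤ :+ :- (X :* Y)))
           ≈-refl (P (c + suc l)) X Y ⟩
    P (c + suc l) ⊗ (𝟙 ⊕ ⊖ (X ⊗ Y))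
      ≈⟨ ⊗-congˡ (⊕-congˡ (⊖-cong (𝕢^-merge (arith d c l)))) ⟩
    P (c + suc l) ⊗ (𝟙 ⊕ ⊖ 𝕢^ (d + d * (c + suc l)))
      ≈⟨ ⨾-q-suc d d (c + suc l) ⟨
    P (suc c + suc l) ∎
    where
    P : ℕ → Series
    P = ⟨ q^ d ⨾q^ d ⟩_
    B₁ B₂ X Y : Series
    B₁ = box d c (suc l)
    B₂ = box d (suc c) l
    X  = 𝕢^ (d + d * c)
    Y  = 𝕢^ (d + d * l)
    arith : ∀ d c l → (d + d * c) + (d + d * l) ≡ d + d * (c + suc l)
    arith = ℕ.solve-∀

  binom-box : ∀ d .{{_ : NonZero d}} c l → binom[q^ d ] (c + l) c ≈[ n ] box d c l
  binom-box d c l rewrite ℕ.m+n∸m≡n c l = begin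
    ⟨ q^ d ⨾q^ d ⟩ (c + l) *ˢ R            ≈⟨ ≡⇒≈ (*ˢ≡⊗ (⟨ q^ d ⨾q^ d ⟩ (c + l)) R) ⟩
    ⟨ q^ d ⨾q^ d ⟩ (c + l) ⊗ R             ≈⟨ ⊗-congʳ (box-⨾ d c l) ⟨
    box d c l ⊗ (C ⊗ L) ⊗ R                ≈⟨ ⊗-congʳ (⊗-congˡ (≡⇒≈ (sym (*ˢ≡⊗ C L)))) ⟩
    box d c l ⊗ (C *ˢ L) ⊗ R
      ≈⟨ solve 3 (λ x y z → x :* y :* z := (y :* z) :* x) ≈-refl (box d c l) (C *ˢ L) R ⟩
    (C *ˢ L) ⊗ R ⊗ box d c l               ≈⟨ ⊗-congʳ (⊗-recip (C *ˢ L) P₀) ⟩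
    𝟙 ⊗ box d c l                          ≈⟨ ⊗-identityˡ (box d c l) ⟩
    box d c l                              ∎
    where
    C L R : Series
    C = ⟨ q^ d ⨾q^ d ⟩ c
    L = ⟨ q^ d ⨾q^ d ⟩ l
    P₀ : (C *ˢ L) 0 ≡ 1ℤ
    P₀ = *ˢ-constant C L (⨾-constant (q^ d) d c (q^-constant d)) (⨾-constant (q^ d) d l (q^-constant d))
    R = recip (C *ˢ L) P₀

  -- Conjugation of partitions. The recursion of `box` hides this symmetry, whereas the product
  -- formula `box-⨾` is symmetric in c and l.
  box-comm : ∀ d .{{_ : NonZero d}} c l → box d c l ≈[ n ] box d l c
  box-comm d c l = ⊗-cancelˡ (C ⊗ L)
    (constant-⊗ C L (⨾-constant (q^ d) d c (q^-constant d)) (⨾-constant (q^ d) d l (q^-constant d))) (begin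
    (C ⊗ L) ⊗ box d c l     ≈⟨ ⊗-comm (C ⊗ L) (box d c l) ⟩
    box d c l ⊗ (C ⊗ L)     ≈⟨ box-⨾ d c l ⟩
    ⟨ q^ d ⨾q^ d ⟩ (c + l)  ≈⟨ ≡⇒≈ (cong (⟨ q^ d ⨾q^ d ⟩_) (ℕ.+-comm c l)) ⟩
    ⟨ q^ d ⨾q^ d ⟩ (l + c)  ≈⟨ box-⨾ d l c ⟨
    box d l c ⊗ (L ⊗ C)     ≈⟨ solve 3 (λ x y z → z :* (y :* x) := (x :* y) :* z) ≈-refl C L (box d l c) ⟩
    (C ⊗ L) ⊗ box d l c     ∎)
    where
    C L : Series
    C = ⟨ q^ d ⨾q^ d ⟩ c
    L = ⟨ q^ d ⨾q^ d ⟩ l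

  euler-even : ∀ N → ⟨ q^ 1 ⨾q^ 1 ⟩ N ⊗ ⟨ -ˢ q^ 1 ⨾q^ 1 ⟩ N ≈[ n ] ⟨ q^ 2 ⨾q^ 2 ⟩ N
  euler-even zero    = ≈-trans (⊗-cong (⨾-zero (q^ 1) 1) (⨾-zero (-ˢ q^ 1) 1))
    (≈-trans (⊗-identityˡ 𝟙) (≈-sym (⨾-zero (q^ 2) 2)))
  euler-even (suc N) = begin
    ⟨ q^ 1 ⨾q^ 1 ⟩ suc N ⊗ ⟨ -ˢ q^ 1 ⨾q^ 1 ⟩ suc N
      ≈⟨ ⊗-cong (⨾-q-suc 1 1 N) (⨾-−q-suc 1 1 N) ⟩
    (A ⊗ (𝟙 ⊕ ⊖ X)) ⊗ (B ⊗ (𝟙 ⊕ X))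
      ≈⟨ solve 3 (λ A B X → (A :* (con 1ℤ :+ :- X)) :* (B :* (con 1ℤ :+ X)) := (A :* B) :* (con 1ℤ :+ :- (X :* X)))
           ≈-refl A B X ⟩
    (A ⊗ B) ⊗ (𝟙 ⊕ ⊖ (X ⊗ X))
      ≈⟨ ⊗-cong (euler-even N) (⊕-congˡ (⊖-cong (𝕢^-merge (arith N)))) ⟩
    ⟨ q^ 2 ⨾q^ 2 ⟩ N ⊗ (𝟙 ⊕ ⊖ 𝕢^ (2 + 2 * N))
      ≈⟨ ⨾-q-suc 2 2 N ⟨
    ⟨ q^ 2 ⨾q^ 2 ⟩ suc N ∎
    where
    A B X : Series
    A = ⟨ q^ 1 ⨾q^ 1 ⟩ N
    B = ⟨ -ˢ q^ 1 ⨾q^ 1 ⟩ N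
    X = 𝕢^ (1 + 1 * N)
    arith : ∀ N → (1 + 1 * N) + (1 + 1 * N) ≡ 2 + 2 * N
    arith = ℕ.solve-∀

  euler-split : ∀ N → ⟨ q^ 1 ⨾q^ 1 ⟩ (N + N) ≈[ n ] ⟨ q^ 1 ⨾q^ 2 ⟩ N ⊗ ⟨ q^ 2 ⨾q^ 2 ⟩ N
  euler-split zero = ≈-sym (≈-trans (⊗-cong (⨾-zero (q^ 1) 2) (⨾-zero (q^ 2) 2))
    (≈-trans (⊗-identityˡ 𝟙) (≈-sym (⨾-zero (q^ 1) 1))))
  euler-split (suc N) rewrite ℕ.+-suc N N = begin
    ⟨ q^ 1 ⨾q^ 1 ⟩ suc (suc (N + N))
      ≈⟨ ≈-trans (⨾-q-suc 1 1 (suc (N + N))) (⊗-congʳ (⨾-q-suc 1 1 (N + N))) ⟩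
    (⟨ q^ 1 ⨾q^ 1 ⟩ (N + N) ⊗ (𝟙 ⊕ ⊖ 𝕢^ (1 + 1 * (N + N)))) ⊗ (𝟙 ⊕ ⊖ 𝕢^ (1 + 1 * suc (N + N)))
      ≈⟨ ⊗-cong (⊗-cong (euler-split N) (⊕-congˡ (⊖-cong (𝕢^-cong (arith N)))))
                 (⊕-congˡ (⊖-cong (𝕢^-cong (arith′ N)))) ⟩
    ((O ⊗ E) ⊗ (𝟙 ⊕ ⊖ X)) ⊗ (𝟙 ⊕ ⊖ Y)
      ≈⟨ solve 4 (λ O E x y → ((O :* E) :* (con 1ℤ :+ :- x)) :* (con 1ℤ :+ :- y)
                            := (O :* (con 1ℤ :+ :- x)) :* (E :* (con 1ℤ :+ :- y))) ≈-refl O E X Y ⟩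
    (O ⊗ (𝟙 ⊕ ⊖ X)) ⊗ (E ⊗ (𝟙 ⊕ ⊖ Y))
      ≈⟨ ⊗-cong (⨾-q-suc 1 2 N) (⨾-q-suc 2 2 N) ⟨
    ⟨ q^ 1 ⨾q^ 2 ⟩ suc N ⊗ ⟨ q^ 2 ⨾q^ 2 ⟩ suc N ∎
    where
    O E X Y : Series
    O = ⟨ q^ 1 ⨾q^ 2 ⟩ N
    E = ⟨ q^ 2 ⨾q^ 2 ⟩ N
    X = 𝕢^ (1 + 2 * N)
    Y = 𝕢^ (2 + 2 * N)
    arith : ∀ N → 1 + 1 * (N + N) ≡ 1 + 2 * N
    arith = ℕ.solve-∀
    arith′ : ∀ N → 1 + 1 * suc (N + N) ≡ 2 + 2 * N
    arith′ = ℕ.solve-∀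

  -- Multiplied by E = (q^2;q^2)_N, and with D cut to 2N factors, the left side becomes (q;q)_2N
  -- (-q;q)_2N = (q^2;q^2)_2N, which agrees with E in degrees up to n.
  euler : ∀ N → n ≤ N → ⟨ q^ 1 ⨾q^ 2 ⟩ N ⊗ ⟨ -ˢ q^ 1 ⨾q^ 1 ⟩∞ refl ≈[ n ] 𝟙
  euler N n≤N = ⊗-cancelˡ E (⨾-constant (q^ 2) 2 N refl) (begin
    E ⊗ (O ⊗ D)                            ≈⟨ solve 3 (λ x y z → x :* (y :* z) := (y :* x) :* z) ≈-refl E O D ⟩
    (O ⊗ E) ⊗ D
      ≈⟨ ⊗-cong (≈-sym (euler-split N)) (⨾-truncate (-ˢ q^ 1) 1 refl (N + N) n≤N+N) ⟩
    ⟨ q^ 1 ⨾q^ 1 ⟩ (N + N) ⊗ ⟨ -ˢ q^ 1 ⨾q^ 1 ⟩ (N + N) ≈⟨ euler-even (N + N) ⟩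
    ⟨ q^ 2 ⨾q^ 2 ⟩ (N + N)                 ≈⟨ ⨾-truncate (q^ 2) 2 refl (N + N) n≤N+N ⟨
    ⟨ q^ 2 ⨾q^ 2 ⟩∞ refl                   ≈⟨ ⨾-truncate (q^ 2) 2 refl N n≤N ⟩
    E                                      ≈⟨ ⊗-identityʳ E ⟨
    E ⊗ 𝟙                                  ∎)
    where
    O E D : Series
    O = ⟨ q^ 1 ⨾q^ 2 ⟩ N
    E = ⟨ q^ 2 ⨾q^ 2 ⟩ N
    D = ⟨ -ˢ q^ 1 ⨾q^ 1 ⟩∞ refl
    n≤N+N : n ≤ N + N
    n≤N+N = ℕ.≤-trans n≤N (ℕ.m≤m+n N N)

-- Counting boxes and hooks row by row

count : {A : Set} {P : A → Set} → Decidable P → List A → ℕ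
count P? xs = length (filter P? xs)

count-++ : {A : Set} {P : A → Set} (P? : Decidable P) (xs ys : List A) →
           count P? (xs ++ ys) ≡ count P? xs + count P? ys
count-++ P? xs ys = trans (cong length (List.filter-++ P? xs ys)) (List.length-++ (filter P? xs))

count-map : {A B : Set} {P : A → Set} (P? : Decidable P) (f : B → A) (xs : List B) →
            count P? (map f xs) ≡ count (P? ∘ f) xs
count-map P? f []       = refl
count-map P? f (x ∷ xs) with does (P? (f x))
... | true  = cong suc (count-map P? f xs)
... | false = count-map P? f xs

count-cong : {A : Set} {P Q : A → Set} (P? : Decidable P) (Q? : Decidable Q) →
             (∀ x → P x ⇔ Q x) → (xs : List A) → count P? xs ≡ count Q? xs
count-cong P? Q? P⇔Q []       = refl
count-cong P? Q? P⇔Q (x ∷ xs) with does (P? x) | does (Q? x) | does-⇔ (P⇔Q x) (P? x) (Q? x)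
... | true  | .true  | refl = cong suc (count-cong P? Q? P⇔Q xs)
... | false | .false | refl = count-cong P? Q? P⇔Q xs

count-none : {A : Set} {P : A → Set} (P? : Decidable P) {xs : List A} → All (¬_ ∘ P) xs → count P? xs ≡ 0
count-none P? none = cong length (List.filter-none P? none)

count-upTo-suc : {P : ℕ → Set} (P? : Decidable P) (r : ℕ) →
                 count P? (upTo (suc r)) ≡ count P? (upTo r) + (if does (P? r) then 1 else 0)
count-upTo-suc P? r = trans (cong (count P?) (sym (List.upTo-∷ʳ r)))
  (trans (count-++ P? (upTo r) (r ∷ [])) (cong (λ c → count P? (upTo r) + c) single))
  where
  single : count P? (r ∷ []) ≡ (if does (P? r) then 1 else 0)
  single with does (P? r)
  ... | true  = refl
  ... | false = refl

count-≥-upTo : ∀ j r → count (j ≤?_) (upTo r) ≡ r ∸ j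
count-≥-upTo j zero    = sym (ℕ.0∸n≡0 j)
count-≥-upTo j (suc r) = trans (count-upTo-suc (j ≤?_) r)
  (trans (cong (_+ (if does (j ≤? r) then 1 else 0)) (count-≥-upTo j r)) last)
  where
  last : (r ∸ j) + (if does (j ≤? r) then 1 else 0) ≡ suc r ∸ j
  last with j ≤? r
  ... | yes j≤r rewrite dec-true (j ≤? r) j≤r = trans (ℕ.+-comm (r ∸ j) 1) (sym (ℕ.+-∸-assoc 1 j≤r))
  ... | no  j≰r rewrite dec-false (j ≤? r) j≰r =
    trans (ℕ.+-identityʳ (r ∸ j)) (trans (ℕ.m≤n⇒m∸n≡0 (ℕ.<⇒≤ (ℕ.≰⇒> j≰r))) (sym (ℕ.m≤n⇒m∸n≡0 (ℕ.≰⇒> j≰r))))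

count-≡-upTo : ∀ j r → count (_≟ j) (upTo r) ≡ (if does (j <? r) then 1 else 0)
count-≡-upTo j zero    rewrite dec-false (j <? 0) ℕ.n≮0 = refl
count-≡-upTo j (suc r) = trans (count-upTo-suc (_≟ j) r)
  (trans (cong (_+ (if does (r ≟ j) then 1 else 0)) (count-≡-upTo j r)) last)
  where
  last : (if does (j <? r) then 1 else 0) + (if does (r ≟ j) then 1 else 0) ≡ (if does (j <? suc r) then 1 else 0)
  last with ℕ.<-cmp j r
  ... | tri< j<r j≢r _
    rewrite dec-true (j <? r) j<r | dec-false (r ≟ j) (j≢r ∘ sym) | dec-true (j <? suc r) (ℕ.m<n⇒m<1+n j<r) = refl
  ... | tri≈ j≮r refl _
    rewrite dec-false (j <? j) j≮r | dec-true (j ≟ j) refl | dec-true (j <? suc j) ℕ.≤-refl = refl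
  ... | tri> j≮r j≢r r<j
    rewrite dec-false (j <? r) j≮r | dec-false (r ≟ j) (j≢r ∘ sym) | dec-false (j <? suc r) (ℕ.<⇒≱ (s≤s r<j)) = refl

-- The length of column j, counted from 0.
column : ℕ → List ℕ → ℕ
column j = count (j <?_)

count-boxes-column : ∀ j λs → count ((_≟ j) ∘ proj₂) (boxes λs) ≡ column j λs
count-boxes-column j []       = refl
count-boxes-column j (r ∷ rs) = begin
  count ((_≟ j) ∘ proj₂) (map (0 ,_) (upTo r) ++ map (map₁ suc) (boxes rs))
    ≡⟨ count-++ ((_≟ j) ∘ proj₂) (map (0 ,_) (upTo r)) (map (map₁ suc) (boxes rs)) ⟩
  count ((_≟ j) ∘ proj₂) (map (0 ,_) (upTo r)) + count ((_≟ j) ∘ proj₂) (map (map₁ suc) (boxes rs))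
    ≡⟨ cong₂ _+_ (trans (count-map ((_≟ j) ∘ proj₂) (0 ,_) (upTo r)) (count-≡-upTo j r))
                 (trans (count-map ((_≟ j) ∘ proj₂) (map₁ suc) (boxes rs)) (count-boxes-column j rs)) ⟩
  (if does (j <? r) then 1 else 0) + column j rs
    ≡⟨ single ⟩
  column j (r ∷ rs) ∎
  where
  open ≡-Reasoning
  single : (if does (j <? r) then 1 else 0) + column j rs ≡ column j (r ∷ rs)
  single with does (j <? r)
  ... | true  = refl
  ... | false = refl

count-boxes-∷ : {P : Box → Set} (P? : Decidable P) (r : ℕ) (rs : List ℕ) →
                count P? (boxes (r ∷ rs)) ≡ count (λ l → P? (0 , l)) (upTo r) + count (λ b → P? (map₁ suc b)) (boxes rs)
count-boxes-∷ P? r rs = trans (count-++ P? (map (0 ,_) (upTo r)) (map (map₁ suc) (boxes rs)))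
  (cong₂ _+_ (count-map P? (0 ,_) (upTo r)) (count-map P? (map₁ suc) (boxes rs)))

-- Within the first row the column condition only finds the box itself again, so this row
-- contributes the box and its arm, r - j boxes. Lower rows meet the hook in column j alone, which
-- gives the leg.
hook-first-row : ∀ r rs j → hook (r ∷ rs) (0 , j) ≡ (r ∸ j) + column j rs
hook-first-row r rs j = trans (count-boxes-∷ (inHook? (0 , j)) r rs) (cong₂ _+_
  (trans (count-cong (λ l → inHook? (0 , j) (0 , l)) (j ≤?_) arm (upTo r)) (count-≥-upTo j r))
  (trans (count-cong (λ b → inHook? (0 , j) (map₁ suc b)) ((_≟ j) ∘ proj₂) leg (boxes rs)) (count-boxes-column j rs)))
  where
  arm : ∀ l → InHook (0 , j) (0 , l) ⇔ (j ≤ l)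
  arm l = mk⇔ (λ { (inj₁ (_ , j≤l)) → j≤l ; (inj₂ (refl , _)) → ℕ.≤-refl }) (λ j≤l → inj₁ (refl , j≤l))
  leg : ∀ b → InHook (0 , j) (map₁ suc b) ⇔ (proj₂ b ≡ j)
  leg b = mk⇔ (λ { (inj₁ (() , _)) ; (inj₂ (e , _)) → e }) (λ e → inj₂ (e , z≤n))

-- Hooks reach only to the right and downwards, so a new first row is invisible to the boxes below
-- it.
hook-later-row : ∀ r rs b → hook (r ∷ rs) (map₁ suc b) ≡ hook rs b
hook-later-row r rs (i , j) = trans (count-boxes-∷ (inHook? (suc i , j)) r rs) (cong₂ _+_
  (count-none (λ l → inHook? (suc i , j) (0 , l)) {upTo r}
    (All.tabulate λ _ → λ { (inj₁ (() , _)) ; (inj₂ (_ , ())) }))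
  (count-cong (λ b → inHook? (suc i , j) (map₁ suc b)) (inHook? (i , j)) shift (boxes rs)))
  where
  shift : ∀ b → InHook (suc i , j) (map₁ suc b) ⇔ InHook (i , j) b
  shift b = mk⇔ (λ { (inj₁ (refl , p)) → inj₁ (refl , p) ; (inj₂ (e , s≤s p)) → inj₂ (e , p) })
                (λ { (inj₁ (refl , p)) → inj₁ (refl , p) ; (inj₂ (e , p)) → inj₂ (e , s≤s p) })

#hooks-∷ : ∀ h r rs → #hooks h (r ∷ rs) ≡ count (λ j → (r ∸ j) + column j rs ≟ h) (upTo r) + #hooks h rs
#hooks-∷ h r rs = begin
  count (_≟ h) (map (hook (r ∷ rs)) (boxes (r ∷ rs)))
    ≡⟨ count-map (_≟ h) (hook (r ∷ rs)) (boxes (r ∷ rs)) ⟩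
  count (λ b → hook (r ∷ rs) b ≟ h) (boxes (r ∷ rs))
    ≡⟨ count-boxes-∷ (λ b → hook (r ∷ rs) b ≟ h) r rs ⟩
  count (λ j → hook (r ∷ rs) (0 , j) ≟ h) (upTo r) + count (λ b → hook (r ∷ rs) (map₁ suc b) ≟ h) (boxes rs)
    ≡⟨ cong₂ _+_
         (count-cong (λ j → hook (r ∷ rs) (0 , j) ≟ h) (λ j → (r ∸ j) + column j rs ≟ h)
           (λ j → ≡⇒⇔ (hook-first-row r rs j)) (upTo r))
         (trans (count-cong (λ b → hook (r ∷ rs) (map₁ suc b) ≟ h) (λ b → hook rs b ≟ h)
           (λ b → ≡⇒⇔ (hook-later-row r rs b)) (boxes rs)) (sym (count-map (_≟ h) (hook rs) (boxes rs)))) ⟩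
  count (λ j → (r ∸ j) + column j rs ≟ h) (upTo r) + #hooks h rs ∎
  where
  open ≡-Reasoning
  ≡⇒⇔ : ∀ {x y} → x ≡ y → (x ≡ h) ⇔ (y ≡ h)
  ≡⇒⇔ refl = mk⇔ (λ e → e) (λ e → e)

-- Weighted generating functions of bounded partitions

Weight : Set
Weight = List ℕ → ℤ

gf : Weight → List (List ℕ) → Series
gf w []       = 𝟘
gf w (λs ∷ L) = w λs ·ˢ 𝕢^ ℕ.sum λs ⊕ gf w L

opaque
  unfolding _⊕_

  ·ˢ-⊗ : ∀ {n} c f g → c ·ˢ (f ⊗ g) ≈[ n ] f ⊗ (c ·ˢ g)
  ·ˢ-⊗ c f g = exact λ i → sym (trans (*ˢ-comm f (c ·ˢ g) i) (trans (·ˢ-*ˢ c g f i) (cong (c ℤ.*_) (*ˢ-comm g f i))))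

  ·ˢ-distribʳ : ∀ {n} c d f → (c ℤ.+ d) ·ˢ f ≈[ n ] c ·ˢ f ⊕ d ·ˢ f
  ·ˢ-distribʳ c d f = exact λ i → ℤ.*-distribʳ-+ (f i) c d

  ·ˢ-zero : ∀ {n} f → 0ℤ ·ˢ f ≈[ n ] 𝟘
  ·ˢ-zero f = exact λ i → ℤ.*-zeroˡ (f i)

  ·ˢ-one : ∀ {n} f → 1ℤ ·ˢ f ≈[ n ] f
  ·ˢ-one f = exact λ i → ℤ.*-identityˡ (f i)

·ˢ-cong : ∀ {n} c {f g} → f ≈[ n ] g → c ·ˢ f ≈[ n ] c ·ˢ g
·ˢ-cong c p = below λ i i≤n → cong (c ℤ.*_) (coeff p i i≤n)

-- Membership in a family is made part of the weight instead of filtering the list: all families are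
-- then summed over the same `inRectangle` lists, and one recursion on the largest part serves them
-- all.
_▸_ : {P : List ℕ → Set} → Decidable P → Weight → Weight
(P? ▸ w) λs = if does (P? λs) then w λs else 0ℤ

opaque
  unfolding _⊕_

  q^-coeff : ∀ e n → (q^ e) n ≡ (if does (e ≟ n) then 1ℤ else 0ℤ)
  q^-coeff zero    zero    = refl
  q^-coeff zero    (suc n) = refl
  q^-coeff (suc e) zero    = refl
  q^-coeff (suc e) (suc n) = trans (q^-coeff e n)
    (cong (if_then 1ℤ else 0ℤ) (does-⇔ (mk⇔ (cong suc) ℕ.suc-injective) (e ≟ n) (suc e ≟ suc n)))

  gf-coeff : {P : List ℕ → Set} (P? : Decidable P) (w : List ℕ → ℕ) (n : ℕ) (L : List (List ℕ)) →
             + ℕ.sum (map w (filter P? (filter (λ λs → ℕ.sum λs ≟ n) L))) ≡ gf (P? ▸ (+_ ∘ w)) L n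
  gf-coeff P? w n []       = refl
  gf-coeff P? w n (λs ∷ L) rewrite q^-coeff (ℕ.sum λs) n with does (ℕ.sum λs ≟ n)
  ... | false = trans (gf-coeff P? w n L) (sym (trans
    (cong (ℤ._+ gf (P? ▸ (+_ ∘ w)) L n) (ℤ.*-zeroʳ ((P? ▸ (+_ ∘ w)) λs))) (ℤ.+-identityˡ _)))
  ... | true  with does (P? λs)
  ...   | true  = trans (ℤ.pos-+ (w λs) _) (cong₂ ℤ._+_ (sym (ℤ.*-identityʳ (+ w λs))) (gf-coeff P? w n L))
  ...   | false = trans (gf-coeff P? w n L) (sym (ℤ.+-identityˡ _))

module GeneratingFunctions (n : ℕ) where
  open TruncatedSeries n public

  gf-++ : ∀ w L L′ → gf w (L ++ L′) ≈[ n ] gf w L ⊕ gf w L′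
  gf-++ w []       L′ = ≈-sym (⊕-identityˡ (gf w L′))
  gf-++ w (λs ∷ L) L′ = ≈-trans (⊕-congˡ (gf-++ w L L′)) (≈-sym (⊕-assoc _ _ _))

  gf-map-∷ : ∀ w r L → gf w (map (r ∷_) L) ≈[ n ] 𝕢^ r ⊗ gf (w ∘ (r ∷_)) L
  gf-map-∷ w r []       = solve 1 (λ x → con 0ℤ := x :* con 0ℤ) ≈-refl (𝕢^ r)
  gf-map-∷ w r (λs ∷ L) = begin
    w (r ∷ λs) ·ˢ 𝕢^ (r + ℕ.sum λs) ⊕ gf w (map (r ∷_) L)
      ≈⟨ ⊕-cong (≈-trans (·ˢ-cong (w (r ∷ λs)) (≈-sym (𝕢^-merge {r} refl))) (·ˢ-⊗ (w (r ∷ λs)) (𝕢^ r) (𝕢^ ℕ.sum λs)))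
                (gf-map-∷ w r L) ⟩
    𝕢^ r ⊗ (w (r ∷ λs) ·ˢ 𝕢^ ℕ.sum λs) ⊕ 𝕢^ r ⊗ gf (w ∘ (r ∷_)) L
      ≈⟨ ⊗-distribˡ-⊕ _ _ _ ⟨
    𝕢^ r ⊗ (w (r ∷ λs) ·ˢ 𝕢^ ℕ.sum λs ⊕ gf (w ∘ (r ∷_)) L) ∎

  gf-cong : ∀ {v w} L → (∀ {λs} → λs ∈ L → v λs ≡ w λs) → gf v L ≈[ n ] gf w L
  gf-cong []       v≡w = ≈-refl
  gf-cong (λs ∷ L) v≡w = ⊕-cong (≡⇒≈ (cong (_·ˢ 𝕢^ ℕ.sum λs) (v≡w (here refl)))) (gf-cong L (v≡w ∘ there))

  gf-zero : ∀ {w} L → (∀ {λs} → λs ∈ L → w λs ≡ 0ℤ) → gf w L ≈[ n ] 𝟘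
  gf-zero []       w≡0 = ≈-refl
  gf-zero (λs ∷ L) w≡0 = ≈-trans (⊕-cong
    (≈-trans (≡⇒≈ (cong (_·ˢ 𝕢^ ℕ.sum λs) (w≡0 (here refl)))) (·ˢ-zero (𝕢^ ℕ.sum λs))) (gf-zero L (w≡0 ∘ there)))
    (⊕-identityʳ 𝟘)

  gf-⊕ : ∀ v w L → gf (λ λs → v λs ℤ.+ w λs) L ≈[ n ] gf v L ⊕ gf w L
  gf-⊕ v w []       = ≈-sym (⊕-identityʳ 𝟘)
  gf-⊕ v w (λs ∷ L) = ≈-trans (⊕-cong (·ˢ-distribʳ (v λs) (w λs) (𝕢^ ℕ.sum λs)) (gf-⊕ v w L))
    (solve 4 (λ a b c d → (a :+ b) :+ (c :+ d) := (a :+ c) :+ (b :+ d)) ≈-refl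
      (v λs ·ˢ 𝕢^ ℕ.sum λs) (w λs ·ˢ 𝕢^ ℕ.sum λs) (gf v L) (gf w L))

inRectangle-zero : ∀ ℓ → inRectangle ℓ 0 ≡ [] ∷ []
inRectangle-zero zero    = refl
inRectangle-zero (suc ℓ) = refl

-- The outer range ends with the largest admissible part `suc k`, so the partitions that use it form
-- the final block of the list.
inRectangle-suc : ∀ ℓ k → inRectangle (suc ℓ) (suc k) ≡
                  inRectangle (suc ℓ) k ++ map (suc k ∷_) (inRectangle ℓ (suc k))
inRectangle-suc ℓ k = cong ([] ∷_) (begin
  concatMap rows (upTo (suc k))                          ≡⟨ cong (concatMap rows) (List.upTo-∷ʳ k) ⟨
  concatMap rows (upTo k ∷ʳ k)                           ≡⟨ List.concatMap-++ rows (upTo k) (k ∷ []) ⟩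
  concatMap rows (upTo k) ++ (rows k ++ [])
    ≡⟨ cong (concatMap rows (upTo k) ++_) (List.++-identityʳ (rows k)) ⟩
  concatMap rows (upTo k) ++ rows k                      ∎)
  where
  open ≡-Reasoning
  rows : ℕ → List (List ℕ)
  rows c = map (suc c ∷_) (inRectangle ℓ (suc c))

gf-inRectangle-suc : ∀ n w ℓ k → gf w (inRectangle (suc ℓ) (suc k)) ≈[ n ]
                     gf w (inRectangle (suc ℓ) k) ⊕ 𝕢^ suc k ⊗ gf (w ∘ (suc k ∷_)) (inRectangle ℓ (suc k))
gf-inRectangle-suc n w ℓ k = ≈-trans (≡⇒≈ (cong (gf w) (inRectangle-suc ℓ k)))
  (≈-trans (gf-++ w (inRectangle (suc ℓ) k) _) (⊕-congˡ (gf-map-∷ w (suc k) (inRectangle ℓ (suc k)))))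
  where open GeneratingFunctions n

-- A partition with ℓ + 1 parts has size at least ℓ + 1 and is invisible up to degree ℓ. In the
-- induction, removing the largest part costs one row and, by `𝕢^-raise`, one degree of precision.
gf-inRectangle-stable : ∀ w ℓ k → gf w (inRectangle ℓ k) ≈[ ℓ ] gf w (inRectangle (suc ℓ) k)
gf-inRectangle-stable w ℓ zero rewrite inRectangle-zero ℓ = below λ _ _ → refl
gf-inRectangle-stable w zero (suc k) = begin
  gf w (inRectangle 0 k)                                ≈⟨ gf-inRectangle-stable w 0 k ⟩
  gf w (inRectangle 1 k)                                ≈⟨ ⊕-identityʳ (gf w (inRectangle 1 k)) ⟨
  gf w (inRectangle 1 k) ⊕ 𝟘
    ≈⟨ ⊕-congˡ (𝕢^-low (suc k) (gf (w ∘ (suc k ∷_)) (inRectangle 0 (suc k))) (s≤s z≤n)) ⟨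
  gf w (inRectangle 1 k) ⊕ 𝕢^ suc k ⊗ gf (w ∘ (suc k ∷_)) (inRectangle 0 (suc k))  ≈⟨ gf-inRectangle-suc 0 w 0 k ⟨
  gf w (inRectangle 1 (suc k))                          ∎
  where open GeneratingFunctions 0
gf-inRectangle-stable w (suc ℓ) (suc k) = begin
  gf w (inRectangle (suc ℓ) (suc k))
    ≈⟨ gf-inRectangle-suc (suc ℓ) w ℓ k ⟩
  gf w (inRectangle (suc ℓ) k) ⊕ 𝕢^ suc k ⊗ gf (w ∘ (suc k ∷_)) (inRectangle ℓ (suc k))
    ≈⟨ ⊕-cong (gf-inRectangle-stable w (suc ℓ) k) (𝕢^-raise k (gf-inRectangle-stable (w ∘ (suc k ∷_)) ℓ (suc k))) ⟩
  gf w (inRectangle (suc (suc ℓ)) k) ⊕ 𝕢^ suc k ⊗ gf (w ∘ (suc k ∷_)) (inRectangle (suc ℓ) (suc k))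
    ≈⟨ gf-inRectangle-suc (suc ℓ) w (suc ℓ) k ⟨
  gf w (inRectangle (suc (suc ℓ)) (suc k)) ∎
  where open GeneratingFunctions (suc ℓ)

-- Up to degree n it suffices to allow n parts.
parts≤ : (n k : ℕ) → Weight → Series
parts≤ n k w = gf w (inRectangle n k)

-- Removing a largest part leaves one row fewer. By stability the bound n on the number of parts can
-- stay fixed nevertheless, so that the recursion closes on `parts≤ n`.
parts≤-suc : ∀ n k w → parts≤ n (suc k) w ≈[ n ] parts≤ n k w ⊕ 𝕢^ suc k ⊗ parts≤ n (suc k) (w ∘ (suc k ∷_))
parts≤-suc zero    k w = ≈-sym (≈-trans (⊕-congˡ (𝕢^-low (suc k) (parts≤ 0 (suc k) (w ∘ (suc k ∷_))) (s≤s z≤n)))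
  (⊕-identityʳ (gf w (inRectangle 0 k))))
  where open GeneratingFunctions 0
parts≤-suc (suc ℓ) k w = ≈-trans (gf-inRectangle-suc (suc ℓ) w ℓ k)
  (⊕-congˡ (𝕢^-raise k (gf-inRectangle-stable (w ∘ (suc k ∷_)) ℓ (suc k))))
  where open GeneratingFunctions (suc ℓ)

-- Indicator weights, index bounds and exponent arithmetic

ind : {A : Set} → Dec A → ℤ
ind a? = if does a? then 1ℤ else 0ℤ

ind-cong : {A B : Set} (a? : Dec A) (b? : Dec B) → A ⇔ B → ind a? ≡ ind b?
ind-cong a? b? A⇔B = cong (if_then 1ℤ else 0ℤ) (does-⇔ A⇔B a? b?)

ind-true : {A : Set} (a? : Dec A) → A → ind a? ≡ 1ℤ
ind-true a? p = cong (if_then 1ℤ else 0ℤ) (dec-true a? p)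

ind-false : {A : Set} (a? : Dec A) → ¬ A → ind a? ≡ 0ℤ
ind-false a? ¬p = cong (if_then 1ℤ else 0ℤ) (dec-false a? ¬p)

-- When λs are the rows below a box in column j, the rows longer than j make up its leg; the weight
-- selects leg l.
δ : ℕ → ℕ → Weight
δ j l λs = ind (column j λs ≟ l)

column-zero : ∀ {j λs} → All (_≤ j) λs → column j λs ≡ 0
column-zero {j} bnd = count-none (j <?_) (All.map ℕ.≤⇒≯ bnd)

column-∷ : ∀ {j x} λs → j < x → column j (x ∷ λs) ≡ suc (column j λs)
column-∷ {j} λs j<x = cong length (List.filter-accept (j <?_) j<x)

δ-zero : ∀ {j λs} → All (_≤ j) λs → δ j 0 λs ≡ 1ℤ
δ-zero {j} {λs} bnd = ind-true (column j λs ≟ 0) (column-zero bnd)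

δ-suc : ∀ {j λs} l → All (_≤ j) λs → δ j (suc l) λs ≡ 0ℤ
δ-suc {j} {λs} l bnd = ind-false (column j λs ≟ suc l) λ e → ℕ.0≢1+n (trans (sym (column-zero bnd)) e)

δ-∷-zero : ∀ {j x} λs → j < x → δ j 0 (x ∷ λs) ≡ 0ℤ
δ-∷-zero {j} {x} λs j<x = ind-false (column j (x ∷ λs) ≟ 0) λ e → ℕ.1+n≢0 (trans (sym (column-∷ λs j<x)) e)

δ-∷-suc : ∀ {j x} l λs → j < x → δ j (suc l) (x ∷ λs) ≡ δ j l λs
δ-∷-suc {j} {x} l λs j<x = ind-cong (column j (x ∷ λs) ≟ suc l) (column j λs ≟ l)
  (mk⇔ (λ e → ℕ.suc-injective (trans (sym (column-∷ λs j<x)) e)) (λ e → trans (column-∷ λs j<x) (cong suc e)))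

▸-cong : {P : List ℕ → Set} (P? : Decidable P) (v w : Weight) {λs : List ℕ} →
         (P λs → v λs ≡ w λs) → (P? ▸ v) λs ≡ (P? ▸ w) λs
▸-cong P? v w {λs} p with P? λs
... | yes Pλs = p Pλs
... | no  _   = refl

▸-zero : {P : List ℕ → Set} (P? : Decidable P) (w : Weight) {λs : List ℕ} →
         (P λs → w λs ≡ 0ℤ) → (P? ▸ w) λs ≡ 0ℤ
▸-zero P? w {λs} p with P? λs
... | yes Pλs = p Pλs
... | no  _   = refl

▸-+ : {P : List ℕ → Set} (P? : Decidable P) (v w : Weight) (λs : List ℕ) →
      (P? ▸ (λ μ → v μ ℤ.+ w μ)) λs ≡ (P? ▸ v) λs ℤ.+ (P? ▸ w) λs
▸-+ P? v w λs with does (P? λs)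
... | true  = refl
... | false = refl

odd-2k+1 : ∀ k → Odd (suc (2 * k))
odd-2k+1 k 2∣ with () ← ∣1⇒≡1 (∣m+n∣m⇒∣n {2} {2 * k} {1} (subst (2 ∣_) (ℕ.+-comm 1 (2 * k)) 2∣) (m∣m*n k))

even-2k+2 : ∀ k → ¬ Odd (suc (suc (2 * k)))
even-2k+2 k odd = odd (subst (2 ∣_) (ℕ.*-suc 2 k) (m∣m*n (suc k)))

-- The sum 0 + 1 + ... + (j - 1). Unlike the quotient j (j - 1) / 2 it satisfies a recursion free of
-- division.
T : ℕ → ℕ
T zero    = 0
T (suc j) = T j + j

T≡ : ∀ j → j * (j ∸ 1) / 2 ≡ T j
T≡ j = trans (cong (_/ 2) (double j)) (m*n/n≡m (T j) 2)
  where
  arith : ∀ j → suc (suc j) * suc j ≡ suc j * j + suc j * 2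
  arith = ℕ.solve-∀
  double : ∀ j → j * (j ∸ 1) ≡ T j * 2
  double zero          = refl
  double (suc zero)    = refl
  double (suc (suc j)) = trans (arith j) (trans (cong (_+ suc j * 2) (double (suc j)))
    (sym (ℕ.*-distribʳ-+ 2 (T (suc j)) (suc j))))

-- Extension by zero beyond B. The bounds on the index j of the theorem thus travel inside the
-- summand while arms, legs and columns are reindexed.
cut : ℕ → (ℕ → Series) → ℕ → Series
cut B f i = if does (i <? B) then f i else 𝟘

cut-< : ∀ {B} f i → i < B → cut B f i ≡ f i
cut-< {B} f i i<B rewrite dec-true (i <? B) i<B = refl

cut-≥ : ∀ {B} f i → B ≤ i → cut B f i ≡ 𝟘
cut-≥ {B} f i B≤i rewrite dec-false (i <? B) (ℕ.≤⇒≯ B≤i) = refl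

⌊2n/2⌋≡n : ∀ n → ⌊ 2 * n /2⌋ ≡ n
⌊2n/2⌋≡n n = trans (cong ⌊_/2⌋ (cong (λ c → n + c) (ℕ.+-identityʳ n))) (sym (ℕ.n≡⌊n+n/2⌋ n))

2n<h⇒n<⌈h/2⌉ : ∀ {n h} → 2 * n < h → n < ⌈ h /2⌉
2n<h⇒n<⌈h/2⌉ {n} {h} 2n<h = subst (_≤ ⌈ h /2⌉) (cong suc (⌊2n/2⌋≡n n)) (ℕ.⌈n/2⌉-mono 2n<h)

2n+1<h⇒n<⌊h/2⌋ : ∀ {n h} → suc (2 * n) < h → n < ⌊ h /2⌋
2n+1<h⇒n<⌊h/2⌋ {n} {h} 2n+1<h = subst (_≤ ⌊ h /2⌋) (cong suc (⌊2n/2⌋≡n n)) (ℕ.⌊n/2⌋-mono 2n+1<h)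

ind-shift : ∀ s l j λs → ind (s + column j λs ≟ s + l) ≡ δ j l λs
ind-shift s l j λs = ind-cong (s + column j λs ≟ s + l) (column j λs ≟ l)
  (mk⇔ (ℕ.+-cancelˡ-≡ s _ _) (cong (λ c → s + c)))

ind-shift-< : ∀ {s h} j λs → h < s → ind (s + column j λs ≟ h) ≡ 0ℤ
ind-shift-< {s} {h} j λs h<s = ind-false (s + column j λs ≟ h) λ e →
  ℕ.<⇒≱ h<s (subst (s ≤_) e (ℕ.m≤m+n s (column j λs)))

-- The two columns could differ only by parts equal to 2M + 2, which is even. Boxes in odd columns
-- thereby reduce to the count for even columns.
column-odd : ∀ M {λs} → All Odd λs → column (suc (2 * M)) λs ≡ column (2 * suc M) λs
column-odd M []                 = refl
column-odd M (_∷_ {x} {λs} o os)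
  with does (suc (2 * M) <? x) | does (2 * suc M <? x)
     | does-⇔ skip (suc (2 * M) <? x) (2 * suc M <? x)
  where
  skip : suc (2 * M) < x ⇔ 2 * suc M < x
  skip = mk⇔ (λ p → ℕ.≤∧≢⇒< (subst (_≤ x) (sym (ℕ.*-suc 2 M)) p) λ { refl → o (m∣m*n (suc M)) })
             (λ p → ℕ.≤-trans (ℕ.n≤1+n _) (subst (_< x) (ℕ.*-suc 2 M) p))
... | true  | .true  | refl = cong suc (column-odd M os)
... | false | .false | refl = column-odd M os

#ʷ : ℕ → Weight
#ʷ h λs = + #hooks h λs

1ʷ : Weight
1ʷ _ = 1ℤ

-- `h₁` and `h₂` are the hook lengths for leg l and arms 2A and 2A + 1. Once h is expressed by A and
-- l, the truncated subtractions are visibly exact.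
module Exponents (A l : ℕ) where
  private
    h₁ h₂ : ℕ
    h₁ = suc (2 * A) + l
    h₂ = suc (suc (2 * A)) + l

    subtract : ∀ {x} y z → x ≡ y + z → x ∸ y ≡ z
    subtract y z refl = ℕ.m+n∸m≡n y z

  h₁∸A∸1 : h₁ ∸ A ∸ 1 ≡ A + l
  h₁∸A∸1 = cong (_∸ 1) (subtract A (suc (A + l)) (arith A l))
    where
    arith : ∀ A l → suc (2 * A) + l ≡ A + suc (A + l)
    arith = ℕ.solve-∀

  2h₁∸4A : 2 * h₁ ∸ 4 * A ≡ 2 * l + 2
  2h₁∸4A = subtract (4 * A) (2 * l + 2) (arith A l)
    where
    arith : ∀ A l → 2 * (suc (2 * A) + l) ≡ 4 * A + (2 * l + 2)
    arith = ℕ.solve-∀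

  h₂∸A∸2 : h₂ ∸ A ∸ 2 ≡ A + l
  h₂∸A∸2 = cong (_∸ 2) (subtract A (suc (suc (A + l))) (arith A l))
    where
    arith : ∀ A l → suc (suc (2 * A)) + l ≡ A + suc (suc (A + l))
    arith = ℕ.solve-∀

  2h₂∸4A∸2 : 2 * h₂ ∸ 4 * A ∸ 2 ≡ 2 * l + 2
  2h₂∸4A∸2 = cong (_∸ 2) (subtract (4 * A) (2 + (2 * l + 2)) (arith A l))
    where
    arith : ∀ A l → 2 * (suc (suc (2 * A)) + l) ≡ 4 * A + (2 + (2 * l + 2))
    arith = ℕ.solve-∀

  3h₂∸4A∸3 : 3 * h₂ ∸ 4 * A ∸ 3 ≡ 2 * A + 3 * l + 3
  3h₂∸4A∸3 = cong (_∸ 3) (subtract (4 * A) (3 + (2 * A + 3 * l + 3)) (arith A l))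
    where
    arith : ∀ A l → 3 * (suc (suc (2 * A)) + l) ≡ 4 * A + (3 + (2 * A + 3 * l + 3))
    arith = ℕ.solve-∀

-- Recursions on the largest part for both families

module Families (n : ℕ) where
  open GeneratingFunctions n public

  parts≤-cong : ∀ k v w → (∀ {λs} → All (_≤ k) λs → v λs ≡ w λs) → parts≤ n k v ≈[ n ] parts≤ n k w
  parts≤-cong k v w p = gf-cong (inRectangle n k) λ ∈ → p (proj₂ (proj₂ (inRectangle-sound n k ∈)))

  parts≤-extend : ∀ {k k′} w → n ≤ k → k ≤ k′ → parts≤ n k′ w ≈[ n ] parts≤ n k w
  parts≤-extend {k} w n≤k k≤k′ = go (ℕ.≤⇒≤′ k≤k′)
    where
    go : ∀ {k′} → k ℕ.≤′ k′ → parts≤ n k′ w ≈[ n ] parts≤ n k w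
    go (ℕ.≤′-reflexive refl) = ≈-refl
    go (ℕ.≤′-step {k′} p)    = begin
      parts≤ n (suc k′) w                                       ≈⟨ parts≤-suc n k′ w ⟩
      parts≤ n k′ w ⊕ 𝕢^ suc k′ ⊗ parts≤ n (suc k′) (w ∘ (suc k′ ∷_))
        ≈⟨ ⊕-cong (go p) (𝕢^-low (suc k′) (parts≤ n (suc k′) (w ∘ (suc k′ ∷_))) (s≤s (ℕ.≤-trans n≤k (ℕ.≤′⇒≤ p)))) ⟩
      parts≤ n k w ⊕ 𝟘                                          ≈⟨ ⊕-identityʳ (parts≤ n k w) ⟩
      parts≤ n k w                                              ∎

  module Restricted {P : List ℕ → Set} (P? : Decidable P) where

    restricted : ℕ → Weight → Series
    restricted k w = parts≤ n k (P? ▸ w)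

    restricted-cong : ∀ k v w → (∀ {λs} → P λs → All (_≤ k) λs → v λs ≡ w λs) → restricted k v ≈[ n ] restricted k w
    restricted-cong k v w p = parts≤-cong k (P? ▸ v) (P? ▸ w) λ bnd → ▸-cong P? v w λ Pλs → p Pλs bnd

    restricted-zero : ∀ k w → (∀ {λs} → P λs → All (_≤ k) λs → w λs ≡ 0ℤ) → restricted k w ≈[ n ] 𝟘
    restricted-zero k w p = gf-zero (inRectangle n k) λ ∈ →
      ▸-zero P? w λ Pλs → p Pλs (proj₂ (proj₂ (inRectangle-sound n k ∈)))

    restricted-⊕ : ∀ k v w → restricted k (λ λs → v λs ℤ.+ w λs) ≈[ n ] restricted k v ⊕ restricted k w
    restricted-⊕ k v w = ≈-trans (gf-cong (inRectangle n k) λ {λs} _ → ▸-+ P? v w λs)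
                                 (gf-⊕ (P? ▸ v) (P? ▸ w) (inRectangle n k))

    -- Linearity in the weight: the number of hits in a row is a sum of indicators, one for each
    -- column.
    restricted-count : ∀ {Q : List ℕ → ℕ → Set} (Q? : ∀ λs → Decidable (Q λs)) k r →
      restricted k (λ λs → + count (Q? λs) (upTo r)) ≈[ n ] ∑< r (λ j → restricted k λ λs → ind (Q? λs j))
    restricted-count Q? k zero    = restricted-zero k _ λ _ _ → refl
    restricted-count Q? k (suc r) = begin
      restricted k (λ λs → + count (Q? λs) (upTo (suc r)))
        ≈⟨ restricted-cong k (λ λs → + count (Q? λs) (upTo (suc r)))
             (λ λs → + count (Q? λs) (upTo r) ℤ.+ ind (Q? λs r))
             (λ {λs} _ _ → peel λs) ⟩
      restricted k (λ λs → + count (Q? λs) (upTo r) ℤ.+ ind (Q? λs r))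
        ≈⟨ restricted-⊕ k (λ λs → + count (Q? λs) (upTo r)) (λ λs → ind (Q? λs r)) ⟩
      restricted k (λ λs → + count (Q? λs) (upTo r)) ⊕ restricted k (λ λs → ind (Q? λs r))
        ≈⟨ ⊕-congʳ (restricted-count Q? k r) ⟩
      ∑< (suc r) (λ j → restricted k λ λs → ind (Q? λs j)) ∎
      where
      peel : ∀ λs → + count (Q? λs) (upTo (suc r)) ≡ + count (Q? λs) (upTo r) ℤ.+ ind (Q? λs r)
      peel λs rewrite count-upTo-suc (Q? λs) r with does (Q? λs r)
      ... | true  = ℤ.pos-+ (count (Q? λs) (upTo r)) 1
      ... | false = ℤ.pos-+ (count (Q? λs) (upTo r)) 0

    restricted-#hooks-∷ : ∀ h r k → restricted k (λ λs → + #hooks h (r ∷ λs)) ≈[ n ]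
      ∑< r (λ j → restricted k λ λs → ind ((r ∸ j) + column j λs ≟ h)) ⊕ restricted k (#ʷ h)
    restricted-#hooks-∷ h r k = begin
      restricted k (λ λs → + #hooks h (r ∷ λs))
        ≈⟨ restricted-cong k (λ λs → + #hooks h (r ∷ λs)) (λ λs → + row λs ℤ.+ + #hooks h λs)
             (λ {λs} _ _ → trans (cong +_ (#hooks-∷ h r λs)) (ℤ.pos-+ (row λs) (#hooks h λs))) ⟩
      restricted k (λ λs → + row λs ℤ.+ + #hooks h λs)
        ≈⟨ restricted-⊕ k (λ λs → + row λs) (#ʷ h) ⟩
      restricted k (λ λs → + row λs) ⊕ restricted k (#ʷ h)
        ≈⟨ ⊕-congʳ (restricted-count (λ λs j → (r ∸ j) + column j λs ≟ h) k r) ⟩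
      ∑< r (λ j → restricted k λ λs → ind ((r ∸ j) + column j λs ≟ h)) ⊕ restricted k (#ʷ h) ∎
      where
      row : List ℕ → ℕ
      row λs = count (λ j → (r ∸ j) + column j λs ≟ h) (upTo r)

  module Distinct = Restricted unique?
  module AllOdd   = Restricted (all? odd?)
  open Distinct using () renaming (restricted to distinct) public

  -- The bound 2k admits exactly the k odd sizes 1, 3, ..., 2k - 1, and the next odd size is 2k + 1.
  odd : ℕ → Weight → Series
  odd k = AllOdd.restricted (2 * k)

  -- After a part k + 1 is removed, the rest must not contain another one. Splitting the rest once
  -- more by its largest part isolates that case, whose weight is zero.
  distinct-suc : ∀ k w → distinct (suc k) w ≈[ n ] distinct k w ⊕ 𝕢^ suc k ⊗ distinct k (w ∘ (suc k ∷_))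
  distinct-suc k w = begin
    distinct (suc k) w
      ≈⟨ parts≤-suc n k (unique? ▸ w) ⟩
    distinct k w ⊕ 𝕢^ suc k ⊗ parts≤ n (suc k) v
      ≈⟨ ⊕-congˡ (⊗-congˡ (parts≤-suc n k v)) ⟩
    distinct k w ⊕ 𝕢^ suc k ⊗ (parts≤ n k v ⊕ 𝕢^ suc k ⊗ parts≤ n (suc k) (v ∘ (suc k ∷_)))
      ≈⟨ ⊕-congˡ (⊗-congˡ (⊕-cong
           (parts≤-cong k v (unique? ▸ (w ∘ (suc k ∷_))) λ {λs} bnd →
             cong (if_then w (suc k ∷ λs) else 0ℤ) (does-⇔ (new bnd) (unique? (suc k ∷ λs)) (unique? λs)))
           (⊗-congˡ (gf-zero (inRectangle n (suc k)) λ _ →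
             ▸-zero unique? w λ { ((≢ ∷ _) ∷ _) → contradiction refl ≢ })))) ⟩
    distinct k w ⊕ 𝕢^ suc k ⊗ (distinct k (w ∘ (suc k ∷_)) ⊕ 𝕢^ suc k ⊗ 𝟘)
      ≈⟨ solve 3 (λ a q b → a :+ q :* (b :+ q :* con 0ℤ) := a :+ q :* b) ≈-refl
           (distinct k w) (𝕢^ suc k) (distinct k (w ∘ (suc k ∷_))) ⟩
    distinct k w ⊕ 𝕢^ suc k ⊗ distinct k (w ∘ (suc k ∷_)) ∎
    where
    v : Weight
    v = (unique? ▸ w) ∘ (suc k ∷_)
    new : ∀ {λs} → All (_≤ k) λs → Unique (suc k ∷ λs) ⇔ Unique λs
    new bnd = mk⇔ (λ { (_ ∷ u) → u }) (λ u → All.map (λ y≤k e → ℕ.<⇒≢ (s≤s y≤k) (sym e)) bnd ∷ u)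

  -- Raising the bound by two admits an even size, which has weight zero, and the size 2k + 1. The
  -- latter may recur, so the bound does not drop in the last summand.
  odd-suc : ∀ k w → odd (suc k) w ≈[ n ] odd k w ⊕ 𝕢^ suc (2 * k) ⊗ odd (suc k) (w ∘ (suc (2 * k) ∷_))
  odd-suc k w = begin
    odd (suc k) w
      ≈⟨ drop-even w ⟩
    parts≤ n (suc (2 * k)) (all? odd? ▸ w)
      ≈⟨ parts≤-suc n (2 * k) (all? odd? ▸ w) ⟩
    odd k w ⊕ 𝕢^ suc (2 * k) ⊗ parts≤ n (suc (2 * k)) ((all? odd? ▸ w) ∘ (suc (2 * k) ∷_))
      ≈⟨ ⊕-congˡ (⊗-congˡ (≈-trans
           (gf-cong (inRectangle n (suc (2 * k))) λ {λs} _ →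
             cong (if_then w (suc (2 * k) ∷ λs) else 0ℤ)
                  (does-⇔ head-odd (all? odd? (suc (2 * k) ∷ λs)) (all? odd? λs)))
           (≈-sym (drop-even (w ∘ (suc (2 * k) ∷_)))))) ⟩
    odd k w ⊕ 𝕢^ suc (2 * k) ⊗ odd (suc k) (w ∘ (suc (2 * k) ∷_)) ∎
    where
    head-odd : ∀ {λs} → All Odd (suc (2 * k) ∷ λs) ⇔ All Odd λs
    head-odd = mk⇔ (λ { (_ ∷ o) → o }) (odd-2k+1 k ∷_)
    drop-even : ∀ w → odd (suc k) w ≈[ n ] parts≤ n (suc (2 * k)) (all? odd? ▸ w)
    drop-even w = begin
      parts≤ n (2 * suc k) (all? odd? ▸ w)
        ≈⟨ ≡⇒≈ (cong (λ m → parts≤ n m (all? odd? ▸ w)) (ℕ.*-suc 2 k)) ⟩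
      parts≤ n (suc (suc (2 * k))) (all? odd? ▸ w)
        ≈⟨ parts≤-suc n (suc (2 * k)) (all? odd? ▸ w) ⟩
      parts≤ n (suc (2 * k)) (all? odd? ▸ w)
        ⊕ 𝕢^ suc (suc (2 * k)) ⊗ parts≤ n (suc (suc (2 * k))) ((all? odd? ▸ w) ∘ (suc (suc (2 * k)) ∷_))
        ≈⟨ ⊕-congˡ (⊗-congˡ (gf-zero (inRectangle n (suc (suc (2 * k)))) λ _ →
             ▸-zero (all? odd?) w λ { (o ∷ _) → contradiction o (even-2k+2 k) })) ⟩
      parts≤ n (suc (2 * k)) (all? odd? ▸ w) ⊕ 𝕢^ suc (suc (2 * k)) ⊗ 𝟘
        ≈⟨ solve 2 (λ a q → a :+ q :* con 0ℤ := a)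
             ≈-refl (parts≤ n (suc (2 * k)) (all? odd? ▸ w)) (𝕢^ suc (suc (2 * k))) ⟩
      parts≤ n (suc (2 * k)) (all? odd? ▸ w) ∎

  a-coeff : ∀ h N → n ≤ N → + a h n ≡ odd N (#ʷ h) n
  a-coeff h N n≤N = trans (gf-coeff (all? odd?) (#hooks h) n (inRectangle n n))
    (sym (coeff (parts≤-extend (all? odd? ▸ #ʷ h) ℕ.≤-refl (ℕ.≤-trans n≤N (ℕ.m≤n*m N 2))) n ℕ.≤-refl))

  b-coeff : ∀ h N → n ≤ N → + b h n ≡ distinct N (#ʷ h) n
  b-coeff h N n≤N = trans (gf-coeff unique? (#hooks h) n (inRectangle n n))
    (sym (coeff (parts≤-extend (unique? ▸ #ʷ h) ℕ.≤-refl n≤N) n ℕ.≤-refl))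

  -- Total generating functions as q-products

  parts≤-zero : ∀ w → parts≤ n 0 w ≈[ n ] w [] ·ˢ 𝟙
  parts≤-zero w rewrite inRectangle-zero n = ≈-trans (⊕-identityʳ (w [] ·ˢ 𝕢^ 0)) (·ˢ-cong (w []) 𝕢^0)

  distinct-1-suc : ∀ k → distinct (suc k) 1ʷ ≈[ n ] distinct k 1ʷ ⊗ (𝟙 ⊕ 𝕢^ suc k)
  distinct-1-suc k = ≈-trans (distinct-suc k 1ʷ)
    (solve 2 (λ f q → f :+ q :* f := f :* (con 1ℤ :+ q)) ≈-refl (distinct k 1ʷ) (𝕢^ suc k))

  distinct-1-⨾ : ∀ m k → distinct m 1ʷ ⊗ ⟨ -ˢ q^ suc m ⨾q^ 1 ⟩ k ≈[ n ] distinct (m + k) 1ʷ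
  distinct-1-⨾ m zero    = ≈-trans (⊗-congˡ (⨾-zero (-ˢ q^ suc m) 1)) (≈-trans (⊗-identityʳ (distinct m 1ʷ))
    (≡⇒≈ (cong (λ k → distinct k 1ʷ) (sym (ℕ.+-identityʳ m)))))
  distinct-1-⨾ m (suc k) = begin
    distinct m 1ʷ ⊗ ⟨ -ˢ q^ suc m ⨾q^ 1 ⟩ suc k
      ≈⟨ ⊗-congˡ (⨾-−q-suc (suc m) 1 k) ⟩
    distinct m 1ʷ ⊗ (⟨ -ˢ q^ suc m ⨾q^ 1 ⟩ k ⊗ (𝟙 ⊕ 𝕢^ (suc m + 1 * k)))
      ≈⟨ ⊗-assoc (distinct m 1ʷ) (⟨ -ˢ q^ suc m ⨾q^ 1 ⟩ k) (𝟙 ⊕ 𝕢^ (suc m + 1 * k)) ⟨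
    distinct m 1ʷ ⊗ ⟨ -ˢ q^ suc m ⨾q^ 1 ⟩ k ⊗ (𝟙 ⊕ 𝕢^ (suc m + 1 * k))
      ≈⟨ ⊗-cong (distinct-1-⨾ m k) (⊕-congˡ (𝕢^-cong (cong (λ j → suc (m + j)) (ℕ.*-identityˡ k)))) ⟩
    distinct (m + k) 1ʷ ⊗ (𝟙 ⊕ 𝕢^ suc (m + k))
      ≈⟨ distinct-1-suc (m + k) ⟨
    distinct (suc (m + k)) 1ʷ
      ≈⟨ ≡⇒≈ (cong (λ k → distinct k 1ʷ) (sym (ℕ.+-suc m k))) ⟩
    distinct (m + suc k) 1ʷ ∎

  distinct-1-∞ : ∀ N → n ≤ N → distinct N 1ʷ ≈[ n ] ⟨ -ˢ q^ 1 ⨾q^ 1 ⟩∞ refl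
  distinct-1-∞ N n≤N = begin
    distinct N 1ʷ                                ≈⟨ distinct-1-⨾ 0 N ⟨
    distinct 0 1ʷ ⊗ ⟨ -ˢ q^ 1 ⨾q^ 1 ⟩ N          ≈⟨ ⊗-congʳ (≈-trans (parts≤-zero (unique? ▸ 1ʷ)) (·ˢ-one 𝟙)) ⟩
    𝟙 ⊗ ⟨ -ˢ q^ 1 ⨾q^ 1 ⟩ N                      ≈⟨ ⊗-identityˡ (⟨ -ˢ q^ 1 ⨾q^ 1 ⟩ N) ⟩
    ⟨ -ˢ q^ 1 ⨾q^ 1 ⟩ N                          ≈⟨ ⨾-truncate (-ˢ q^ 1) 1 refl N n≤N ⟨
    ⟨ -ˢ q^ 1 ⨾q^ 1 ⟩∞ refl                      ∎

  odd-1-suc : ∀ k → odd (suc k) 1ʷ ⊗ (𝟙 ⊕ ⊖ 𝕢^ suc (2 * k)) ≈[ n ] odd k 1ʷ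
  odd-1-suc k = begin
    odd (suc k) 1ʷ ⊗ (𝟙 ⊕ ⊖ 𝕢^ suc (2 * k))
      ≈⟨ solve 2 (λ f q → f :* (con 1ℤ :+ :- q) := f :+ :- (q :* f)) ≈-refl (odd (suc k) 1ʷ) (𝕢^ suc (2 * k)) ⟩
    odd (suc k) 1ʷ ⊕ ⊖ (𝕢^ suc (2 * k) ⊗ odd (suc k) 1ʷ)
      ≈⟨ ⊕-congʳ (odd-suc k 1ʷ) ⟩
    odd k 1ʷ ⊕ 𝕢^ suc (2 * k) ⊗ odd (suc k) 1ʷ ⊕ ⊖ (𝕢^ suc (2 * k) ⊗ odd (suc k) 1ʷ)
      ≈⟨ solve 2 (λ f g → f :+ g :+ :- g := f) ≈-refl (odd k 1ʷ) (𝕢^ suc (2 * k) ⊗ odd (suc k) 1ʷ) ⟩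
    odd k 1ʷ ∎

  -- The factors for the sizes 2m + 1, ..., 2(m + k) - 1 cancel their geometric series; in this form
  -- no reciprocal appears.
  odd-1-⨾ : ∀ m k → odd (m + k) 1ʷ ⊗ ⟨ q^ (2 * m + 1) ⨾q^ 2 ⟩ k ≈[ n ] odd m 1ʷ
  odd-1-⨾ m zero    = ≈-trans (⊗-congˡ (⨾-zero (q^ (2 * m + 1)) 2)) (≈-trans (⊗-identityʳ (odd (m + 0) 1ʷ))
    (≡⇒≈ (cong (λ k → odd k 1ʷ) (ℕ.+-identityʳ m))))
  odd-1-⨾ m (suc k) = begin
    odd (m + suc k) 1ʷ ⊗ ⟨ q^ (2 * m + 1) ⨾q^ 2 ⟩ suc k
      ≈⟨ ⊗-cong (≡⇒≈ (cong (λ k → odd k 1ʷ) (ℕ.+-suc m k)))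
                (≈-trans (⨾-q-suc (2 * m + 1) 2 k) (⊗-congˡ (⊕-congˡ (⊖-cong (𝕢^-cong (arith m k)))))) ⟩
    odd (suc (m + k)) 1ʷ ⊗ (⟨ q^ (2 * m + 1) ⨾q^ 2 ⟩ k ⊗ (𝟙 ⊕ ⊖ 𝕢^ suc (2 * (m + k))))
      ≈⟨ solve 3 (λ x y z → x :* (y :* z) := (x :* z) :* y) ≈-refl
           (odd (suc (m + k)) 1ʷ) (⟨ q^ (2 * m + 1) ⨾q^ 2 ⟩ k) (𝟙 ⊕ ⊖ 𝕢^ suc (2 * (m + k))) ⟩
    (odd (suc (m + k)) 1ʷ ⊗ (𝟙 ⊕ ⊖ 𝕢^ suc (2 * (m + k)))) ⊗ ⟨ q^ (2 * m + 1) ⨾q^ 2 ⟩ k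
      ≈⟨ ⊗-congʳ (odd-1-suc (m + k)) ⟩
    odd (m + k) 1ʷ ⊗ ⟨ q^ (2 * m + 1) ⨾q^ 2 ⟩ k
      ≈⟨ odd-1-⨾ m k ⟩
    odd m 1ʷ ∎
    where
    arith : ∀ m k → 2 * m + 1 + 2 * k ≡ suc (2 * (m + k))
    arith = ℕ.solve-∀

  -- Both sides are inverse to (q;q^2)_N modulo q^(n+1), the right one by `euler`.
  odd-1-∞ : ∀ N → n ≤ N → odd N 1ʷ ≈[ n ] ⟨ -ˢ q^ 1 ⨾q^ 1 ⟩∞ refl
  odd-1-∞ N n≤N = ⊗-cancelˡ (⟨ q^ 1 ⨾q^ 2 ⟩ N) (⨾-constant (q^ 1) 2 N refl) (begin
    ⟨ q^ 1 ⨾q^ 2 ⟩ N ⊗ odd N 1ʷ                    ≈⟨ ⊗-comm (⟨ q^ 1 ⨾q^ 2 ⟩ N) (odd N 1ʷ) ⟩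
    odd N 1ʷ ⊗ ⟨ q^ 1 ⨾q^ 2 ⟩ N                    ≈⟨ odd-1-⨾ 0 N ⟩
    odd 0 1ʷ                                       ≈⟨ ≈-trans (parts≤-zero (all? odd? ▸ 1ʷ)) (·ˢ-one 𝟙) ⟩
    𝟙                                              ≈⟨ euler N n≤N ⟨
    ⟨ q^ 1 ⨾q^ 2 ⟩ N ⊗ ⟨ -ˢ q^ 1 ⨾q^ 1 ⟩∞ refl     ∎)

  -- Partitions with a prescribed number of parts above a column

  distinct-suc-cong : ∀ k v w → (∀ λs → v (suc k ∷ λs) ≡ w λs) →
                      distinct (suc k) v ≈[ n ] distinct k v ⊕ 𝕢^ suc k ⊗ distinct k w
  distinct-suc-cong k v w p = ≈-trans (distinct-suc k v)
    (⊕-congˡ (⊗-congˡ (Distinct.restricted-cong k (v ∘ (suc k ∷_)) w λ {λs} _ _ → p λs)))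

  odd-suc-cong : ∀ k v w → (∀ λs → v (suc (2 * k) ∷ λs) ≡ w λs) →
                 odd (suc k) v ≈[ n ] odd k v ⊕ 𝕢^ suc (2 * k) ⊗ odd (suc k) w
  odd-suc-cong k v w p = ≈-trans (odd-suc k v)
    (⊕-congˡ (⊗-congˡ (AllOdd.restricted-cong (2 * suc k) (v ∘ (suc (2 * k) ∷_)) w λ {λs} _ _ → p λs)))

  distinct-0 : ∀ k → distinct k (const 0ℤ) ≈[ n ] 𝟘
  distinct-0 k = Distinct.restricted-zero k (const 0ℤ) λ _ _ → refl

  odd-0 : ∀ k → odd k (const 0ℤ) ≈[ n ] 𝟘
  odd-0 k = AllOdd.restricted-zero (2 * k) (const 0ℤ) λ _ _ → refl

  distinct-δ-zero : ∀ m d → distinct (m + d) (δ m 0) ≈[ n ] distinct m 1ʷ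
  distinct-δ-zero m zero rewrite ℕ.+-identityʳ m = Distinct.restricted-cong m (δ m 0) 1ʷ λ _ → δ-zero
  distinct-δ-zero m (suc d) rewrite ℕ.+-suc m d = begin
    distinct (suc (m + d)) (δ m 0)
      ≈⟨ distinct-suc-cong (m + d) (δ m 0) (const 0ℤ) (λ λs → δ-∷-zero λs (s≤s (ℕ.m≤m+n m d))) ⟩
    distinct (m + d) (δ m 0) ⊕ 𝕢^ suc (m + d) ⊗ distinct (m + d) (const 0ℤ)
      ≈⟨ ⊕-cong (distinct-δ-zero m d) (⊗-congˡ (distinct-0 (m + d))) ⟩
    distinct m 1ʷ ⊕ 𝕢^ suc (m + d) ⊗ 𝟘
      ≈⟨ solve 2 (λ a q → a :+ q :* con 0ℤ := a) ≈-refl (distinct m 1ʷ) (𝕢^ suc (m + d)) ⟩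
    distinct m 1ʷ ∎

  distinct-δ-suc : ∀ m d l → distinct (m + suc d) (δ m (suc l)) ≈[ n ]
                   distinct (m + d) (δ m (suc l)) ⊕ 𝕢^ suc (m + d) ⊗ distinct (m + d) (δ m l)
  distinct-δ-suc m d l rewrite ℕ.+-suc m d =
    distinct-suc-cong (m + d) (δ m (suc l)) (δ m l) (λ λs → δ-∷-suc l λs (s≤s (ℕ.m≤m+n m d)))

  -- Only d admissible sizes exceed m, too few for l distinct parts.
  distinct-δ-> : ∀ m {d l} → d < l → distinct (m + d) (δ m l) ≈[ n ] 𝟘
  distinct-δ-> m {zero} {suc l} _ rewrite ℕ.+-identityʳ m = Distinct.restricted-zero m (δ m (suc l)) λ _ → δ-suc l
  distinct-δ-> m {suc d} {suc l} (s≤s d<l) = begin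
    distinct (m + suc d) (δ m (suc l))
      ≈⟨ distinct-δ-suc m d l ⟩
    distinct (m + d) (δ m (suc l)) ⊕ 𝕢^ suc (m + d) ⊗ distinct (m + d) (δ m l)
      ≈⟨ ⊕-cong (distinct-δ-> m (ℕ.m<n⇒m<1+n d<l)) (⊗-congˡ (distinct-δ-> m d<l)) ⟩
    𝟘 ⊕ 𝕢^ suc (m + d) ⊗ 𝟘
      ≈⟨ solve 1 (λ q → con 0ℤ :+ q :* con 0ℤ := con 0ℤ) ≈-refl (𝕢^ suc (m + d)) ⟩
    𝟘 ∎

  -- The l parts above m are at least m + 1, ..., m + l, with sum m l + l (l + 1) / 2. Their excess
  -- over these values is a partition into at most l parts of size at most c. Absence or presence of
  -- the largest size m + l + c reproduces the recursion of `box`.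
  distinct-δ : ∀ m l c → distinct (m + (l + c)) (δ m l) ≈[ n ] distinct m 1ʷ ⊗ (𝕢^ (m * l + T (suc l)) ⊗ box 1 c l)
  distinct-δ m zero c = begin
    distinct (m + c) (δ m 0)                        ≈⟨ distinct-δ-zero m c ⟩
    distinct m 1ʷ
      ≈⟨ solve 1 (λ f → f := f :* (con 1ℤ :* con 1ℤ)) ≈-refl (distinct m 1ʷ) ⟩
    distinct m 1ʷ ⊗ (𝟙 ⊗ 𝟙)
      ≈⟨ ⊗-congˡ (⊗-cong (≈-trans (𝕢^-cong (trans (ℕ.+-identityʳ (m * 0)) (ℕ.*-zeroʳ m))) 𝕢^0) (≡⇒≈ (box-zeroʳ 1 c))) ⟨
    distinct m 1ʷ ⊗ (𝕢^ (m * 0 + 0) ⊗ box 1 c 0)    ∎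
  distinct-δ m (suc l) zero = begin
    distinct (m + suc (l + 0)) (δ m (suc l))
      ≈⟨ distinct-δ-suc m (l + 0) l ⟩
    distinct (m + (l + 0)) (δ m (suc l)) ⊕ 𝕢^ suc (m + (l + 0)) ⊗ distinct (m + (l + 0)) (δ m l)
      -- With c = 0 all l + 1 sizes above m must occur; omitting the largest one leaves too few.
      ≈⟨ ⊕-cong (distinct-δ-> m (s≤s (ℕ.≤-reflexive (ℕ.+-identityʳ l)))) (⊗-congˡ (distinct-δ m l 0)) ⟩
    𝟘 ⊕ 𝕢^ suc (m + (l + 0)) ⊗ (F ⊗ (𝕢^ (m * l + T (suc l)) ⊗ 𝟙))
      ≈⟨ solve 3 (λ q f x → con 0ℤ :+ q :* (f :* (x :* con 1ℤ)) := f :* ((q :* x) :* con 1ℤ)) ≈-refl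
           (𝕢^ suc (m + (l + 0))) F (𝕢^ (m * l + T (suc l))) ⟩
    F ⊗ (𝕢^ suc (m + (l + 0)) ⊗ 𝕢^ (m * l + T (suc l)) ⊗ 𝟙)
      ≈⟨ ⊗-congˡ (⊗-congʳ (𝕢^-merge (arith m l (T (suc l))))) ⟩
    F ⊗ (𝕢^ (m * suc l + T (suc (suc l))) ⊗ 𝟙) ∎
    where
    F : Series
    F = distinct m 1ʷ
    arith : ∀ m l t → suc (m + (l + 0)) + (m * l + t) ≡ m * suc l + (t + suc l)
    arith = ℕ.solve-∀
  distinct-δ m (suc l) (suc c) = begin
    distinct (m + suc (l + suc c)) (δ m (suc l))
      ≈⟨ distinct-δ-suc m (l + suc c) l ⟩
    distinct (m + (l + suc c)) (δ m (suc l)) ⊕ 𝕢^ suc (m + (l + suc c)) ⊗ distinct (m + (l + suc c)) (δ m l)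
      ≈⟨ ⊕-cong (≈-trans (≡⇒≈ (cong (λ k → distinct (m + k) (δ m (suc l))) (ℕ.+-suc l c))) (distinct-δ m (suc l) c))
                (⊗-congˡ (distinct-δ m l (suc c))) ⟩
    F ⊗ (X ⊗ box 1 c (suc l)) ⊕ 𝕢^ suc (m + (l + suc c)) ⊗ (F ⊗ (𝕢^ (m * l + T (suc l)) ⊗ box 1 (suc c) l))
      ≈⟨ solve 6 (λ f x b q y b′ → f :* (x :* b) :+ q :* (f :* (y :* b′)) := f :* (x :* b :+ q :* y :* b′)) ≈-refl
           F X (box 1 c (suc l)) (𝕢^ suc (m + (l + suc c))) (𝕢^ (m * l + T (suc l))) (box 1 (suc c) l) ⟩
    F ⊗ (X ⊗ box 1 c (suc l) ⊕ 𝕢^ suc (m + (l + suc c)) ⊗ 𝕢^ (m * l + T (suc l)) ⊗ box 1 (suc c) l)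
      ≈⟨ ⊗-congˡ (⊕-congˡ (⊗-congʳ (≈-trans (𝕢^-merge (arith m l c (T (suc l)))) (≈-sym (𝕢^-merge refl))))) ⟩
    F ⊗ (X ⊗ box 1 c (suc l) ⊕ X ⊗ 𝕢^ (1 * suc c) ⊗ box 1 (suc c) l)
      ≈⟨ solve 5 (λ f x b q b′ → f :* (x :* b :+ x :* q :* b′) := f :* (x :* (b :+ q :* b′))) ≈-refl
           F X (box 1 c (suc l)) (𝕢^ (1 * suc c)) (box 1 (suc c) l) ⟩
    F ⊗ (X ⊗ box 1 (suc c) (suc l)) ∎
    where
    F X : Series
    F = distinct m 1ʷ
    X = 𝕢^ (m * suc l + T (suc (suc l)))
    arith : ∀ m l c t → suc (m + (l + suc c)) + (m * l + t) ≡ m * suc l + (t + suc l) + 1 * suc c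
    arith = ℕ.solve-∀

  odd-δ-zero : ∀ M A → odd (M + A) (δ (2 * M) 0) ≈[ n ] odd M 1ʷ
  odd-δ-zero M zero = ≈-trans (≡⇒≈ (cong (λ k → odd k (δ (2 * M) 0)) (ℕ.+-identityʳ M)))
    (AllOdd.restricted-cong (2 * M) (δ (2 * M) 0) 1ʷ λ _ → δ-zero)
  odd-δ-zero M (suc A) rewrite ℕ.+-suc M A = begin
    odd (suc (M + A)) (δ (2 * M) 0)
      ≈⟨ odd-suc-cong (M + A) (δ (2 * M) 0) (const 0ℤ) (λ λs → δ-∷-zero λs (s≤s (ℕ.*-monoʳ-≤ 2 (ℕ.m≤m+n M A)))) ⟩
    odd (M + A) (δ (2 * M) 0) ⊕ 𝕢^ suc (2 * (M + A)) ⊗ odd (suc (M + A)) (const 0ℤ)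
      ≈⟨ ⊕-cong (odd-δ-zero M A) (⊗-congˡ (odd-0 (suc (M + A)))) ⟩
    odd M 1ʷ ⊕ 𝕢^ suc (2 * (M + A)) ⊗ 𝟘
      ≈⟨ solve 2 (λ a q → a :+ q :* con 0ℤ := a) ≈-refl (odd M 1ʷ) (𝕢^ suc (2 * (M + A))) ⟩
    odd M 1ʷ ∎

  odd-δ-suc : ∀ M A l → odd (suc (M + A)) (δ (2 * M) (suc l)) ≈[ n ]
              odd (M + A) (δ (2 * M) (suc l)) ⊕ 𝕢^ suc (2 * (M + A)) ⊗ odd (suc (M + A)) (δ (2 * M) l)
  odd-δ-suc M A l = odd-suc-cong (M + A) (δ (2 * M) (suc l)) (δ (2 * M) l)
    (λ λs → δ-∷-suc l λs (s≤s (ℕ.*-monoʳ-≤ 2 (ℕ.m≤m+n M A))))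

  -- Each of the l parts above 2M is 2M + 1 plus an even number up to 2A, so the excesses form a
  -- partition in a box, counted in q^2. As the largest size may be taken again, each step lowers
  -- either A or l.
  odd-δ : ∀ M A l → odd (suc (M + A)) (δ (2 * M) l) ≈[ n ] odd M 1ʷ ⊗ (𝕢^ ((2 * M + 1) * l) ⊗ box 2 A l)
  odd-δ M A zero = begin
    odd (suc (M + A)) (δ (2 * M) 0)                   ≈⟨ ≡⇒≈ (cong (λ k → odd k (δ (2 * M) 0)) (ℕ.+-suc M A)) ⟨
    odd (M + suc A) (δ (2 * M) 0)                     ≈⟨ odd-δ-zero M (suc A) ⟩
    odd M 1ʷ
      ≈⟨ solve 1 (λ f → f := f :* (con 1ℤ :* con 1ℤ)) ≈-refl (odd M 1ʷ) ⟩
    odd M 1ʷ ⊗ (𝟙 ⊗ 𝟙)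
      ≈⟨ ⊗-congˡ (⊗-cong (≈-trans (𝕢^-cong (ℕ.*-zeroʳ (2 * M + 1))) 𝕢^0) (≡⇒≈ (box-zeroʳ 2 A))) ⟨
    odd M 1ʷ ⊗ (𝕢^ ((2 * M + 1) * 0) ⊗ box 2 A 0)     ∎
  odd-δ M zero (suc l) = begin
    odd (suc (M + 0)) (δ (2 * M) (suc l))
      ≈⟨ odd-δ-suc M 0 l ⟩
    odd (M + 0) (δ (2 * M) (suc l)) ⊕ 𝕢^ suc (2 * (M + 0)) ⊗ odd (suc (M + 0)) (δ (2 * M) l)
      ≈⟨ ⊕-cong (≈-trans (≡⇒≈ (cong (λ k → odd k (δ (2 * M) (suc l))) (ℕ.+-identityʳ M)))
                         (AllOdd.restricted-zero (2 * M) (δ (2 * M) (suc l)) λ _ → δ-suc l))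
                (⊗-congˡ (odd-δ M 0 l)) ⟩
    𝟘 ⊕ 𝕢^ suc (2 * (M + 0)) ⊗ (odd M 1ʷ ⊗ (𝕢^ ((2 * M + 1) * l) ⊗ 𝟙))
      ≈⟨ solve 3 (λ q f x → con 0ℤ :+ q :* (f :* (x :* con 1ℤ)) := f :* ((q :* x) :* con 1ℤ)) ≈-refl
           (𝕢^ suc (2 * (M + 0))) (odd M 1ʷ) (𝕢^ ((2 * M + 1) * l)) ⟩
    odd M 1ʷ ⊗ (𝕢^ suc (2 * (M + 0)) ⊗ 𝕢^ ((2 * M + 1) * l) ⊗ 𝟙)
      ≈⟨ ⊗-congˡ (⊗-congʳ (𝕢^-merge (arith M l))) ⟩
    odd M 1ʷ ⊗ (𝕢^ ((2 * M + 1) * suc l) ⊗ 𝟙) ∎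
    where
    arith : ∀ M l → suc (2 * (M + 0)) + (2 * M + 1) * l ≡ (2 * M + 1) * suc l
    arith = ℕ.solve-∀
  odd-δ M (suc A) (suc l) = begin
    odd (suc (M + suc A)) (δ (2 * M) (suc l))
      ≈⟨ odd-δ-suc M (suc A) l ⟩
    odd (M + suc A) (δ (2 * M) (suc l)) ⊕ 𝕢^ suc (2 * (M + suc A)) ⊗ odd (suc (M + suc A)) (δ (2 * M) l)
      ≈⟨ ⊕-cong (≈-trans (≡⇒≈ (cong (λ k → odd k (δ (2 * M) (suc l))) (ℕ.+-suc M A))) (odd-δ M A (suc l)))
                (⊗-congˡ (odd-δ M (suc A) l)) ⟩
    F ⊗ (X ⊗ box 2 A (suc l)) ⊕ 𝕢^ suc (2 * (M + suc A)) ⊗ (F ⊗ (𝕢^ ((2 * M + 1) * l) ⊗ box 2 (suc A) l))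
      ≈⟨ solve 6 (λ f x b q y b′ → f :* (x :* b) :+ q :* (f :* (y :* b′)) := f :* (x :* b :+ q :* y :* b′)) ≈-refl
           F X (box 2 A (suc l)) (𝕢^ suc (2 * (M + suc A))) (𝕢^ ((2 * M + 1) * l)) (box 2 (suc A) l) ⟩
    F ⊗ (X ⊗ box 2 A (suc l) ⊕ 𝕢^ suc (2 * (M + suc A)) ⊗ 𝕢^ ((2 * M + 1) * l) ⊗ box 2 (suc A) l)
      ≈⟨ ⊗-congˡ (⊕-congˡ (⊗-congʳ (≈-trans (𝕢^-merge (arith M A l)) (≈-sym (𝕢^-merge refl))))) ⟩
    F ⊗ (X ⊗ box 2 A (suc l) ⊕ X ⊗ 𝕢^ (2 * suc A) ⊗ box 2 (suc A) l)
      ≈⟨ solve 5 (λ f x b q b′ → f :* (x :* b :+ x :* q :* b′) := f :* (x :* (b :+ q :* b′))) ≈-refl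
           F X (box 2 A (suc l)) (𝕢^ (2 * suc A)) (box 2 (suc A) l) ⟩
    F ⊗ (X ⊗ box 2 (suc A) (suc l)) ∎
    where
    F X : Series
    F = odd M 1ʷ
    X = 𝕢^ ((2 * M + 1) * suc l)
    arith : ∀ M A l → suc (2 * (M + suc A)) + (2 * M + 1) * l ≡ (2 * M + 1) * suc l + 2 * suc A
    arith = ℕ.solve-∀

  -- Resummation by arms and by column parity

  ∑<-cut : ∀ {B K} (V : ℕ → ℕ → Series) → B ≤ K →
           ∑< K (λ r → ∑< (suc r) λ m → cut B (λ a → V a m) (r ∸ m)) ≈[ n ] ∑< B (λ a → ∑< (K ∸ a) λ m → V a m)
  ∑<-cut {B} {K} V B≤K = begin
    ∑< K (λ r → ∑< (suc r) λ m → cut B (λ a → V a m) (r ∸ m))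
      ≈⟨ ∑<-triangle K (λ m a → cut B (λ a → V a m) a) ⟩
    ∑< K (λ a → ∑< (K ∸ a) λ m → cut B (λ a → V a m) a)
      ≈⟨ ∑<-extend B≤K (λ a B≤a → ∑<-zero (K ∸ a) λ m _ → ≡⇒≈ (cut-≥ (λ a → V a m) a B≤a)) ⟩
    ∑< B (λ a → ∑< (K ∸ a) λ m → cut B (λ a → V a m) a)
      ≈⟨ ∑<-cong B (λ a a<B → ∑<-cong (K ∸ a) λ m _ → ≡⇒≈ (cut-< (λ a → V a m) a a<B)) ⟩
    ∑< B (λ a → ∑< (K ∸ a) λ m → V a m) ∎

  ∑<-parity : ∀ k f → ∑< (suc (2 * k)) f ≈[ n ] ∑< (suc k) (λ M → f (2 * M)) ⊕ ∑< k (λ M → f (suc (2 * M)))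
  ∑<-parity zero    f = ≈-sym (⊕-identityʳ _)
  ∑<-parity (suc k) f = begin
    ∑< (suc (2 * suc k)) f
      ≈⟨ ≡⇒≈ (cong (λ m → ∑< (suc m) f) (ℕ.*-suc 2 k)) ⟩
    ∑< (suc (2 * k)) f ⊕ f (suc (2 * k)) ⊕ f (suc (suc (2 * k)))
      ≈⟨ ⊕-cong (⊕-congʳ (∑<-parity k f)) (≡⇒≈ (cong f (sym (ℕ.*-suc 2 k)))) ⟩
    ∑< (suc k) (λ M → f (2 * M)) ⊕ ∑< k (λ M → f (suc (2 * M))) ⊕ f (suc (2 * k)) ⊕ f (2 * suc k)
      ≈⟨ solve 4 (λ a b c d → a :+ b :+ c :+ d := (a :+ d) :+ (b :+ c)) ≈-refl
           (∑< (suc k) (λ M → f (2 * M))) (∑< k (λ M → f (suc (2 * M)))) (f (suc (2 * k))) (f (2 * suc k)) ⟩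
    ∑< (suc (suc k)) (λ M → f (2 * M)) ⊕ ∑< (suc k) (λ M → f (suc (2 * M))) ∎

  ∑∞-⊗ : ∀ e B (g : ℕ → Series) E (c : Summable λ m → g m *ˢ q^ (E * m)) M → 0 < E → n < M →
         q^ e *ˢ B *ˢ ∑∞ (λ m → g m *ˢ q^ (E * m)) c ≈[ n ] ∑< M (λ m → 𝕢^ e ⊗ B ⊗ (g m ⊗ 𝕢^ (E * m)))
  ∑∞-⊗ e B g E c M 0<E n<M = begin
    q^ e *ˢ B *ˢ S
      ≈⟨ ≡⇒≈ (trans (*ˢ≡⊗ (q^ e *ˢ B) S) (cong (_⊗ S) (trans (*ˢ≡⊗ (q^ e) B) (cong (_⊗ B) (q^≡𝕢^ e))))) ⟩
    𝕢^ e ⊗ B ⊗ S            ≈⟨ ⊗-congˡ (∑∞-truncate (λ m → g m *ˢ q^ (E * m)) c M low n<M) ⟩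
    𝕢^ e ⊗ B ⊗ ∑< M (λ m → g m *ˢ q^ (E * m))
      ≈⟨ ⊗-congˡ (∑<-cong M λ m _ → ≡⇒≈ (trans (*ˢ≡⊗ (g m) (q^ (E * m))) (cong (g m ⊗_) (q^≡𝕢^ (E * m))))) ⟩
    𝕢^ e ⊗ B ⊗ ∑< M (λ m → g m ⊗ 𝕢^ (E * m))
      ≈⟨ ∑<-⊗ M (𝕢^ e ⊗ B) (λ m → g m ⊗ 𝕢^ (E * m)) ⟨
    ∑< M (λ m → 𝕢^ e ⊗ B ⊗ (g m ⊗ 𝕢^ (E * m))) ∎
    where
    S : Series
    S = ∑∞ (λ m → g m *ˢ q^ (E * m)) c
    low : ∀ m k → k < m → (g m *ˢ q^ (E * m)) k ≡ 0ℤ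
    low m k k<m = *ˢ-q^-low (g m) (E * m) k (ℕ.<-≤-trans k<m (ℕ.m≤n*m m E {{ℕ.>-nonZero 0<E}}))

  -- Hook counts for distinct parts

  1/−q : ℕ → ℕ → Series
  1/−q m k = 1/⟨ -ˢ q^ (suc m) ⨾q^ 1 ⟩ k refl

  term₃ : ℕ → ℕ → ℕ → Series
  term₃ h l m = 𝕢^ (h + T l) ⊗ binom[q^ 1 ] (h ∸ l ∸ 1) l ⊗ (1/−q m (h ∸ l) ⊗ 𝕢^ ((l + 1) * m))

  -- The contribution of a first row of length m + a + 1 with a = l + c, seen from column m. The row
  -- and its leg settle the sizes m + 1, ..., m + a + 1, so the a + 1 = h - l factors of these sizes
  -- are divided out of the total.
  distinct-term₃ : ∀ m l c → 𝕢^ suc (m + (l + c)) ⊗ distinct (m + (l + c)) (δ m l) ≈[ n ]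
                   distinct (suc (m + (l + c))) 1ʷ ⊗ term₃ (suc (l + c) + l) l m
  distinct-term₃ m l c rewrite ℕ.m+n∸n≡m (suc (l + c)) l = begin
    𝕢^ suc (m + (l + c)) ⊗ distinct (m + (l + c)) (δ m l)
      ≈⟨ ⊗-congˡ (distinct-δ m l c) ⟩
    𝕢^ suc (m + (l + c)) ⊗ (F ⊗ (𝕢^ (m * l + T (suc l)) ⊗ box 1 c l))
      ≈⟨ solve 4 (λ q f x b → q :* (f :* (x :* b)) := f :* (q :* x) :* b) ≈-refl
           (𝕢^ suc (m + (l + c))) F (𝕢^ (m * l + T (suc l))) (box 1 c l) ⟩
    F ⊗ (𝕢^ suc (m + (l + c)) ⊗ 𝕢^ (m * l + T (suc l))) ⊗ box 1 c l
      ≈⟨ ⊗-cong (⊗-congˡ (≈-trans (𝕢^-merge (arith m l c (T l))) (≈-sym (𝕢^-merge refl))))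
                (≈-trans (box-comm 1 c l) (≈-sym (binom-box 1 l c))) ⟩
    F ⊗ (X ⊗ Y) ⊗ B
      ≈⟨ solve 4 (λ f x y b → f :* (x :* y) :* b := (f :* con 1ℤ) :* (x :* b :* y)) ≈-refl F X Y B ⟩
    F ⊗ 𝟙 ⊗ (X ⊗ B ⊗ Y)
      -- Inserting 1 = P R: P completes F to the total over all sizes up to the row length, and the
      -- reciprocal R stays in the term.
      ≈⟨ ⊗-congʳ (⊗-congˡ (⊗-recip P (⨾-constant (-ˢ q^ suc m) 1 (suc (l + c)) refl))) ⟨
    F ⊗ (P ⊗ R) ⊗ (X ⊗ B ⊗ Y)
      ≈⟨ solve 6 (λ f p r x b y → f :* (p :* r) :* (x :* b :* y) := (f :* p) :* (x :* b :* (r :* y)))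
           ≈-refl F P R X B Y ⟩
    (F ⊗ P) ⊗ (X ⊗ B ⊗ (R ⊗ Y))
      ≈⟨ ⊗-congʳ (≈-trans (distinct-1-⨾ m (suc (l + c))) (≡⇒≈ (cong (λ k → distinct k 1ʷ) (ℕ.+-suc m (l + c))))) ⟩
    distinct (suc (m + (l + c))) 1ʷ ⊗ (X ⊗ B ⊗ (R ⊗ Y)) ∎
    where
    F X Y B P R : Series
    F = distinct m 1ʷ
    X = 𝕢^ (suc (l + c) + l + T l)
    Y = 𝕢^ ((l + 1) * m)
    B = binom[q^ 1 ] (l + c) l
    P = ⟨ -ˢ q^ suc m ⨾q^ 1 ⟩ suc (l + c)
    R = 1/−q m (suc (l + c))
    arith : ∀ m l c t → suc (m + (l + c)) + (m * l + (t + l)) ≡ (suc (l + c) + l + t) + (l + 1) * m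
    arith = ℕ.solve-∀

  -- For h = a + 1 + l, the inequality l ≤ a forced by distinctness is the same as l < ⌈h/2⌉; when
  -- it fails, both sides vanish.
  distinct-leg : ∀ m a l → 𝕢^ suc (m + a) ⊗ distinct (m + a) (δ m l) ≈[ n ]
                 distinct (suc (m + a)) 1ʷ ⊗ cut ⌈ suc a + l /2⌉ (λ l′ → term₃ (suc a + l) l′ m) l
  distinct-leg m a l with l ≤? a
  ... | yes l≤a with c , refl ← ℕ.m≤n⇒∃[o]m+o≡n l≤a = ≈-trans (distinct-term₃ m l c)
    (⊗-congˡ (≡⇒≈ (sym (cut-< (λ l′ → term₃ (suc (l + c) + l) l′ m) l (2n<h⇒n<⌈h/2⌉ 2l<h)))))
    where
    2l<h : 2 * l < suc (l + c) + l
    2l<h = s≤s (ℕ.≤-trans (ℕ.+-monoʳ-≤ l (ℕ.≤-reflexive (ℕ.+-identityʳ l))) (ℕ.+-monoˡ-≤ l (ℕ.m≤m+n l c)))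
  ... | no  l≰a = begin
    𝕢^ suc (m + a) ⊗ distinct (m + a) (δ m l)   ≈⟨ ⊗-congˡ (distinct-δ-> m (ℕ.≰⇒> l≰a)) ⟩
    𝕢^ suc (m + a) ⊗ 𝟘
      ≈⟨ solve 2 (λ x y → x :* con 0ℤ := y :* con 0ℤ) ≈-refl (𝕢^ suc (m + a)) F ⟩
    F ⊗ 𝟘
      ≈⟨ ⊗-congˡ (≡⇒≈ (cut-≥ (λ l′ → term₃ (suc a + l) l′ m) l (ℕ.≮⇒≥ long))) ⟨
    F ⊗ cut ⌈ suc a + l /2⌉ (λ l′ → term₃ (suc a + l) l′ m) l ∎
    where
    F : Series
    F = distinct (suc (m + a)) 1ʷ
    long : ¬ (l < ⌈ suc a + l /2⌉)
    long l< = l≰a (ℕ.+-cancelʳ-≤ l l a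
      (subst (_≤ a + l) (cong (λ c → l + c) (ℕ.+-identityʳ l)) (ℕ.s≤s⁻¹ (<⌈n/2⌉ (suc a + l) l l<))))

  -- A hook of length h with arm a has leg h - a - 1. For a ≥ h the subtraction would wrongly yield
  -- leg 0, hence `V₃` appears only under `cut h` or in sums over a < h.
  V₃ : ℕ → ℕ → ℕ → Series
  V₃ h a m = cut ⌈ h /2⌉ (λ l → term₃ h l m) (h ∸ suc a)

  distinct-hook : ∀ h m a → 𝕢^ suc (m + a) ⊗ distinct (m + a) (λ λs → ind (suc a + column m λs ≟ h)) ≈[ n ]
                  distinct (suc (m + a)) 1ʷ ⊗ cut h (λ a → V₃ h a m) a
  distinct-hook h m a with a <? h
  ... | yes a<h with l , refl ← ℕ.m≤n⇒∃[o]m+o≡n a<h = begin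
    𝕢^ suc (m + a) ⊗ distinct (m + a) (λ λs → ind (suc a + column m λs ≟ suc a + l))
      ≈⟨ ⊗-congˡ (Distinct.restricted-cong (m + a) (λ λs → ind (suc a + column m λs ≟ suc a + l)) (δ m l)
           λ {λs} _ _ → ind-shift (suc a) l m λs) ⟩
    𝕢^ suc (m + a) ⊗ distinct (m + a) (δ m l)
      ≈⟨ distinct-leg m a l ⟩
    distinct (suc (m + a)) 1ʷ ⊗ cut ⌈ suc a + l /2⌉ (λ l′ → term₃ (suc a + l) l′ m) l
      ≈⟨ ⊗-congˡ (≡⇒≈ (trans (cong (cut ⌈ suc a + l /2⌉ (λ l′ → term₃ (suc a + l) l′ m)) (sym (ℕ.m+n∸m≡n (suc a) l)))
                             (sym (cut-< (λ a′ → V₃ (suc a + l) a′ m) a a<h)))) ⟩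
    distinct (suc (m + a)) 1ʷ ⊗ cut (suc a + l) (λ a′ → V₃ (suc a + l) a′ m) a ∎
  ... | no a≮h = begin
    𝕢^ suc (m + a) ⊗ distinct (m + a) (λ λs → ind (suc a + column m λs ≟ h))
      ≈⟨ ⊗-congˡ (Distinct.restricted-zero (m + a) (λ λs → ind (suc a + column m λs ≟ h))
           λ {λs} _ _ → ind-shift-< m λs (s≤s (ℕ.≮⇒≥ a≮h))) ⟩
    𝕢^ suc (m + a) ⊗ 𝟘
      ≈⟨ solve 2 (λ x y → x :* con 0ℤ := y :* con 0ℤ) ≈-refl (𝕢^ suc (m + a)) (distinct (suc (m + a)) 1ʷ) ⟩
    distinct (suc (m + a)) 1ʷ ⊗ 𝟘
      ≈⟨ ⊗-congˡ (≡⇒≈ (cut-≥ (λ a → V₃ h a m) a (ℕ.≮⇒≥ a≮h))) ⟨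
    distinct (suc (m + a)) 1ʷ ⊗ cut h (λ a → V₃ h a m) a ∎

  -- The hooks outside a first row k + 1 are counted by G whether or not that row is present, whence
  -- the factor 1 + q^(k+1), which also takes the total F to F′. The new row adds one box for each
  -- column m ≤ k, with arm k - m.
  distinct-#hooks : ∀ h K → distinct K (#ʷ h) ≈[ n ]
    distinct K 1ʷ ⊗ ∑< K (λ r → ∑< (suc r) λ m → cut h (λ a → V₃ h a m) (r ∸ m))
  distinct-#hooks h zero    = ≈-trans (parts≤-zero (unique? ▸ #ʷ h)) (≈-trans (·ˢ-zero 𝟙)
    (solve 1 (λ x → con 0ℤ := x :* con 0ℤ) ≈-refl (distinct 0 1ʷ)))
  distinct-#hooks h (suc k) = begin
    distinct (suc k) (#ʷ h)
      ≈⟨ distinct-suc k (#ʷ h) ⟩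
    G ⊕ Q ⊗ distinct k (#ʷ h ∘ (suc k ∷_))
      ≈⟨ ⊕-congˡ (⊗-congˡ (Distinct.restricted-#hooks-∷ h (suc k) k)) ⟩
    G ⊕ Q ⊗ (∑< (suc k) row ⊕ G)
      ≈⟨ solve 3 (λ g q s → g :+ q :* (s :+ g) := g :* (con 1ℤ :+ q) :+ q :* s) ≈-refl G Q (∑< (suc k) row) ⟩
    G ⊗ (𝟙 ⊕ Q) ⊕ Q ⊗ ∑< (suc k) row
      ≈⟨ ⊕-cong (⊗-congʳ (distinct-#hooks h k)) (≈-sym (∑<-⊗ (suc k) Q row)) ⟩
    F ⊗ S ⊗ (𝟙 ⊕ Q) ⊕ ∑< (suc k) (λ m → Q ⊗ row m)
      ≈⟨ ⊕-cong (solve 3 (λ f s p → f :* s :* p := f :* p :* s) ≈-refl F S (𝟙 ⊕ Q))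
                (∑<-cong (suc k) λ m m≤k → box-of m (ℕ.s≤s⁻¹ m≤k)) ⟩
    F ⊗ (𝟙 ⊕ Q) ⊗ S ⊕ ∑< (suc k) (λ m → F′ ⊗ U m)
      ≈⟨ ⊕-cong (⊗-congʳ (≈-sym (distinct-1-suc k))) (∑<-⊗ (suc k) F′ U) ⟩
    F′ ⊗ S ⊕ F′ ⊗ ∑< (suc k) U
      ≈⟨ ⊗-distribˡ-⊕ F′ S (∑< (suc k) U) ⟨
    F′ ⊗ (S ⊕ ∑< (suc k) U) ∎
    where
    G Q F F′ S : Series
    G  = distinct k (#ʷ h)
    Q  = 𝕢^ suc k
    F  = distinct k 1ʷ
    F′ = distinct (suc k) 1ʷ
    S  = ∑< k (λ r → ∑< (suc r) λ m → cut h (λ a → V₃ h a m) (r ∸ m))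
    row U : ℕ → Series
    row j = distinct k λ λs → ind ((suc k ∸ j) + column j λs ≟ h)
    U m = cut h (λ a → V₃ h a m) (k ∸ m)
    box-of : ∀ m → m ≤ k → Q ⊗ row m ≈[ n ] F′ ⊗ U m
    box-of m m≤k with a , refl ← ℕ.m≤n⇒∃[o]m+o≡n m≤k
      rewrite sym (ℕ.+-suc m a) | ℕ.m+n∸m≡n m (suc a) | ℕ.+-suc m a | ℕ.m+n∸m≡n m a = distinct-hook h m a

  b-formula : ∀ h → distinct (h + suc n) (#ʷ h) ≈[ n ]
    ⟨ -ˢ q^ 1 ⨾q^ 1 ⟩∞ refl *ˢ
      (∑[ i < ⌈ h /2⌉ ] let j = toℕ i in
        q^ (h + j * (j ∸ 1) / 2) *ˢ binom[q^ 1 ] (h ∸ j ∸ 1) j *ˢ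
          ∑∞ (λ m → 1/⟨ -ˢ q^ (suc m) ⨾q^ 1 ⟩ (h ∸ j) refl *ˢ q^ ((j + 1) * m))
             (summable₃ j (λ m → 1/⟨ -ˢ q^ (suc m) ⨾q^ 1 ⟩ (h ∸ j) refl)))
  b-formula h = begin
    distinct K (#ʷ h)
      ≈⟨ distinct-#hooks h K ⟩
    distinct K 1ʷ ⊗ ∑< K (λ r → ∑< (suc r) λ m → cut h (λ a → V₃ h a m) (r ∸ m))
      ≈⟨ ⊗-cong (distinct-1-∞ K (ℕ.≤-trans (ℕ.n≤1+n n) (ℕ.m≤n+m (suc n) h))) (∑<-cut (V₃ h) (ℕ.m≤m+n h (suc n))) ⟩
    D ⊗ ∑< h (λ a → ∑< (K ∸ a) λ m → V₃ h a m)
      -- Arm and leg of a hook of length h add up to h - 1, so reversal makes the leg the index.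
      ≈⟨ ⊗-congˡ (∑<-reverse h (λ a → ∑< (K ∸ a) λ m → V₃ h a m)) ⟩
    D ⊗ ∑< h (λ l → ∑< (K ∸ (h ∸ suc l)) λ m → V₃ h (h ∸ suc l) m)
      ≈⟨ ⊗-congˡ (∑<-cong h λ l l<h → ∑<-cong (K ∸ (h ∸ suc l)) λ m _ →
           ≡⇒≈ (cong (cut ⌈ h /2⌉ (λ l → term₃ h l m)) (reflect l<h))) ⟩
    D ⊗ ∑< h (λ l → ∑< (K ∸ (h ∸ suc l)) λ m → cut ⌈ h /2⌉ (λ l → term₃ h l m) l)
      ≈⟨ ⊗-congˡ (∑<-extend (ℕ.⌈n/2⌉≤n h) λ l ≤l →
           ∑<-zero (K ∸ (h ∸ suc l)) λ m _ → ≡⇒≈ (cut-≥ (λ l → term₃ h l m) l ≤l)) ⟩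
    D ⊗ ∑< ⌈ h /2⌉ (λ l → ∑< (K ∸ (h ∸ suc l)) λ m → cut ⌈ h /2⌉ (λ l → term₃ h l m) l)
      ≈⟨ ⊗-congˡ (∑<-cong ⌈ h /2⌉ λ l l< → ∑<-cong (K ∸ (h ∸ suc l)) λ m _ → ≡⇒≈ (cut-< (λ l → term₃ h l m) l l<)) ⟩
    D ⊗ ∑< ⌈ h /2⌉ (λ l → ∑< (K ∸ (h ∸ suc l)) (term₃ h l))
      ≈⟨ ⊗-congˡ (∑ˢ-∑< ⌈ h /2⌉ {f = λ l → ∑< (K ∸ (h ∸ suc l)) (term₃ h l)} λ i → at (toℕ i)) ⟨
    D ⊗ R
      ≈⟨ ≡⇒≈ (*ˢ≡⊗ D R) ⟨
    D *ˢ R ∎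
    where
    K : ℕ
    K = h + suc n
    D : Series
    D = ⟨ -ˢ q^ 1 ⨾q^ 1 ⟩∞ refl
    summand : ℕ → Series
    summand j = q^ (h + j * (j ∸ 1) / 2) *ˢ binom[q^ 1 ] (h ∸ j ∸ 1) j *ˢ
      ∑∞ (λ m → 1/⟨ -ˢ q^ (suc m) ⨾q^ 1 ⟩ (h ∸ j) refl *ˢ q^ ((j + 1) * m))
         (summable₃ j (λ m → 1/⟨ -ˢ q^ (suc m) ⨾q^ 1 ⟩ (h ∸ j) refl))
    R : Series
    R = ∑[ i < ⌈ h /2⌉ ] summand (toℕ i)
    reflect : ∀ {l} → l < h → h ∸ suc (h ∸ suc l) ≡ l
    reflect {l} l<h with c , refl ← ℕ.m≤n⇒∃[o]m+o≡n l<h rewrite ℕ.m+n∸m≡n (suc l) c | ℕ.m+n∸n≡m l c = refl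
    at : ∀ j → summand j ≈[ n ] ∑< (K ∸ (h ∸ suc j)) (term₃ h j)
    at j = ≈-trans (∑∞-⊗ (h + j * (j ∸ 1) / 2) (binom[q^ 1 ] (h ∸ j ∸ 1) j) (λ m → 1/−q m (h ∸ j)) (j + 1)
        (summable₃ j λ m → 1/−q m (h ∸ j))
        (K ∸ (h ∸ suc j)) (ℕ.m≤n+m 1 j)
        (ℕ.≤-trans (ℕ.≤-reflexive (sym (ℕ.m+n∸m≡n h (suc n)))) (ℕ.∸-monoʳ-≤ K (ℕ.m∸n≤m h (suc j)))))
      (∑<-cong (K ∸ (h ∸ suc j)) λ m _ → ⊗-congʳ (⊗-congʳ (𝕢^-cong (cong (λ t → h + t) (T≡ j)))))

  -- Hook counts for odd parts

  term₁ term₂ : ℕ → ℕ → ℕ → Series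
  term₁ h A M = 𝕢^ h ⊗ binom[q^ 2 ] (h ∸ A ∸ 1) A ⊗ (⟨ q^ (2 * M + 1) ⨾q^ 2 ⟩ A ⊗ 𝕢^ ((2 * h ∸ 4 * A) * M))
  term₂ h A M = 𝕢^ (3 * h ∸ 4 * A ∸ 3) ⊗ binom[q^ 2 ] (h ∸ A ∸ 2) A
                ⊗ (⟨ q^ (2 * M + 3) ⨾q^ 2 ⟩ A ⊗ 𝕢^ ((2 * h ∸ 4 * A ∸ 2) * M))

  -- A first row of length 2(M + A) + 1 seen from column 2M. Its size may recur below it, hence
  -- `suc (M + A)` on the left; the total on the right stops one size earlier, and the factor of the
  -- missing size comes from the cancellation in `odd-#hooks`. The split into d and e is left open
  -- because even and odd columns group the exponent differently.
  odd-box : ∀ M A l d e → d + e ≡ suc (2 * (M + A)) + (2 * M + 1) * l →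
    𝕢^ suc (2 * (M + A)) ⊗ odd (suc (M + A)) (δ (2 * M) l) ≈[ n ]
    odd (M + A) 1ʷ ⊗ (𝕢^ d ⊗ binom[q^ 2 ] (A + l) A ⊗ (⟨ q^ (2 * M + 1) ⨾q^ 2 ⟩ A ⊗ 𝕢^ e))
  odd-box M A l d e eq = begin
    𝕢^ suc (2 * (M + A)) ⊗ odd (suc (M + A)) (δ (2 * M) l)
      ≈⟨ ⊗-congˡ (≈-trans (odd-δ M A l) (⊗-congʳ (≈-sym (odd-1-⨾ M A)))) ⟩
    𝕢^ suc (2 * (M + A)) ⊗ (F ⊗ P ⊗ (𝕢^ ((2 * M + 1) * l) ⊗ box 2 A l))
      ≈⟨ solve 5 (λ q f p x b → q :* (f :* p :* (x :* b)) := f :* p :* (q :* x) :* b) ≈-refl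
           (𝕢^ suc (2 * (M + A))) F P (𝕢^ ((2 * M + 1) * l)) (box 2 A l) ⟩
    F ⊗ P ⊗ (𝕢^ suc (2 * (M + A)) ⊗ 𝕢^ ((2 * M + 1) * l)) ⊗ box 2 A l
      ≈⟨ ⊗-cong (⊗-congˡ (≈-trans (𝕢^-merge refl) (≈-sym (𝕢^-merge eq)))) (≈-sym (binom-box 2 A l)) ⟩
    F ⊗ P ⊗ (𝕢^ d ⊗ 𝕢^ e) ⊗ B
      ≈⟨ solve 5 (λ f p x y b → f :* p :* (x :* y) :* b := f :* (x :* b :* (p :* y))) ≈-refl F P (𝕢^ d) (𝕢^ e) B ⟩
    F ⊗ (𝕢^ d ⊗ B ⊗ (P ⊗ 𝕢^ e)) ∎
    where
    F P B : Series
    F = odd (M + A) 1ʷ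
    P = ⟨ q^ (2 * M + 1) ⨾q^ 2 ⟩ A
    B = binom[q^ 2 ] (A + l) A

  term₁-odd : ∀ M A l → 𝕢^ suc (2 * (M + A)) ⊗ odd (suc (M + A)) (δ (2 * M) l) ≈[ n ]
              odd (M + A) 1ʷ ⊗ term₁ (suc (2 * A) + l) A M
  term₁-odd M A l rewrite Exponents.h₁∸A∸1 A l | Exponents.2h₁∸4A A l =
    odd-box M A l (suc (2 * A) + l) ((2 * l + 2) * M) (arith M A l)
    where
    arith : ∀ M A l → (suc (2 * A) + l) + (2 * l + 2) * M ≡ suc (2 * (M + A)) + (2 * M + 1) * l
    arith = ℕ.solve-∀

  -- Column 2M + 1 is replaced by column 2M + 2, so `suc M` takes the place of M. This turns the
  -- base exponent 2M + 1 into 2M + 3 and moves constants from the power of q depending on M into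
  -- the leading one.
  term₂-odd : ∀ M A l → 𝕢^ suc (2 * (suc M + A)) ⊗ odd (suc (suc M + A)) (δ (2 * suc M) l) ≈[ n ]
              odd (suc M + A) 1ʷ ⊗ term₂ (suc (suc (2 * A)) + l) A M
  term₂-odd M A l rewrite Exponents.h₂∸A∸2 A l | Exponents.2h₂∸4A∸2 A l | Exponents.3h₂∸4A∸3 A l = ≈-trans
    (odd-box (suc M) A l (2 * A + 3 * l + 3) ((2 * l + 2) * M) (arith M A l))
    (⊗-congˡ (⊗-congˡ (⊗-congʳ (≡⇒≈ (cong (λ e → ⟨ q^ e ⨾q^ 2 ⟩ A) (base M))))))
    where
    arith : ∀ M A l → (2 * A + 3 * l + 3) + (2 * l + 2) * M ≡ suc (2 * (suc M + A)) + (2 * suc M + 1) * l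
    arith = ℕ.solve-∀
    base : ∀ M → 2 * suc M + 1 ≡ 2 * M + 3
    base = ℕ.solve-∀

  odd-even-column : ∀ h M A →
    𝕢^ suc (2 * (M + A)) ⊗ odd (suc (M + A)) (λ λs → ind (suc (2 * A) + column (2 * M) λs ≟ h)) ≈[ n ]
    odd (M + A) 1ʷ ⊗ cut ⌈ h /2⌉ (λ A → term₁ h A M) A
  odd-even-column h M A with suc (2 * A) ≤? h
  ... | yes 2A<h with l , refl ← ℕ.m≤n⇒∃[o]m+o≡n 2A<h = begin
    𝕢^ suc (2 * (M + A)) ⊗ odd (suc (M + A)) (λ λs → ind (suc (2 * A) + column (2 * M) λs ≟ suc (2 * A) + l))
      ≈⟨ ⊗-congˡ (AllOdd.restricted-cong (2 * suc (M + A))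
           (λ λs → ind (suc (2 * A) + column (2 * M) λs ≟ suc (2 * A) + l)) (δ (2 * M) l)
           λ {λs} _ _ → ind-shift (suc (2 * A)) l (2 * M) λs) ⟩
    𝕢^ suc (2 * (M + A)) ⊗ odd (suc (M + A)) (δ (2 * M) l)
      ≈⟨ term₁-odd M A l ⟩
    odd (M + A) 1ʷ ⊗ term₁ (suc (2 * A) + l) A M
      ≈⟨ ⊗-congˡ (≡⇒≈ (cut-< (λ A′ → term₁ (suc (2 * A) + l) A′ M) A (2n<h⇒n<⌈h/2⌉ 2A<h))) ⟨
    odd (M + A) 1ʷ ⊗ cut ⌈ suc (2 * A) + l /2⌉ (λ A′ → term₁ (suc (2 * A) + l) A′ M) A ∎
  ... | no 2A≮h = begin
    𝕢^ suc (2 * (M + A)) ⊗ odd (suc (M + A)) (λ λs → ind (suc (2 * A) + column (2 * M) λs ≟ h))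
      ≈⟨ ⊗-congˡ (AllOdd.restricted-zero (2 * suc (M + A)) (λ λs → ind (suc (2 * A) + column (2 * M) λs ≟ h))
           λ {λs} _ _ → ind-shift-< (2 * M) λs (ℕ.≰⇒> 2A≮h)) ⟩
    𝕢^ suc (2 * (M + A)) ⊗ 𝟘
      ≈⟨ solve 2 (λ x y → x :* con 0ℤ := y :* con 0ℤ) ≈-refl (𝕢^ suc (2 * (M + A))) (odd (M + A) 1ʷ) ⟩
    odd (M + A) 1ʷ ⊗ 𝟘
      ≈⟨ ⊗-congˡ (≡⇒≈ (cut-≥ (λ A → term₁ h A M) A (ℕ.≮⇒≥ (2A≮h ∘ <⌈n/2⌉ h A)))) ⟨
    odd (M + A) 1ʷ ⊗ cut ⌈ h /2⌉ (λ A → term₁ h A M) A ∎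

  odd-odd-column : ∀ h M A →
    𝕢^ suc (2 * (suc M + A)) ⊗
      odd (suc (suc M + A)) (λ λs → ind (suc (suc (2 * A)) + column (suc (2 * M)) λs ≟ h)) ≈[ n ]
    odd (suc M + A) 1ʷ ⊗ cut ⌊ h /2⌋ (λ A → term₂ h A M) A
  odd-odd-column h M A with suc (suc (2 * A)) ≤? h
  ... | yes 2A+1<h with l , refl ← ℕ.m≤n⇒∃[o]m+o≡n 2A+1<h = begin
    𝕢^ suc (2 * (suc M + A)) ⊗
      odd (suc (suc M + A)) (λ λs → ind (suc (suc (2 * A)) + column (suc (2 * M)) λs ≟ suc (suc (2 * A)) + l))
      ≈⟨ ⊗-congˡ (AllOdd.restricted-cong (2 * suc (suc M + A))
           (λ λs → ind (suc (suc (2 * A)) + column (suc (2 * M)) λs ≟ suc (suc (2 * A)) + l)) (δ (2 * suc M) l)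
           λ {λs} os _ → trans (ind-shift (suc (suc (2 * A))) l (suc (2 * M)) λs)
                                 (cong (λ c → ind (c ≟ l)) (column-odd M os))) ⟩
    𝕢^ suc (2 * (suc M + A)) ⊗ odd (suc (suc M + A)) (δ (2 * suc M) l)
      ≈⟨ term₂-odd M A l ⟩
    odd (suc M + A) 1ʷ ⊗ term₂ (suc (suc (2 * A)) + l) A M
      ≈⟨ ⊗-congˡ (≡⇒≈ (cut-< (λ A′ → term₂ (suc (suc (2 * A)) + l) A′ M) A (2n+1<h⇒n<⌊h/2⌋ 2A+1<h))) ⟨
    odd (suc M + A) 1ʷ ⊗ cut ⌊ suc (suc (2 * A)) + l /2⌋ (λ A′ → term₂ (suc (suc (2 * A)) + l) A′ M) A ∎
  ... | no 2A+1≮h = begin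
    𝕢^ suc (2 * (suc M + A)) ⊗ odd (suc (suc M + A)) (λ λs → ind (suc (suc (2 * A)) + column (suc (2 * M)) λs ≟ h))
      ≈⟨ ⊗-congˡ (AllOdd.restricted-zero (2 * suc (suc M + A))
           (λ λs → ind (suc (suc (2 * A)) + column (suc (2 * M)) λs ≟ h))
           λ {λs} _ _ → ind-shift-< (suc (2 * M)) λs (ℕ.≰⇒> 2A+1≮h)) ⟩
    𝕢^ suc (2 * (suc M + A)) ⊗ 𝟘
      ≈⟨ solve 2 (λ x y → x :* con 0ℤ := y :* con 0ℤ) ≈-refl (𝕢^ suc (2 * (suc M + A))) (odd (suc M + A) 1ʷ) ⟩
    odd (suc M + A) 1ʷ ⊗ 𝟘
      ≈⟨ ⊗-congˡ (≡⇒≈ (cut-≥ (λ A → term₂ h A M) A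
           (ℕ.≮⇒≥ (2A+1≮h ∘ subst (_< h) (ℕ.+-comm (2 * A) 1) ∘ <⌊n/2⌋ h A)))) ⟨
    odd (suc M + A) 1ʷ ⊗ cut ⌊ h /2⌋ (λ A → term₂ h A M) A ∎

  opaque
    unfolding _⊕_

    constant-1−q : ∀ e → (𝟙 ⊕ ⊖ 𝕢^ suc e) 0 ≡ 1ℤ
    constant-1−q e = refl

  -- A row of length 2k + 1 has arm 2(k - M) at column 2M and arm 2(k - M - 1) + 1 at column 2M + 1;
  -- the last argument of `cut` is half the arm, rounded down.
  U₁ U₂ : ℕ → ℕ → ℕ → Series
  U₁ h k M = cut ⌈ h /2⌉ (λ A → term₁ h A M) (k ∸ M)
  U₂ h k M = cut ⌊ h /2⌋ (λ A → term₂ h A M) (k ∸ suc M)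

  -- Removing a part 2k + 1 does not lower the bound, so G′ occurs on both sides of its recursion,
  -- and multiplication by 1 - Q leaves G plus the new rows. The same factor takes F′ to F and is
  -- cancelled at the end.
  odd-#hooks : ∀ h K → odd K (#ʷ h) ≈[ n ]
    odd K 1ʷ ⊗ ∑< K (λ k → ∑< (suc k) (U₁ h k) ⊕ ∑< k (U₂ h k))
  odd-#hooks h zero    = ≈-trans (parts≤-zero (all? odd? ▸ #ʷ h)) (≈-trans (·ˢ-zero 𝟙)
    (solve 1 (λ x → con 0ℤ := x :* con 0ℤ) ≈-refl (odd 0 1ʷ)))
  odd-#hooks h (suc k) = ⊗-cancelˡ (𝟙 ⊕ ⊖ Q) (constant-1−q (2 * k)) (begin
    (𝟙 ⊕ ⊖ Q) ⊗ G′
      ≈⟨ solve 2 (λ q g → (con 1ℤ :+ :- q) :* g := g :+ :- (q :* g)) ≈-refl Q G′ ⟩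
    G′ ⊕ ⊖ (Q ⊗ G′)
      ≈⟨ ⊕-congʳ (odd-suc k (#ʷ h)) ⟩
    G ⊕ Q ⊗ odd (suc k) (#ʷ h ∘ (suc (2 * k) ∷_)) ⊕ ⊖ (Q ⊗ G′)
      ≈⟨ ⊕-congʳ (⊕-congˡ (⊗-congˡ (AllOdd.restricted-#hooks-∷ h (suc (2 * k)) (2 * suc k)))) ⟩
    G ⊕ Q ⊗ (∑< (suc (2 * k)) row ⊕ G′) ⊕ ⊖ (Q ⊗ G′)
      ≈⟨ solve 4 (λ g q s g′ → g :+ q :* (s :+ g′) :+ :- (q :* g′) := g :+ q :* s)
           ≈-refl G Q (∑< (suc (2 * k)) row) G′ ⟩
    G ⊕ Q ⊗ ∑< (suc (2 * k)) row
      ≈⟨ ⊕-cong (odd-#hooks h k) row-sum ⟩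
    F ⊗ S ⊕ F ⊗ W
      ≈⟨ ⊗-distribˡ-⊕ F S W ⟨
    F ⊗ (S ⊕ W)
      ≈⟨ ⊗-congʳ (odd-1-suc k) ⟨
    F′ ⊗ (𝟙 ⊕ ⊖ Q) ⊗ (S ⊕ W)
      ≈⟨ solve 3 (λ f p s → f :* p :* s := p :* (f :* s)) ≈-refl F′ (𝟙 ⊕ ⊖ Q) (S ⊕ W) ⟩
    (𝟙 ⊕ ⊖ Q) ⊗ (F′ ⊗ (S ⊕ W)) ∎)
    where
    G G′ Q F F′ S W : Series
    G  = odd k (#ʷ h)
    G′ = odd (suc k) (#ʷ h)
    Q  = 𝕢^ suc (2 * k)
    F  = odd k 1ʷ
    F′ = odd (suc k) 1ʷ
    S  = ∑< k (λ k → ∑< (suc k) (U₁ h k) ⊕ ∑< k (U₂ h k))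
    W  = ∑< (suc k) (U₁ h k) ⊕ ∑< k (U₂ h k)
    row : ℕ → Series
    row j = odd (suc k) λ λs → ind ((suc (2 * k) ∸ j) + column j λs ≟ h)

    even-row : ∀ M → M ≤ k → Q ⊗ row (2 * M) ≈[ n ] F ⊗ U₁ h k M
    even-row M M≤k with A , refl ← ℕ.m≤n⇒∃[o]m+o≡n M≤k rewrite ℕ.m+n∸m≡n M A = ≈-trans
      (⊗-congˡ (≡⇒≈ (cong (λ s → odd (suc (M + A)) λ λs → ind (s + column (2 * M) λs ≟ h))
        (trans (cong (_∸ 2 * M) (arith M A)) (ℕ.m+n∸m≡n (2 * M) (suc (2 * A)))))))
      (odd-even-column h M A)
      where
      arith : ∀ M A → suc (2 * (M + A)) ≡ 2 * M + suc (2 * A)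
      arith = ℕ.solve-∀

    odd-row : ∀ M → M < k → Q ⊗ row (suc (2 * M)) ≈[ n ] F ⊗ U₂ h k M
    odd-row M M<k with A , refl ← ℕ.m≤n⇒∃[o]m+o≡n M<k rewrite ℕ.m+n∸m≡n M A = ≈-trans
      (⊗-congˡ (≡⇒≈ (cong (λ s → odd (suc (suc M + A)) λ λs → ind (s + column (suc (2 * M)) λs ≟ h))
        (trans (cong (_∸ 2 * M) (arith M A)) (ℕ.m+n∸m≡n (2 * M) (suc (suc (2 * A))))))))
      (odd-odd-column h M A)
      where
      arith : ∀ M A → 2 * (suc M + A) ≡ 2 * M + suc (suc (2 * A))
      arith = ℕ.solve-∀

    row-sum : Q ⊗ ∑< (suc (2 * k)) row ≈[ n ] F ⊗ W
    row-sum = begin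
      Q ⊗ ∑< (suc (2 * k)) row
        ≈⟨ ⊗-congˡ (∑<-parity k row) ⟩
      Q ⊗ (∑< (suc k) (λ M → row (2 * M)) ⊕ ∑< k (λ M → row (suc (2 * M))))
        ≈⟨ ⊗-distribˡ-⊕ Q (∑< (suc k) (λ M → row (2 * M))) (∑< k (λ M → row (suc (2 * M)))) ⟩
      Q ⊗ ∑< (suc k) (λ M → row (2 * M)) ⊕ Q ⊗ ∑< k (λ M → row (suc (2 * M)))
        ≈⟨ ⊕-cong (∑<-⊗ (suc k) Q (λ M → row (2 * M))) (∑<-⊗ k Q (λ M → row (suc (2 * M)))) ⟨
      ∑< (suc k) (λ M → Q ⊗ row (2 * M)) ⊕ ∑< k (λ M → Q ⊗ row (suc (2 * M)))
        ≈⟨ ⊕-cong (∑<-cong (suc k) λ M M<k+1 → even-row M (ℕ.s≤s⁻¹ M<k+1)) (∑<-cong k odd-row) ⟩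
      ∑< (suc k) (λ M → F ⊗ U₁ h k M) ⊕ ∑< k (λ M → F ⊗ U₂ h k M)
        ≈⟨ ⊕-cong (∑<-⊗ (suc k) F (U₁ h k)) (∑<-⊗ k F (U₂ h k)) ⟩
      F ⊗ ∑< (suc k) (U₁ h k) ⊕ F ⊗ ∑< k (U₂ h k)
        ≈⟨ ⊗-distribˡ-⊕ F (∑< (suc k) (U₁ h k)) (∑< k (U₂ h k)) ⟨
      F ⊗ W ∎

  a-formula : ∀ h → odd (suc (h + suc n)) (#ʷ h) ≈[ n ]
      ⟨ -ˢ q^ 1 ⨾q^ 1 ⟩∞ refl *ˢ
        (∑[ i < ⌈ h /2⌉ ] let j = toℕ i in
          q^ h *ˢ binom[q^ 2 ] (h ∸ j ∸ 1) j *ˢ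
            ∑∞ (λ m → ⟨ q^ (2 * m + 1) ⨾q^ 2 ⟩ j *ˢ q^ ((2 * h ∸ 4 * j) * m))
               (summable₁ h i (λ m → ⟨ q^ (2 * m + 1) ⨾q^ 2 ⟩ j)))
      +ˢ
      ⟨ -ˢ q^ 1 ⨾q^ 1 ⟩∞ refl *ˢ
        (∑[ i < ⌊ h /2⌋ ] let j = toℕ i in
          q^ (3 * h ∸ 4 * j ∸ 3) *ˢ binom[q^ 2 ] (h ∸ j ∸ 2) j *ˢ
            ∑∞ (λ m → ⟨ q^ (2 * m + 3) ⨾q^ 2 ⟩ j *ˢ q^ ((2 * h ∸ 4 * j ∸ 2) * m))
               (summable₂ h i (λ m → ⟨ q^ (2 * m + 3) ⨾q^ 2 ⟩ j)))
  a-formula h = begin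
    odd (suc K) (#ʷ h)
      ≈⟨ odd-#hooks h (suc K) ⟩
    odd (suc K) 1ʷ ⊗ ∑< (suc K) (λ k → ∑< (suc k) (U₁ h k) ⊕ ∑< k (U₂ h k))
      ≈⟨ ⊗-cong (odd-1-∞ (suc K) (ℕ.m≤n⇒m≤1+n n≤K)) (∑<-⊕ (suc K) (λ k → ∑< (suc k) (U₁ h k)) (λ k → ∑< k (U₂ h k))) ⟩
    D ⊗ (∑< (suc K) (λ k → ∑< (suc k) (U₁ h k)) ⊕ ∑< (suc K) (λ k → ∑< k (U₂ h k)))
      ≈⟨ ⊗-congˡ (⊕-cong (∑<-cut (term₁ h) (ℕ.m≤n⇒m≤1+n (ℕ.≤-trans (ℕ.⌈n/2⌉≤n h) h≤K)))
                         -- A row of length 1 has no odd column. Dropping this empty summand k = 0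
                         -- costs one row, which explains the additional `suc` in the bound.
                         (≈-trans (∑<-suc K (λ k → ∑< k (U₂ h k))) (≈-trans (⊕-identityˡ _)
                           (∑<-cut (term₂ h) (ℕ.≤-trans (ℕ.⌊n/2⌋≤n h) h≤K))))) ⟩
    D ⊗ (∑< ⌈ h /2⌉ (λ j → ∑< (suc K ∸ j) (term₁ h j)) ⊕ ∑< ⌊ h /2⌋ (λ j → ∑< (K ∸ j) (term₂ h j)))
      ≈⟨ ⊗-congˡ (⊕-cong (∑ˢ-∑< ⌈ h /2⌉ {f = λ j → ∑< (suc K ∸ j) (term₁ h j)} at₁)
                         (∑ˢ-∑< ⌊ h /2⌋ {f = λ j → ∑< (K ∸ j) (term₂ h j)} at₂)) ⟨
    D ⊗ (R₁ ⊕ R₂)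
      ≈⟨ ⊗-distribˡ-⊕ D R₁ R₂ ⟩
    D ⊗ R₁ ⊕ D ⊗ R₂
      ≈⟨ ≡⇒≈ (trans (+ˢ≡⊕ (D *ˢ R₁) (D *ˢ R₂)) (cong₂ _⊕_ (*ˢ≡⊗ D R₁) (*ˢ≡⊗ D R₂))) ⟨
    D *ˢ R₁ +ˢ D *ˢ R₂ ∎
    where
    K : ℕ
    K = h + suc n
    n≤K : n ≤ K
    n≤K = ℕ.≤-trans (ℕ.n≤1+n n) (ℕ.m≤n+m (suc n) h)
    h≤K : h ≤ K
    h≤K = ℕ.m≤m+n h (suc n)
    n<K∸j : ∀ {j} → j ≤ h → n < K ∸ j
    n<K∸j j≤h = ℕ.≤-trans (ℕ.≤-reflexive (sym (ℕ.m+n∸m≡n h (suc n)))) (ℕ.∸-monoʳ-≤ K j≤h)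
    D R₁ R₂ : Series
    D = ⟨ -ˢ q^ 1 ⨾q^ 1 ⟩∞ refl
    summand₁ : Fin ⌈ h /2⌉ → Series
    summand₁ i = let j = toℕ i in
      q^ h *ˢ binom[q^ 2 ] (h ∸ j ∸ 1) j *ˢ
        ∑∞ (λ m → ⟨ q^ (2 * m + 1) ⨾q^ 2 ⟩ j *ˢ q^ ((2 * h ∸ 4 * j) * m))
           (summable₁ h i (λ m → ⟨ q^ (2 * m + 1) ⨾q^ 2 ⟩ j))
    summand₂ : Fin ⌊ h /2⌋ → Series
    summand₂ i = let j = toℕ i in
      q^ (3 * h ∸ 4 * j ∸ 3) *ˢ binom[q^ 2 ] (h ∸ j ∸ 2) j *ˢ
        ∑∞ (λ m → ⟨ q^ (2 * m + 3) ⨾q^ 2 ⟩ j *ˢ q^ ((2 * h ∸ 4 * j ∸ 2) * m))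
           (summable₂ h i (λ m → ⟨ q^ (2 * m + 3) ⨾q^ 2 ⟩ j))
    R₁ = ∑ˢ ⌈ h /2⌉ summand₁
    R₂ = ∑ˢ ⌊ h /2⌋ summand₂
    positive₁ : ∀ j → j < ⌈ h /2⌉ → 0 < 2 * h ∸ 4 * j
    positive₁ j j< with l , e ← ℕ.m≤n⇒∃[o]m+o≡n (<⌈n/2⌉ h j j<) =
      subst (0 <_) (sym (trans (cong (λ h → 2 * h ∸ 4 * j) (sym e)) (Exponents.2h₁∸4A j l)))
        (ℕ.≤-trans (s≤s z≤n) (ℕ.m≤n+m 2 (2 * l)))
    positive₂ : ∀ j → j < ⌊ h /2⌋ → 0 < 2 * h ∸ 4 * j ∸ 2
    positive₂ j j< with l , e ← ℕ.m≤n⇒∃[o]m+o≡n (subst (_< h) (ℕ.+-comm (2 * j) 1) (<⌊n/2⌋ h j j<)) =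
      subst (0 <_) (sym (trans (cong (λ h → 2 * h ∸ 4 * j ∸ 2) (sym e)) (Exponents.2h₂∸4A∸2 j l)))
        (ℕ.≤-trans (s≤s z≤n) (ℕ.m≤n+m 2 (2 * l)))
    at₁ : ∀ i → summand₁ i ≈[ n ] ∑< (suc K ∸ toℕ i) (term₁ h (toℕ i))
    at₁ i = ∑∞-⊗ h (binom[q^ 2 ] (h ∸ j ∸ 1) j) (λ m → ⟨ q^ (2 * m + 1) ⨾q^ 2 ⟩ j) (2 * h ∸ 4 * j)
      (summable₁ h i (λ m → ⟨ q^ (2 * m + 1) ⨾q^ 2 ⟩ j)) (suc K ∸ j) (positive₁ j (Fin.toℕ<n i))
      (ℕ.≤-trans (n<K∸j (ℕ.≤-trans (ℕ.<⇒≤ (Fin.toℕ<n i)) (ℕ.⌈n/2⌉≤n h))) (ℕ.∸-monoˡ-≤ j (ℕ.n≤1+n K)))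
      where
      j : ℕ
      j = toℕ i
    at₂ : ∀ i → summand₂ i ≈[ n ] ∑< (K ∸ toℕ i) (term₂ h (toℕ i))
    at₂ i = ∑∞-⊗ (3 * h ∸ 4 * j ∸ 3) (binom[q^ 2 ] (h ∸ j ∸ 2) j) (λ m → ⟨ q^ (2 * m + 3) ⨾q^ 2 ⟩ j)
      (2 * h ∸ 4 * j ∸ 2) (summable₂ h i (λ m → ⟨ q^ (2 * m + 3) ⨾q^ 2 ⟩ j)) (K ∸ j) (positive₂ j (Fin.toℕ<n i))
      (n<K∸j (ℕ.≤-trans (ℕ.<⇒≤ (Fin.toℕ<n i)) (ℕ.⌊n/2⌋≤n h)))
      where
      j : ℕ
      j = toℕ i

theorem2p1 : (h : ℕ) → 1 ≤ h →
    (a~ h ≈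
    ⟨ -ˢ q^ 1 ⨾q^ 1 ⟩∞ refl *ˢ
    (∑[ i < ⌈ h /2⌉ ] let j = toℕ i in
    q^ h *ˢ binom[q^ 2 ] (h ∸ j ∸ 1) j *ˢ
    ∑∞ (λ m → ⟨ q^ (2 * m + 1) ⨾q^ 2 ⟩ j *ˢ q^ ((2 * h ∸ 4 * j) * m))
    (summable₁ h i (λ m → ⟨ q^ (2 * m + 1) ⨾q^ 2 ⟩ j)))
    +ˢ
    ⟨ -ˢ q^ 1 ⨾q^ 1 ⟩∞ refl *ˢ
    (∑[ i < ⌊ h /2⌋ ] let j = toℕ i in
    q^ (3 * h ∸ 4 * j ∸ 3) *ˢ binom[q^ 2 ] (h ∸ j ∸ 2) j *ˢ
    ∑∞ (λ m → ⟨ q^ (2 * m + 3) ⨾q^ 2 ⟩ j *ˢ q^ ((2 * h ∸ 4 * j ∸ 2) * m))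
    (summable₂ h i (λ m → ⟨ q^ (2 * m + 3) ⨾q^ 2 ⟩ j))))
    ×
    (b~ h ≈
    ⟨ -ˢ q^ 1 ⨾q^ 1 ⟩∞ refl *ˢ
    (∑[ i < ⌈ h /2⌉ ] let j = toℕ i in
    q^ (h + j * (j ∸ 1) / 2) *ˢ binom[q^ 1 ] (h ∸ j ∸ 1) j *ˢ
    ∑∞ (λ m → 1/⟨ -ˢ q^ (suc m) ⨾q^ 1 ⟩ (h ∸ j) refl *ˢ q^ ((j + 1) * m))
    (summable₃ j (λ m → 1/⟨ -ˢ q^ (suc m) ⨾q^ 1 ⟩ (h ∸ j) refl))))
theorem2p1 h _ = a-series , b-series
    where
    n≤K : ∀ n → n ≤ h + suc n
    n≤K n = ℕ.≤-trans (ℕ.n≤1+n n) (ℕ.m≤n+m (suc n) h)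
    a-series = λ n → let open Families n in
      trans (a-coeff h (suc (h + suc n)) (ℕ.m≤n⇒m≤1+n (n≤K n))) (coeff (a-formula h) n ℕ.≤-refl)
    b-series = λ n → let open Families n in
      trans (b-coeff h (h + suc n) (n≤K n)) (coeff (b-formula h) n ℕ.≤-refl)
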